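{- Let $r\geq3$, $t\geq1$, $k_1\geq k_2\geq\cdots\geq k_r\geq t+2$ and $n\geq5-k_1+2k_1\log_2k_1$. If $\mathcal{F}_1\subseteq\Pi_{k_1}(n),\ldots,\mathcal{F}_r\subseteq\Pi_{k_r}(n)$ are non-trivial $r$-cross $t$-intersecting, then $$\prod_{i=1}^r|\mathcal{F}_i|\leq\left((t+1)S(n-t,k_r-t)-tS(n-t-1,k_r-t-1)\right)\prod_{i=1}^{r-1}S(n-t-1,k_i-t-1).$$ If equality holds, then there is an $a\in[r]$ with $k_a=k_r$ and a partition $T$ consisting of $t+1$ singletons such that $\mathcal{F}_a=\{F\in\Pi_{k_a}(n):|T\cap F|\geq t\}$ and $\mathcal{F}_i=\{F\in\Pi_{k_i}(n):T\subseteq F\}$ for each $i\in[r]\setminus\{a\}$.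
   Context: $[n]=\{1,\ldots,n\}$. A partition is a set of pairwise disjoint non-empty sets (blocks); a $k$-partition has $k$ blocks; $\Pi_k(n)$ is the set of $k$-partitions of $[n]$; $S(n,k)=|\Pi_k(n)|$ is the Stirling number of the second kind, with $S(n,a)=0$ for $a\leq 0$. For partitions $P,Q$, $P\cap Q$ is the set of common blocks. For a family $\mathcal{F}$, $\cap\mathcal{F}$ is the set of blocks common to all its members. $\mathcal{F}_1,\ldots,\mathcal{F}_r$ are $r$-cross $t$-intersecting if $|F_1\cap\cdots\cap F_r|\geq t$ for all $F_i\in\mathcal{F}_i$, and non-trivial if $|\bigcap_{i=1}^r(\cap\mathcal{F}_i)|<t$. -}

module Defs where

open import Data.Nat using (ℕ; zero; suc; _+_; _*_; _≤_; _<_; s≤s; z≤n)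
open import Data.Nat.Properties using (_<?_)
open import Data.Bool using (Bool; true; false)
import Data.Bool as Bool
open import Data.Fin using (Fin; toℕ; fromℕ)
open import Data.Fin.Properties using (all?)
open import Data.Fin.Subset using (Subset; Nonempty; Empty; _∩_; ⁅_⁆) renaming (_∈_ to _∈ₛ_)
open import Data.Vec using (Vec; []; _∷_)
open import Data.Vec.Properties using (≡-dec)
open import Data.List using (List; []; _∷_; _++_; map; filter; length; allFin)
open import Data.Nat.ListAction using (product)
open import Data.List.Relation.Unary.All using (All) renaming (all? to allL?)
open import Data.List.Relation.Unary.Any using (Any)
open import Data.List.Relation.Unary.AllPairs using (AllPairs)
open import Data.Product using (_×_; ∃)
open import Relation.Binary.PropositionalEquality using (_≡_; _≢_)
open import Relation.Binary.Definitions using (DecidableEquality)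
open import Relation.Nullary using (¬_)
open import Data.List.Membership.Propositional using () renaming (_∈_ to _∈L_)

_≟ₛ_ : ∀ {n} → DecidableEquality (Subset n)
_≟ₛ_ = ≡-dec Bool._≟_

import Data.List.Membership.DecPropositional
module Mem {n : ℕ} = Data.List.Membership.DecPropositional (_≟ₛ_ {n})
open Mem public using (_∈_; _∈?_)

-- Stirling numbers of the second kind (standard recursion; S(n,0)=[n=0])
S : ℕ → ℕ → ℕ
S zero    zero    = 1
S zero    (suc k) = 0
S (suc n) zero    = 0
S (suc n) (suc k) = suc k * S n (suc k) + S n k

-- A partition of [n] (= Fin n): a finite set of blocks (subsets of [n]),
-- represented by a duplicate-free list; blocks are non-empty, pairwise
-- disjoint, and cover [n].
IsPartition : (n : ℕ) → List (Subset n) → Set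
IsPartition n P =
  AllPairs _≢_ P
  × All Nonempty P
  × AllPairs (λ B C → Empty (B ∩ C)) P
  × (∀ x → Any (x ∈ₛ_) P)

IsKPartition : (n k : ℕ) → List (Subset n) → Set
IsKPartition n k P = IsPartition n P × length P ≡ k

SameBlocks : ∀ {n} → List (Subset n) → List (Subset n) → Set
SameBlocks {n} P Q = (∀ (B : Subset n) → B ∈ P → B ∈ Q) × (∀ (B : Subset n) → B ∈ Q → B ∈ P)

IsKFamily : (n k : ℕ) → List (List (Subset n)) → Set
IsKFamily n k F = All (IsKPartition n k) F × AllPairs (λ P Q → ¬ SameBlocks P Q) F

-- P ∩ Q : common blocks (as a list, duplicate-free when P is)
common : ∀ {n} → List (Subset n) → List (Subset n) → List (Subset n)
common P Q = filter (_∈? Q) P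

lastIdx : (r : ℕ) → 3 ≤ r → Fin r
lastIdx (suc r) _ = fromℕ r

interAll : ∀ {n} (r : ℕ) → 3 ≤ r → (Fin r → List (Subset n)) → List (Subset n)
interAll r h G = filter (λ B → all? (λ i → B ∈? G i)) (G (lastIdx r h))

CrossIntersecting : ∀ {n} (r : ℕ) → 3 ≤ r → ℕ → (Fin r → List (List (Subset n))) → Set
CrossIntersecting {n} r h t 𝓕 =
  ∀ (G : Fin r → List (Subset n)) → (∀ i → G i ∈L 𝓕 i) → t ≤ length (interAll r h G)

allSubsets : (n : ℕ) → List (Subset n)
allSubsets zero = [] ∷ []
allSubsets (suc n) = map (true ∷_) (allSubsets n) ++ map (false ∷_) (allSubsets n)

bigCap : ∀ {n} (r : ℕ) → (Fin r → List (List (Subset n))) → List (Subset n)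
bigCap {n} r 𝓕 = filter (λ B → all? (λ i → allL? (B ∈?_) (𝓕 i))) (allSubsets n)

NonTrivial : ∀ {n} (r : ℕ) → ℕ → (Fin r → List (List (Subset n))) → Set
NonTrivial r t 𝓕 = length (bigCap r 𝓕) < t

∏ : ∀ {r} → (Fin r → ℕ) → ℕ
∏ {r} f = product (map f (allFin r))

∏init : ∀ {r} → (Fin r → ℕ) → ℕ
∏init {r} f = product (map f (filter (λ i → suc (toℕ i) <? r) (allFin r)))

SingletonPartition : ∀ {n} → ℕ → List (Subset n) → Set
SingletonPartition m T = length T ≡ m × AllPairs _≢_ T × All (λ B → ∃ λ x → B ≡ ⁅ x ⁆) T

firstIdx : (r : ℕ) → 3 ≤ r → Fin r
firstIdx (suc r) _ = Data.Fin.zero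

{-# OPTIONS --safe #-}

-- Let (𝓐, 𝓑) be cross s-intersecting, and let α, β be the least sizes of sets of blocks that meet every member of 𝓑, resp. of 𝓐,
-- in s blocks. Each member of 𝓐 shares s blocks with the optimal set of size β, and below size α such a selection can always be
-- extended inside some member of 𝓑. So 𝓐 is covered by at most C(β,s) l^(α-s) sets of α blocks, and symmetrically for 𝓑.
-- Since S(n-j,k-j) ≥ k₁² S(n-j-1,k-j-1) for n ≥ 5 - k₁ + 2 k₁ log k₁, these factors are absorbed and |𝓐||𝓑| ≤ S(n-s,k-s) S(n-s,l-s).
--
-- Call two of the families bad if some of their members share only t blocks; these then lie in all members of all other families.
-- By non-triviality two disjoint pairs of indices are not both bad, so at most three families exceed S(n-t-1,k-t-1). If among
-- three such families all pairs are bad, their product is tiny. Otherwise (𝓑, 𝓓) is cross (t+1)-intersecting, the members of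
-- the third family 𝓐 meet some B ∩ D in t blocks, and the product is largest when B ∩ D consists of t+1 singletons.

module Submission where

open import Defs
open import Data.Bool using (true; false)
open import Data.Nat
  using (ℕ; zero; suc; _+_; _*_; _∸_; _^_; _≤_; _<_; z≤n; s≤s; s≤s⁻¹; NonZero; >-nonZero; _≤?_; _<?_)
open import Data.Nat.Properties
open import Data.Nat.Combinatorics using (_C_; nCk≡nC[n∸k]; nCk+nC[k+1]≡[n+1]C[k+1]; nCn≡1)
open import Data.Nat.ListAction using (sum; product)
open import Data.Nat.ListAction.Properties using (sum-↭; sum-++; product-↭)
open import Data.Nat.Tactic.RingSolver using (solve-∀)
open import Data.Fin using (Fin; toℕ) renaming (_≤_ to _≤ᶠ_)
open import Data.Fin.Properties using (toℕ<n; toℕ-fromℕ; toℕ-injective; ≤fromℕ) renaming (_≟_ to _≟ᶠ_; all? to allF?)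
open import Data.Fin.Subset using (Subset; inside; outside; ⁅_⁆; _∩_; _∪_; _─_; _-_; ∣_∣; Nonempty; Empty)
  renaming (_∈_ to _∈ₛ_; _∉_ to _∉ₛ_; _⊆_ to _⊆ₛ_; ⊤ to full)
open import Data.Fin.Subset.Properties
  using (drop-there; x∈⁅y⁆⇒x≡y; ∣⁅x⁆∣≡1; ∣⊤∣≡n; ∈⊤; x∈p∩q⁺; x∈p∩q⁻; x∈p∪q⁺; x∈p∪q⁻; p─q⊆p; x∈p∧x∉q⇒x∈p─q; p⊆q⇒∣p∣≤∣q∣; nonempty?)
  renaming (_∈?_ to _∈ₛ?_; ⊆-antisym to ⊆ₛ-antisym)
open import Data.Empty using (⊥-elim) renaming (⊥ to ⊥₀)
open import Data.Unit using (⊤; tt)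
open import Data.List using (List; []; _∷_; _++_; map; filter; length; allFin; concatMap; cartesianProduct)
open import Data.List.Properties using (length-map; length-++; filter-accept; filter-reject; filter-all; length-filter; map-++; map-cong; length-tabulate)
open import Data.List.Relation.Unary.All as All using (All; []; _∷_) renaming (all? to allL?)
open import Data.List.Relation.Unary.All.Properties as Allₚ using (¬All⇒Any¬; ¬Any⇒All¬)
open import Data.List.Relation.Unary.Any as Any using (Any; here; there) renaming (any? to anyL?)
open import Data.List.Relation.Unary.Any.Properties as Anyₚ using ()
open import Data.List.Relation.Unary.AllPairs using (AllPairs; []; _∷_)
open import Data.List.Relation.Unary.AllPairs.Properties as AllPairsₚ using ()
open import Data.List.Relation.Unary.Unique.Propositional using (Unique)
open import Data.List.Relation.Unary.Unique.Propositional.Properties as Uniqueₚ using (allFin⁺)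
open import Data.List.Membership.Propositional using (lose; find) renaming (_∈_ to _∈L_; _∉_ to _∉L_)
open import Data.List.Membership.Propositional.Properties using (∈-filter⁺; ∈-filter⁻; ∈-++⁺ˡ; ∈-++⁺ʳ; ∈-map⁺; ∈-∃++; ∈-allFin; ∈-length; ∈-cartesianProduct⁺; ∈-cartesianProduct⁻)
open import Data.List.Relation.Binary.Permutation.Propositional using (_↭_; ↭-refl; ↭-sym; ↭-trans; prep; ↭-reflexive)
open import Data.List.Relation.Binary.Permutation.Propositional.Properties
  using (↭-length; shift; ∈-resp-↭; All-resp-↭; Any-resp-↭; map⁺; filter-↭; drop-∷; ++⁺ˡ; ++-comm)
open import Data.Product using (_×_; _,_; proj₁; proj₂; ∃; ∃-syntax)
open import Data.Sum using (_⊎_; inj₁; inj₂; [_,_]′)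
open import Data.Vec using ([]; _∷_; here; there)
open import Function using (_∘_; id; case_of_)
open import Relation.Nullary using (¬_; Dec; yes; no; contradiction)
open import Relation.Nullary.Decidable using (decidable-stable; toWitness; ¬?; _×-dec_) renaming (map′ to mapDec)
open import Relation.Unary using (Pred; Decidable)
open import Relation.Binary.Definitions using (DecidableEquality)
open import Relation.Binary.PropositionalEquality
  using (_≡_; _≢_; refl; sym; trans; cong; cong₂; subst; subst₂; module ≡-Reasoning)

-- Write K for k₁. The estimates obey a budget: each further fixed block divides the number of
-- partitions by at least K², while a level of branching spends up to K on the choice of a block and
-- up to K on the binomial coefficient. The budget starts only after one block is fixed, and it is
-- void at the bottom, since S(m,1) = 1. This is what forces the separate treatment of k = s + 1 and
-- k = t + 2, where families are compared partition by partition, or K⁴ ≤ S(m,2) is used, or a block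
-- so large that few partitions contain it. The extremal families are never counted from below. In
-- the case of equality a family attains an upper bound that depends only on a condition on its
-- members, so a missing partition that satisfies this condition could be added and would break the
-- bound.

-- Elementary inequalities for Stirling numbers

S-suc-mono : ∀ n k → S n (suc k) ≤ S (suc n) (suc k)
S-suc-mono n k = ≤-trans (m≤n*m (S n (suc k)) (suc k)) (m≤m+n _ _)

S-mono : ∀ {a b} k → a ≤ b → S a (suc k) ≤ S b (suc k)
S-mono {zero} k _ = z≤n
S-mono {suc a} {suc b} k (s≤s a≤b) = S-mono′ a≤b
  where
  S-mono′ : ∀ {a b} → a ≤ b → S (suc a) (suc k) ≤ S (suc b) (suc k)
  S-mono′ {a} {b} a≤b with m≤n⇒m<n∨m≡n a≤b
  ... | inj₂ refl = ≤-refl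
  S-mono′ {a} {suc b} a≤b | inj₁ (s≤s a≤b′) = ≤-trans (S-mono′ a≤b′) (S-suc-mono (suc b) k)

S-pos : ∀ {n k} → k ≤ n → 0 < S (suc n) (suc k)
S-pos {zero} z≤n = s≤s z≤n
S-pos {suc n} {zero} z≤n = ≤-trans (S-pos {n} {zero} z≤n) (S-suc-mono (suc n) 0)
S-pos {suc n} {suc k} (s≤s p) = ≤-trans (S-pos p) (m≤n+m (S (suc n) (suc k)) (suc (suc k) * S (suc n) (suc (suc k))))

S-zero : ∀ {n k} → n < k → S n k ≡ 0
S-zero {zero} {suc k} _ = refl
S-zero {suc n} {suc k} (s≤s n<k) rewrite S-zero (m<n⇒m<1+n n<k) | S-zero n<k = trans (+-identityʳ _) (*-zeroʳ k)

S0≤1 : ∀ n → S n 0 ≤ 1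
S0≤1 zero = ≤-refl
S0≤1 (suc n) = z≤n

S1≡1 : ∀ n → S (suc n) 1 ≡ 1
S1≡1 zero = refl
S1≡1 (suc n) rewrite S1≡1 n = refl

S1≤1 : ∀ n → S n 1 ≤ 1
S1≤1 zero = z≤n
S1≤1 (suc n) = ≤-reflexive (S1≡1 n)

suc-S2 : ∀ n → suc (S (suc n) 2) ≡ 2 ^ n
suc-S2 zero = refl
suc-S2 (suc n) rewrite S1≡1 n | sym (suc-S2 n) = lem (S (suc n) 2)
  where
  lem : ∀ x → suc (2 * x + 1) ≡ 2 * suc x
  lem = solve-∀

S-pow : ∀ m e n → suc m ^ e * S n (suc m) ≤ S (e + n) (suc m)
S-pow m zero n = ≤-reflexive (+-identityʳ _)
S-pow m (suc e) n = begin
  suc m * suc m ^ e * S n (suc m)   ≡⟨ *-assoc (suc m) (suc m ^ e) _ ⟩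
  suc m * (suc m ^ e * S n (suc m)) ≤⟨ *-monoʳ-≤ (suc m) (S-pow m e n) ⟩
  suc m * S (e + n) (suc m)         ≤⟨ m≤m+n _ _ ⟩
  S (suc e + n) (suc m) ∎
  where open ≤-Reasoning

-- Sets of a + 1 and b + 1 points, glued at one point, have a + 1 + b points: each union costs one
-- point. For a single block the inequality would read 1 + 1 ≤ 1, hence the index `2 + m`.
S-superadditive : ∀ m a b → S (suc a) (2 + m) + S (suc b) (2 + m) ≤ S (suc a + b) (2 + m)
S-superadditive m zero b = ≤-reflexive (cong (_+ S (suc b) (2 + m)) (trans (+-identityʳ _) (*-zeroʳ m)))
S-superadditive m (suc a) b = begin
  S (2 + a) k + S (suc b) k                               ≡⟨ lem (k * S (suc a) k) (S (suc a) (1 + m)) (S (suc b) k) ⟩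
  (k * S (suc a) k + S (suc b) k) + S (suc a) (1 + m)     ≤⟨ +-mono-≤ (+-monoʳ-≤ (k * S (suc a) k) (m≤n*m (S (suc b) k) k)) (S-mono m (m≤m+n (suc a) b)) ⟩
  (k * S (suc a) k + k * S (suc b) k) + S (suc a + b) (1 + m) ≡⟨ cong (_+ S (suc a + b) (1 + m)) (*-distribˡ-+ k (S (suc a) k) (S (suc b) k)) ⟨
  k * (S (suc a) k + S (suc b) k) + S (suc a + b) (1 + m) ≤⟨ +-monoˡ-≤ _ (*-monoʳ-≤ k (S-superadditive m a b)) ⟩
  S (2 + a + b) k ∎
  where
  open ≤-Reasoning
  k = 2 + m
  lem : ∀ x y z → (x + y) + z ≡ (x + z) + y
  lem = solve-∀

-- The form for two sets of which d points each are used up by further blocks. If truncation turns a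
-- difference into 0, its term vanishes and monotonicity is enough.
S-superadditive-∸ : ∀ m d a b → 1 ≤ a → 1 ≤ b →
  S (a ∸ d) (2 + m) + S (b ∸ d) (2 + m) ≤ S (a + b ∸ 1 ∸ d) (2 + m)
S-superadditive-∸ m d (suc a) (suc b) _ _ with suc a ∸ d in eqa | suc b ∸ d in eqb
... | zero | y = S-mono (suc m) (≤-trans (≤-reflexive (sym eqb)) (∸-monoˡ-≤ d (m≤n+m (suc b) a)))
... | suc x | zero = ≤-trans (≤-reflexive (+-identityʳ _))
      (S-mono (suc m) (≤-trans (≤-reflexive (sym eqa)) (∸-monoˡ-≤ d (≤-trans (m≤m+n (suc a) b) (≤-reflexive (sym (+-suc a b)))))))
... | suc x | suc y = ≤-trans (S-superadditive m x y) (S-mono (suc m) le)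
  where
  ea : suc a ≡ d + suc x
  ea = trans (sym (m+[n∸m]≡n (<⇒≤ (m∸n≢0⇒n<m {suc a} {d} (λ e → case trans (sym eqa) e of λ ()))))) (cong (d +_) eqa)
  eb : suc b ≡ d + suc y
  eb = trans (sym (m+[n∸m]≡n (<⇒≤ (m∸n≢0⇒n<m {suc b} {d} (λ e → case trans (sym eqb) e of λ ()))))) (cong (d +_) eqb)
  le : suc x + y ≤ a + suc b ∸ d
  le = m+n≤o⇒n≤o∸m d (≤-trans (≤-reflexive (lem₁ d x y)) (s≤s⁻¹ (≤-trans (≤-trans (m≤n+m _ d) (≤-reflexive (lem₂ d x y))) (≤-reflexive (sym (cong₂ _+_ ea eb))))))
    where
    lem₁ : ∀ d x y → d + (suc x + y) ≡ x + (d + suc y)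
    lem₁ = solve-∀
    lem₂ : ∀ d x y → d + suc (x + (d + suc y)) ≡ (d + suc x) + (d + suc y)
    lem₂ = solve-∀
    m+n≤o⇒n≤o∸m : ∀ m {n o} → m + n ≤ o → n ≤ o ∸ m
    m+n≤o⇒n≤o∸m m {n} p = ≤-trans (≤-reflexive (sym (m+n∸m≡n m n))) (∸-monoˡ-≤ m p)

-- Falling factorials and x ^ n = Σ_j S(n,j) x(x-1)⋯(x-j+1).

fall : ℕ → ℕ → ℕ
fall x zero = 1
fall zero (suc j) = 0
fall (suc x) (suc j) = suc x * fall x j

fall-suc : ∀ x j → fall x (suc j) + j * fall x j ≡ x * fall x j
fall-suc zero zero = refl
fall-suc zero (suc j) = *-zeroʳ (suc j)
fall-suc (suc x) zero = +-identityʳ _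
fall-suc (suc x) (suc j) = begin
  suc x * fall x (suc j) + suc j * (suc x * fall x j) ≡⟨ lem₁ x j (fall x (suc j)) (fall x j) ⟩
  suc x * ((fall x (suc j) + j * fall x j) + fall x j) ≡⟨ cong (λ z → suc x * (z + fall x j)) (fall-suc x j) ⟩
  suc x * (x * fall x j + fall x j) ≡⟨ lem₂ x (fall x j) ⟩
  suc x * (suc x * fall x j) ∎
  where
  open ≡-Reasoning
  lem₁ : ∀ x j u v → suc x * u + suc j * (suc x * v) ≡ suc x * ((u + j * v) + v)
  lem₁ = solve-∀
  lem₂ : ∀ x v → suc x * (x * v + v) ≡ suc x * (suc x * v)
  lem₂ = solve-∀

fall-diag-pos : ∀ x → 0 < fall x x
fall-diag-pos zero = s≤s z≤n
fall-diag-pos (suc x) = *-mono-≤ {1} {suc x} {1} (s≤s z≤n) (fall-diag-pos x)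

fall-step : ∀ x j → j < x → fall x j ≤ fall x (suc j)
fall-step (suc x) zero _ = s≤s z≤n
fall-step (suc x) (suc j) (s≤s j<x) = *-monoʳ-≤ (suc x) (fall-step x j j<x)

-- An injection of j ≤ x points into x + 1 values omits a value; sum over the omitted value.
fall≤ : ∀ x j → j ≤ x → fall (suc x) j ≤ suc x * fall x j
fall≤ x zero _ = s≤s z≤n
fall≤ x (suc j) j<x = *-monoʳ-≤ (suc x) (fall-step x j j<x)

Σ≤ : (ℕ → ℕ) → ℕ → ℕ
Σ≤ f zero = f 0
Σ≤ f (suc M) = Σ≤ f M + f (suc M)

Σ≤-mono : ∀ {f g : ℕ → ℕ} M → (∀ j → j ≤ M → f j ≤ g j) → Σ≤ f M ≤ Σ≤ g M
Σ≤-mono zero h = h 0 z≤n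
Σ≤-mono (suc M) h = +-mono-≤ (Σ≤-mono M (λ j p → h j (m≤n⇒m≤1+n p))) (h (suc M) ≤-refl)

Σ≤-*ˡ : ∀ c (f : ℕ → ℕ) M → Σ≤ (λ j → c * f j) M ≡ c * Σ≤ f M
Σ≤-*ˡ c f zero = refl
Σ≤-*ˡ c f (suc M) rewrite Σ≤-*ˡ c f M = sym (*-distribˡ-+ c _ _)

-- Truncating the sums leaves a boundary term. For x = M + 1 it is the last summand of x times the
-- longer sum, which closes the induction in `pow≡Σ-fall`.
S-fall-step : ∀ n x M → Σ≤ (λ j → S (suc n) j * fall x j) (suc M)
  ≡ x * Σ≤ (λ j → S n j * fall x j) M + suc M * (S n (suc M) * fall x (suc M))
S-fall-step n x zero = begin
  0 * 1 + (1 * S n 1 + S n 0) * fall x 1            ≡⟨ lem₁ (S n 1) (S n 0) (fall x 1) ⟩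
  S n 0 * (fall x 1 + 0 * fall x 0) + 1 * (S n 1 * fall x 1) ≡⟨ cong (λ z → S n 0 * z + 1 * (S n 1 * fall x 1)) (fall-suc x 0) ⟩
  S n 0 * (x * 1) + 1 * (S n 1 * fall x 1)          ≡⟨ lem₂ x (S n 0) (1 * (S n 1 * fall x 1)) ⟩
  x * (S n 0 * 1) + 1 * (S n 1 * fall x 1) ∎
  where
  open ≡-Reasoning
  lem₁ : ∀ u w v → 0 + (1 * u + w) * v ≡ w * (v + 0) + 1 * (u * v)
  lem₁ = solve-∀
  lem₂ : ∀ x u v → u * (x * 1) + v ≡ x * (u * 1) + v
  lem₂ = solve-∀
S-fall-step n x (suc M) = begin
  Σ≤ _ (suc M) + (suc (suc M) * S n (suc (suc M)) + S n (suc M)) * f₂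
    ≡⟨ cong (_+ (suc (suc M) * S n (suc (suc M)) + S n (suc M)) * f₂) (S-fall-step n x M) ⟩
  x * Σ≤ _ M + suc M * (S n (suc M) * f₁) + (suc (suc M) * S n (suc (suc M)) + S n (suc M)) * f₂
    ≡⟨ lem₁ (x * Σ≤ (λ j → S n j * fall x j) M) (suc M) (S n (suc M)) f₁ (suc (suc M)) (S n (suc (suc M))) f₂ ⟩
  x * Σ≤ _ M + S n (suc M) * (f₂ + suc M * f₁) + suc (suc M) * (S n (suc (suc M)) * f₂)
    ≡⟨ cong (λ z → x * Σ≤ (λ j → S n j * fall x j) M + S n (suc M) * z + suc (suc M) * (S n (suc (suc M)) * f₂)) (fall-suc x (suc M)) ⟩
  x * Σ≤ _ M + S n (suc M) * (x * f₁) + suc (suc M) * (S n (suc (suc M)) * f₂)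
    ≡⟨ lem₂ x (Σ≤ (λ j → S n j * fall x j) M) (S n (suc M)) f₁ _ ⟩
  x * (Σ≤ _ M + S n (suc M) * f₁) + suc (suc M) * (S n (suc (suc M)) * f₂) ∎
  where
  open ≡-Reasoning
  f₁ = fall x (suc M)
  f₂ = fall x (suc (suc M))
  lem₁ : ∀ a m s f m′ s′ f′ → a + m * (s * f) + (m′ * s′ + s) * f′ ≡ a + s * (f′ + m * f) + m′ * (s′ * f′)
  lem₁ = solve-∀
  lem₂ : ∀ x a s f c → x * a + s * (x * f) + c ≡ x * (a + s * f) + c
  lem₂ = solve-∀

Σ≤-S0 : ∀ x M → Σ≤ (λ j → S 0 j * fall x j) M ≡ 1
Σ≤-S0 x zero = refl
Σ≤-S0 x (suc M) = trans (+-identityʳ _) (Σ≤-S0 x M)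

pow≡Σ-fall : ∀ n x → x ^ n ≡ Σ≤ (λ j → S n j * fall x j) x
pow≡Σ-fall zero x = sym (Σ≤-S0 x x)
pow≡Σ-fall (suc n) zero = refl
pow≡Σ-fall (suc n) (suc x) = sym (begin
  Σ≤ _ (suc x) ≡⟨ S-fall-step n (suc x) x ⟩
  suc x * Σ≤ _ x + suc x * (S n (suc x) * fall (suc x) (suc x)) ≡⟨ *-distribˡ-+ (suc x) (Σ≤ (λ j → S n j * fall (suc x) j) x) (S n (suc x) * fall (suc x) (suc x)) ⟨
  suc x * Σ≤ (λ j → S n j * fall (suc x) j) (suc x) ≡⟨ cong (suc x *_) (pow≡Σ-fall n (suc x)) ⟨
  suc x * suc x ^ n ∎)
  where open ≡-Reasoning

S-fall≤pow : ∀ n x → S n x * fall x x ≤ x ^ n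
S-fall≤pow n zero = ≤-reflexive (sym (pow≡Σ-fall n zero))
S-fall≤pow n (suc x) = ≤-trans (m≤n+m _ _) (≤-reflexive (sym (pow≡Σ-fall n (suc x))))

-- Bonferroni: at most (x+1) x ^ n functions [n] → [x+1] miss a value.
pow≤S-fall+ : ∀ n x → suc x ^ n ≤ suc x * x ^ n + S n (suc x) * fall (suc x) (suc x)
pow≤S-fall+ n x = begin
  suc x ^ n ≡⟨ pow≡Σ-fall n (suc x) ⟩
  Σ≤ (λ j → S n j * fall (suc x) j) x + top ≤⟨ +-monoˡ-≤ top (Σ≤-mono x bound) ⟩
  Σ≤ (λ j → suc x * (S n j * fall x j)) x + top ≡⟨ cong (_+ top) (Σ≤-*ˡ (suc x) _ x) ⟩
  suc x * Σ≤ (λ j → S n j * fall x j) x + top ≡⟨ cong (λ z → suc x * z + top) (pow≡Σ-fall n x) ⟨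
  suc x * x ^ n + top ∎
  where
  open ≤-Reasoning
  top = S n (suc x) * fall (suc x) (suc x)
  bound : ∀ j → j ≤ x → S n j * fall (suc x) j ≤ suc x * (S n j * fall x j)
  bound j j≤x = ≤-trans (*-monoʳ-≤ (S n j) (fall≤ x j j≤x)) (≤-reflexive (lem (S n j) (suc x) (fall x j)))
    where
    lem : ∀ a b c → a * (b * c) ≡ b * (a * c)
    lem = solve-∀

-- Growth of Stirling numbers along diagonals

-- After multiplication by p! the left side is at most c p^N, by counting all functions, and the
-- right side is at least (p+1)^N - p p^N, by `pow≤S-fall+` divided by p + 1.
S-ratio : ∀ c p N → (c + p) * p ^ N ≤ suc p ^ N → c * S N p ≤ S (suc N) (suc p)
S-ratio c p N h = *-cancelʳ-≤ _ _ P {{>-nonZero (fall-diag-pos p)}} (begin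
  c * S N p * P    ≡⟨ *-assoc c _ P ⟩
  c * (S N p * P)  ≤⟨ *-monoʳ-≤ c (S-fall≤pow N p) ⟩
  c * p ^ N        ≤⟨ +-cancelʳ-≤ (p * p ^ N) _ _ step ⟩
  S (suc N) (suc p) * P ∎)
  where
  open ≤-Reasoning
  P = fall p p
  lem₁ : ∀ q pN p s P → q * (p * pN) + s * (q * P) ≡ q * (s * P + p * pN)
  lem₁ = solve-∀
  step : c * p ^ N + p * p ^ N ≤ S (suc N) (suc p) * P + p * p ^ N
  step = begin
    c * p ^ N + p * p ^ N ≡⟨ sym (*-distribʳ-+ (p ^ N) c p) ⟩
    (c + p) * p ^ N ≤⟨ h ⟩
    suc p ^ N ≤⟨ *-cancelˡ-≤ (suc p) (≤-trans (pow≤S-fall+ (suc N) p) (≤-reflexive (lem₁ (suc p) (p ^ N) p (S (suc N) (suc p)) P))) ⟩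
    S (suc N) (suc p) * P + p * p ^ N ∎

^-distribʳ : ∀ e a b → (a * b) ^ e ≡ a ^ e * b ^ e
^-distribʳ zero a b = refl
^-distribʳ (suc e) a b rewrite ^-distribʳ e a b = lem a b (a ^ e) (b ^ e)
  where
  lem : ∀ a b x y → a * b * (x * y) ≡ a * x * (b * y)
  lem = solve-∀

^-cancel-≤ : ∀ e {a b} → a ^ suc e ≤ b ^ suc e → a ≤ b
^-cancel-≤ e {a} {b} h with a ≤? b
... | yes p = p
... | no ¬p = contradiction h (<⇒≱ (^-monoˡ-< (suc e) (≰⇒> ¬p)))

^-swap : ∀ a d e → (a ^ d) ^ e ≡ (a ^ e) ^ d
^-swap a d e = trans (^-*-assoc a d e) (trans (cong (a ^_) (*-comm d e)) (sym (^-*-assoc a e d)))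

n≤n*n : ∀ n → n ≤ n * n
n≤n*n zero = z≤n
n≤n*n (suc n) = m≤m*n (suc n) (suc n)

-- This is (1 + 1/p)^e ≥ 1 + e/p + e(e-1)/(2p²), multiplied by 2p² p^e, with the negative term moved
-- to the right.
binomial₃ : ∀ p e → p ^ e * (2 * (p * p) + 2 * (e * p) + e * e) ≤ 2 * (p * p) * suc p ^ e + e * p ^ e
binomial₃ p zero = ≤-reflexive (lem p)
  where
  lem : ∀ p → 1 * (2 * (p * p) + 2 * 0 + 0) ≡ 2 * (p * p) * 1 + 0
  lem = solve-∀
binomial₃ p (suc e) = +-cancelʳ-≤ (e * P * suc p) _ _ (begin
  p * P * (2 * (p * p) + 2 * (suc e * p) + suc e * suc e) + e * P * suc p
    ≤⟨ +-cancelʳ-≤ (e * e * P) _ _ (≤-trans (≤-reflexive (lem p e P)) (+-monoʳ-≤ _ (*-monoˡ-≤ P (n≤n*n e)))) ⟩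
  P * (2 * (p * p) + 2 * (e * p) + e * e) * suc p + suc e * (p * P)
    ≤⟨ +-monoˡ-≤ (suc e * (p * P)) (*-monoˡ-≤ (suc p) (binomial₃ p e)) ⟩
  (2 * (p * p) * Q + e * P) * suc p + suc e * (p * P)
    ≡⟨ lem₂ p e P Q ⟩
  2 * (p * p) * (suc p * Q) + suc e * (p * P) + e * P * suc p ∎)
  where
  open ≤-Reasoning
  P = p ^ e
  Q = suc p ^ e
  lem : ∀ p e P → p * P * (2 * (p * p) + 2 * (suc e * p) + suc e * suc e) + e * P * suc p + e * e * P
    ≡ P * (2 * (p * p) + 2 * (e * p) + e * e) * suc p + suc e * (p * P) + e * P
  lem = solve-∀
  lem₂ : ∀ p e P Q → (2 * (p * p) * Q + e * P) * suc p + suc e * (p * P)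
    ≡ 2 * (p * p) * (suc p * Q) + suc e * (p * P) + e * P * suc p
  lem₂ = solve-∀

-- From the first three terms of the binomial expansion of (1 + 1/p) ^ (p + 1).
5/2-bound : ∀ p → 1 ≤ p → 5 * p ^ suc p ≤ 2 * suc p ^ suc p
5/2-bound p@(suc _) _ = *-cancelˡ-≤ (p * p) (+-cancelʳ-≤ (suc p * X) _ _ (begin
  p * p * (5 * X) + suc p * X ≤⟨ m≤m+n _ (3 * p * X) ⟩
  p * p * (5 * X) + suc p * X + 3 * p * X ≡⟨ lem p X ⟩
  X * (2 * (p * p) + 2 * (suc p * p) + suc p * suc p) ≤⟨ binomial₃ p (suc p) ⟩
  2 * (p * p) * Y + suc p * X ≡⟨ lem₂ p X Y ⟩
  p * p * (2 * Y) + suc p * X ∎))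
  where
  open ≤-Reasoning
  X = p ^ suc p
  Y = suc p ^ suc p
  lem : ∀ p X → p * p * (5 * X) + suc p * X + 3 * p * X ≡ X * (2 * (p * p) + 2 * (suc p * p) + suc p * suc p)
  lem = solve-∀
  lem₂ : ∀ p X Y → 2 * (p * p) * Y + suc p * X ≡ p * p * (2 * Y) + suc p * X
  lem₂ = solve-∀

-- ... since (5/2) ^ 4 ≥ 2 ^ 5.
32-bound : ∀ p → 1 ≤ p → 32 * p ^ (suc p * 4) ≤ suc p ^ (suc p * 4)
32-bound p h = *-cancelˡ-≤ 16 (begin
  16 * (32 * p ^ (suc p * 4)) ≡⟨ sym (*-assoc 16 32 (p ^ (suc p * 4))) ⟩
  512 * p ^ (suc p * 4) ≤⟨ *-monoˡ-≤ (p ^ (suc p * 4)) (toWitness {a? = 512 ≤? 625} tt) ⟩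
  5 ^ 4 * p ^ (suc p * 4) ≡⟨ cong (5 ^ 4 *_) (sym (^-*-assoc p (suc p) 4)) ⟩
  5 ^ 4 * (p ^ suc p) ^ 4 ≡⟨ sym (^-distribʳ 4 5 (p ^ suc p)) ⟩
  (5 * p ^ suc p) ^ 4 ≤⟨ ^-monoˡ-≤ 4 (5/2-bound p h) ⟩
  (2 * suc p ^ suc p) ^ 4 ≡⟨ ^-distribʳ 4 2 (suc p ^ suc p) ⟩
  16 * (suc p ^ suc p) ^ 4 ≡⟨ cong (16 *_) (^-*-assoc (suc p) (suc p) 4) ⟩
  16 * suc p ^ (suc p * 4) ∎)
  where open ≤-Reasoning

-- What the extreme case q = K - 1 of `numeric` asks for once the hypothesis on n is spent. From K =
-- 23 on, K² ≥ 529 > 2^9 suffices; the twenty smaller values are checked by computation.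
2^9K-bound : ∀ K → 3 ≤ K → 2 ^ (9 * K) ≤ K ^ (2 * K + 8) * 2 ^ 19
2^9K-bound K 3≤K with K <? 23
... | yes K<23 = subst (λ k → 2 ^ (9 * k) ≤ k ^ (2 * k + 8) * 2 ^ 19) (m∸n+n≡m 3≤K)
        (small (+-cancelʳ-< 3 (K ∸ 3) 20 (≤-<-trans (≤-reflexive (m∸n+n≡m 3≤K)) K<23)))
  where
  small : ∀ {i} → i < 20 → 2 ^ (9 * (i + 3)) ≤ (i + 3) ^ (2 * (i + 3) + 8) * 2 ^ 19
  small = toWitness {a? = allUpTo? (λ i → 2 ^ (9 * (i + 3)) ≤? (i + 3) ^ (2 * (i + 3) + 8) * 2 ^ 19) 20} tt
... | no K≮23 = begin
  2 ^ (9 * K) ≡⟨ sym (^-*-assoc 2 9 K) ⟩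
  512 ^ K ≤⟨ ^-monoˡ-≤ K (≤-trans (toWitness {a? = 512 ≤? 23 ^ 2} tt) (^-monoˡ-≤ 2 (≮⇒≥ K≮23))) ⟩
  (K ^ 2) ^ K ≡⟨ ^-*-assoc K 2 K ⟩
  K ^ (2 * K) ≤⟨ ^-monoʳ-≤ K {{>-nonZero (≤-trans (s≤s z≤n) 3≤K)}} (m≤m+n (2 * K) 8) ⟩
  K ^ (2 * K + 8) ≤⟨ m≤m*n (K ^ (2 * K + 8)) (2 ^ 19) ⟩
  K ^ (2 * K + 8) * 2 ^ 19 ∎
  where open ≤-Reasoning

-- K ^ 2K ≤ 2 ^ (2K + c) is the hypothesis of the theorem for n = K + 5 + c.
module Growth (K c : ℕ) (3≤K : 3 ≤ K) (big : K ^ (2 * K) ≤ 2 ^ (2 * K + c)) where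

  private instance
    K≢0 : NonZero K
    K≢0 = >-nonZero (≤-trans (s≤s z≤n) 3≤K)

  1≤2^ : ∀ e → 1 ≤ 2 ^ e
  1≤2^ e = m^n>0 2 e

  -- To base 2 the claim is 4q(1 + 2 log K) ≤ 5(4 + c + q), and five times the hypothesis gives 5c ≥
  -- 10K log K - 10K. The factor `2 ^ (10 * K)` on both sides makes room for the negative term.
  numeric : ∀ q e → q + suc e ≡ K → (2 * (K * K)) ^ (q * 4) ≤ 32 ^ (4 + c + q)
  numeric q e eq = *-cancelʳ-≤ _ _ (2 ^ (10 * K)) {{m^n≢0 2 (10 * K)}} (begin
    (2 * (K * K)) ^ (q * 4) * 2 ^ (10 * K)
      ≡⟨ cong₂ _*_ (^-distribʳ (q * 4) 2 (K * K)) (cong (2 ^_) (trans (lem₁ K) (cong (λ z → 9 * K + z) (sym eq)))) ⟩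
    2 ^ (q * 4) * (K * K) ^ (q * 4) * 2 ^ (9 * K + (q + suc e))
      ≡⟨ cong₂ (λ x y → 2 ^ (q * 4) * x * y) K²^ (^-distribˡ-+-* 2 (9 * K) (q + suc e)) ⟩
    2 ^ (q * 4) * K ^ (8 * q) * (2 ^ (9 * K) * 2 ^ (q + suc e))
      ≤⟨ *-monoʳ-≤ (2 ^ (q * 4) * K ^ (8 * q)) (*-mono-≤ (2^9K-bound K 3≤K) 2^q) ⟩
    2 ^ (q * 4) * K ^ (8 * q) * (K ^ (2 * K + 8) * 2 ^ 19 * (2 ^ suc q * K ^ (8 * e)))
      ≡⟨ lem₂ (2 ^ (q * 4)) (K ^ (8 * q)) (K ^ (2 * K + 8)) (2 ^ 19) (2 ^ suc q) (K ^ (8 * e)) ⟩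
    2 ^ (q * 4) * (2 ^ 19 * 2 ^ suc q) * (K ^ (8 * q) * (K ^ (2 * K + 8) * K ^ (8 * e)))
      ≡⟨ cong₂ _*_ 2s Ks ⟩
    2 ^ (5 * q + 20) * K ^ (2 * K * 5)
      ≤⟨ *-monoʳ-≤ (2 ^ (5 * q + 20)) (≤-trans (≤-reflexive (sym (^-*-assoc K (2 * K) 5)))
           (≤-trans (^-monoˡ-≤ 5 big) (≤-reflexive (^-*-assoc 2 (2 * K + c) 5)))) ⟩
    2 ^ (5 * q + 20) * 2 ^ ((2 * K + c) * 5)
      ≡⟨ sym (^-distribˡ-+-* 2 (5 * q + 20) ((2 * K + c) * 5)) ⟩
    2 ^ (5 * q + 20 + (2 * K + c) * 5)
      ≡⟨ cong (2 ^_) (lem₃ q K c) ⟩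
    2 ^ (5 * (4 + c + q) + 10 * K)
      ≡⟨ ^-distribˡ-+-* 2 (5 * (4 + c + q)) (10 * K) ⟩
    2 ^ (5 * (4 + c + q)) * 2 ^ (10 * K)
      ≡⟨ cong (_* 2 ^ (10 * K)) (sym (^-*-assoc 2 5 (4 + c + q))) ⟩
    32 ^ (4 + c + q) * 2 ^ (10 * K) ∎)
    where
    open ≤-Reasoning
    lem₁ : ∀ K → 10 * K ≡ 9 * K + K
    lem₁ = solve-∀
    lem₂ : ∀ a b c d e f → a * b * (c * d * (e * f)) ≡ a * (d * e) * (b * (c * f))
    lem₂ = solve-∀
    lem₃ : ∀ q K c → 5 * q + 20 + (2 * K + c) * 5 ≡ 5 * (4 + c + q) + 10 * K
    lem₃ = solve-∀
    lem₄ : ∀ q → q * 4 + (19 + suc q) ≡ 5 * q + 20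
    lem₄ = solve-∀
    lem₅ : ∀ q e K → 8 * q + (2 * K + 8 + 8 * e) ≡ 2 * K + 8 * (q + suc e)
    lem₅ = solve-∀
    lem₆ : ∀ K → 2 * K + 8 * K ≡ 2 * K * 5
    lem₆ = solve-∀
    lem₇ : ∀ q → 2 * (q * 4) ≡ 8 * q
    lem₇ = solve-∀
    K²^ : (K * K) ^ (q * 4) ≡ K ^ (8 * q)
    K²^ = trans (cong (_^ (q * 4)) (cong (K *_) (sym (*-identityʳ K)))) (trans (^-*-assoc K 2 (q * 4)) (cong (K ^_) (lem₇ q)))
    2^q : 2 ^ (q + suc e) ≤ 2 ^ suc q * K ^ (8 * e)
    2^q = ≤-trans (≤-reflexive (trans (cong (2 ^_) (+-suc q e)) (^-distribˡ-+-* 2 (suc q) e)))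
      (*-monoʳ-≤ (2 ^ suc q) (≤-trans (^-monoˡ-≤ e (≤-trans (s≤s (s≤s z≤n)) 3≤K)) (^-monoʳ-≤ K (m≤n*m e 8))))
    2s : 2 ^ (q * 4) * (2 ^ 19 * 2 ^ suc q) ≡ 2 ^ (5 * q + 20)
    2s = trans (cong (2 ^ (q * 4) *_) (sym (^-distribˡ-+-* 2 19 (suc q))))
      (trans (sym (^-distribˡ-+-* 2 (q * 4) (19 + suc q))) (cong (2 ^_) (lem₄ q)))
    Ks : K ^ (8 * q) * (K ^ (2 * K + 8) * K ^ (8 * e)) ≡ K ^ (2 * K * 5)
    Ks = trans (cong (K ^ (8 * q) *_) (sym (^-distribˡ-+-* K (2 * K + 8) (8 * e))))
      (trans (sym (^-distribˡ-+-* K (8 * q) (2 * K + 8 + 8 * e)))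
        (cong (K ^_) (trans (lem₅ q e K) (trans (cong (λ z → 2 * K + 8 * z) eq) (lem₆ K)))))

  -- Both sides are raised to the power 4(p+1), at which `32-bound` replaces (1 + 1/p) by 2^5. With
  -- K² + p ≤ 2K² the claim becomes `numeric` for q = p + 1.
  growth : ∀ p → 1 ≤ p → 2 + p ≤ K → (K * K + p) * p ^ (4 + c + suc p) ≤ suc p ^ (4 + c + suc p)
  growth p 1≤p 2+p≤K = ^-cancel-≤ (3 + p * 4) (begin
    ((K * K + p) * p ^ E) ^ (suc p * 4) ≡⟨ ^-distribʳ (suc p * 4) (K * K + p) (p ^ E) ⟩
    (K * K + p) ^ (suc p * 4) * (p ^ E) ^ (suc p * 4) ≤⟨ *-monoˡ-≤ ((p ^ E) ^ (suc p * 4)) (^-monoˡ-≤ (suc p * 4) K²+p≤) ⟩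
    (2 * (K * K)) ^ (suc p * 4) * (p ^ E) ^ (suc p * 4) ≤⟨ *-mono-≤ (numeric (suc p) (K ∸ (2 + p)) (trans (+-suc (suc p) _) (m+[n∸m]≡n 2+p≤K))) (≤-reflexive (^-swap p E (suc p * 4))) ⟩
    32 ^ E * (p ^ (suc p * 4)) ^ E ≡⟨ sym (^-distribʳ E 32 (p ^ (suc p * 4))) ⟩
    (32 * p ^ (suc p * 4)) ^ E ≤⟨ ^-monoˡ-≤ E (32-bound p 1≤p) ⟩
    (suc p ^ (suc p * 4)) ^ E ≡⟨ ^-swap (suc p) (suc p * 4) E ⟩
    (suc p ^ E) ^ (suc p * 4) ∎)
    where
    open ≤-Reasoning
    E = 4 + c + suc p
    K²+p≤ : K * K + p ≤ 2 * (K * K)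
    K²+p≤ = +-monoʳ-≤ (K * K) (≤-trans (≤-trans (m≤n+m p 2) 2+p≤K) (≤-trans (n≤n*n K) (m≤m+n (K * K) 0)))

  S-growth : ∀ p N → 1 ≤ p → 2 + p ≤ K → 4 + c + suc p ≤ N → K * K * S N p ≤ S (suc N) (suc p)
  S-growth p N 1≤p 2+p≤K E≤N = S-ratio (K * K) p N (subst (λ e → (K * K + p) * p ^ e ≤ suc p ^ e) (m+[n∸m]≡n E≤N) (begin
    (K * K + p) * p ^ (E + x) ≡⟨ cong ((K * K + p) *_) (^-distribˡ-+-* p E x) ⟩
    (K * K + p) * (p ^ E * p ^ x) ≡⟨ sym (*-assoc (K * K + p) (p ^ E) (p ^ x)) ⟩
    (K * K + p) * p ^ E * p ^ x ≤⟨ *-mono-≤ (growth p 1≤p 2+p≤K) (^-monoˡ-≤ x (n≤1+n p)) ⟩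
    suc p ^ E * suc p ^ x ≡⟨ sym (^-distribˡ-+-* (suc p) E x) ⟩
    suc p ^ (E + x) ∎))
    where
    open ≤-Reasoning
    E = 4 + c + suc p
    x = N ∸ E

  -- The number is 2^N - 1, and K^4 4^(K-2) ≤ K^(2K) ≤ 4^K 2^c gives K^4 ≤ 2^(4+c). A gain of K^4 in
  -- place of K² makes up for the last level, where S(m,1) = 1 gains nothing.
  S2-growth : ∀ N → 6 + c ≤ N → K ^ 4 ≤ S (suc N) 2
  S2-growth N 6+c≤N = s≤s⁻¹ (begin
    suc (K ^ 4) ≤⟨ +-mono-≤ (m^n>0 K 4) (m≤m+n (K ^ 4) (2 * K ^ 4)) ⟩
    4 * K ^ 4 ≤⟨ *-cancelˡ-≤ (16 * 4 ^ z) {{m*n≢0 16 (4 ^ z) {{_}} {{m^n≢0 4 z}}}} step ⟩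
    2 ^ (6 + c) ≤⟨ ^-monoʳ-≤ 2 6+c≤N ⟩
    2 ^ N ≡⟨ sym (suc-S2 N) ⟩
    suc (S (suc N) 2) ∎)
    where
    open ≤-Reasoning
    z = K ∸ 2
    2+z : 2 + z ≡ K
    2+z = m+[n∸m]≡n (≤-trans (n≤1+n 2) 3≤K)
    lem₁ : ∀ a b → 16 * a * (4 * b) ≡ 64 * (b * a)
    lem₁ = solve-∀
    lem₂ : ∀ z → 4 + 2 * z ≡ 2 * (2 + z)
    lem₂ = solve-∀
    lem₃ : ∀ K c → 6 + (2 * K + c) ≡ 2 * K + (6 + c)
    lem₃ = solve-∀
    step : 16 * 4 ^ z * (4 * K ^ 4) ≤ 16 * 4 ^ z * 2 ^ (6 + c)
    step = begin
      16 * 4 ^ z * (4 * K ^ 4) ≡⟨ lem₁ (4 ^ z) (K ^ 4) ⟩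
      64 * (K ^ 4 * 4 ^ z) ≤⟨ *-monoʳ-≤ 64 (*-monoʳ-≤ (K ^ 4) (^-monoˡ-≤ z (^-monoˡ-≤ 2 (≤-trans (n≤1+n 2) 3≤K)))) ⟩
      64 * (K ^ 4 * (K ^ 2) ^ z) ≡⟨ cong (λ w → 64 * (K ^ 4 * w)) (^-*-assoc K 2 z) ⟩
      64 * (K ^ 4 * K ^ (2 * z)) ≡⟨ cong (64 *_) (trans (sym (^-distribˡ-+-* K 4 (2 * z))) (cong (K ^_) (trans (lem₂ z) (cong (2 *_) 2+z)))) ⟩
      64 * K ^ (2 * K) ≤⟨ *-monoʳ-≤ 64 big ⟩
      2 ^ 6 * 2 ^ (2 * K + c) ≡⟨ sym (^-distribˡ-+-* 2 6 (2 * K + c)) ⟩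
      2 ^ (6 + (2 * K + c)) ≡⟨ cong (2 ^_) (lem₃ K c) ⟩
      2 ^ (2 * K + (6 + c)) ≡⟨ ^-distribˡ-+-* 2 (2 * K) (6 + c) ⟩
      2 ^ (2 * K) * 2 ^ (6 + c) ≡⟨ cong (_* 2 ^ (6 + c)) (trans (sym (^-*-assoc 2 2 K)) (trans (cong (4 ^_) (sym 2+z)) (^-distribˡ-+-* 4 2 z))) ⟩
      16 * 4 ^ z * 2 ^ (6 + c) ∎

  -- If b + 1 blocks partition [n] and 2^|y| ≤ 2b for each block y, multiplying these bounds gives
  -- the inequality refuted here. Since 4b ≤ (b+1)² ≤ K², it would give 2^K 2^n ≤ K^(2K), whereas
  -- the hypothesis makes 2^K 2^n at least 32 K^(2K).
  not-all-small : ∀ b → suc b ≤ K → ¬ (2 ^ (K + 5 + c) ≤ (2 * b) ^ suc b)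
  not-all-small zero sb≤K h = contradiction (≤-trans (1≤2^ (K + 5 + c)) h) λ ()
  not-all-small b@(suc b′) sb≤K h = contradiction (begin
      32 * K ^ (2 * K) ≤⟨ *-monoʳ-≤ 32 big ⟩
      2 ^ 5 * 2 ^ (2 * K + c) ≡⟨ sym (^-distribˡ-+-* 2 5 (2 * K + c)) ⟩
      2 ^ (5 + (2 * K + c)) ≡⟨ cong (2 ^_) (lem₁ K c) ⟩
      2 ^ (K + (K + 5 + c)) ≡⟨ ^-distribˡ-+-* 2 K (K + 5 + c) ⟩
      2 ^ K * 2 ^ (K + 5 + c) ≤⟨ *-monoʳ-≤ (2 ^ K) h ⟩
      2 ^ K * (2 * b) ^ suc b ≤⟨ *-monoʳ-≤ (2 ^ K) (^-monoʳ-≤ (2 * b) sb≤K) ⟩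
      2 ^ K * (2 * b) ^ K ≡⟨ sym (^-distribʳ K 2 (2 * b)) ⟩
      (2 * (2 * b)) ^ K ≤⟨ ^-monoˡ-≤ K (≤-trans (≤-trans (m≤m+n _ (b′ * b′)) (≤-reflexive (lem₂ b′))) (^-monoˡ-≤ 2 sb≤K)) ⟩
      (K ^ 2) ^ K ≡⟨ ^-*-assoc K 2 K ⟩
      K ^ (2 * K) ∎)
    (<⇒≱ (m<n*m (K ^ (2 * K)) 32 {{m^n≢0 K (2 * K)}} (s≤s (s≤s z≤n))))
    where
    open ≤-Reasoning
    m<n*m : ∀ m n .{{_ : NonZero m}} → 1 < n → m < n * m
    m<n*m m n 1<n = subst (m <_) (*-comm m n) (m<m*n m n 1<n)
    lem₁ : ∀ K c → 5 + (2 * K + c) ≡ K + (K + 5 + c)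
    lem₁ = solve-∀
    lem₂ : ∀ b → 2 * (2 * suc b) + b * b ≡ (2 + b) ^ 2
    lem₂ b = trans (lem b) (cong ((2 + b) *_) (sym (*-identityʳ (2 + b))))
      where
      lem : ∀ b → 2 * (2 * suc b) + b * b ≡ (2 + b) * (2 + b)
      lem = solve-∀

-- Log-concavity of the numbers m! S(n,m) of surjections [n] → [m].

surj : ℕ → ℕ → ℕ
surj n m = fall m m * S n m

-- The extra point takes one of m + 1 values; the other points hit all values or all but this one.
surj-suc : ∀ n m → surj (suc n) (suc m) ≡ suc m * (surj n (suc m) + surj n m)
surj-suc n m = lem (suc m) (fall m m) (S n (suc m)) (S n m)
  where
  lem : ∀ a f x y → a * f * (a * x + y) ≡ a * (a * f * x + f * y)
  lem = solve-∀


-- Multiplication by 1 + x preserves log-concavity of the coefficients. The product of the outermost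
-- terms needs two exchanges, and the second requires l < m; so the symmetric case l = m is split
-- off.
sum-logconcave : ∀ (f : ℕ → ℕ) → (∀ {l m} → l ≤ m → f (suc m) * f l ≤ f m * f (suc l)) →
  ∀ {l m} → l ≤ m → (f (2 + m) + f (1 + m)) * (f (1 + l) + f l) ≤ (f (1 + m) + f m) * (f (2 + l) + f (1 + l))
sum-logconcave f h {l} {m} l≤m with m≤n⇒m<n∨m≡n l≤m
... | inj₂ refl = ≤-reflexive (*-comm (f (2 + m) + f (1 + m)) _)
... | inj₁ l<m = begin
  (f (2 + m) + f (1 + m)) * (f (1 + l) + f l)
    ≡⟨ lem₁ (f (2 + m)) (f (1 + m)) (f (1 + l)) (f l) ⟩
  f (2 + m) * f (1 + l) + f (2 + m) * f l + f (1 + m) * f (1 + l) + f (1 + m) * f l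
    ≤⟨ +-mono-≤ (+-mono-≤ (+-mono-≤ (h (s≤s l≤m)) (≤-trans (h (m≤n⇒m≤1+n l≤m)) (h l<m))) ≤-refl) (h l≤m) ⟩
  f (1 + m) * f (2 + l) + f m * f (2 + l) + f (1 + m) * f (1 + l) + f m * f (1 + l)
    ≡⟨ lem₂ (f (1 + m)) (f m) (f (2 + l)) (f (1 + l)) ⟩
  (f (1 + m) + f m) * (f (2 + l) + f (1 + l)) ∎
  where
  open ≤-Reasoning
  lem₁ : ∀ a b x y → (a + b) * (x + y) ≡ a * x + a * y + b * x + b * y
  lem₁ = solve-∀
  lem₂ : ∀ a b x y → a * x + b * x + a * y + b * y ≡ (a + b) * (x + y)
  lem₂ = solve-∀

swap-middle : ∀ a b x y → (a * x) * (b * y) ≡ (a * b) * (x * y)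
swap-middle = solve-∀

-- The recursion `surj-suc` multiplies by factors m + 1, which are log-concave too. All pairs l ≤ m
-- are treated at once, as passing from neighbouring indices to distant ones would mean division by
-- terms that may be 0.
surj-logconcave : ∀ n {l m} → l ≤ m → surj n (suc m) * surj n l ≤ surj n m * surj n (suc l)
surj-logconcave zero {l} {m} _ rewrite *-zeroʳ (fall (suc m) (suc m)) = z≤n
surj-logconcave (suc n) {zero} {m} _ = ≤-trans (≤-reflexive (*-zeroʳ (surj (suc n) (suc m)))) z≤n
surj-logconcave (suc n) {suc l} {suc m} (s≤s l≤m)
  rewrite surj-suc n (suc m) | surj-suc n (suc l) | surj-suc n l | surj-suc n m = begin
  (2 + m) * G₁ m * (suc l * G₀ l)   ≡⟨ swap-middle (2 + m) (suc l) (G₁ m) (G₀ l) ⟩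
  (2 + m) * suc l * (G₁ m * G₀ l)   ≤⟨ *-mono-≤ (coef l≤m) (sum-logconcave (surj n) (surj-logconcave n) l≤m) ⟩
  suc m * (2 + l) * (G₀ m * G₁ l)   ≡⟨ sym (swap-middle (suc m) (2 + l) (G₀ m) (G₁ l)) ⟩
  suc m * G₀ m * ((2 + l) * G₁ l) ∎
  where
  open ≤-Reasoning
  G₀ G₁ : ℕ → ℕ
  G₀ i = surj n (1 + i) + surj n i
  G₁ i = surj n (2 + i) + surj n (1 + i)
  coef : ∀ {l m} → l ≤ m → (2 + m) * suc l ≤ suc m * (2 + l)
  coef {l} {m} l≤m = +-cancelʳ-≤ m _ _ (≤-trans (≤-reflexive (lem l m)) (+-monoʳ-≤ (suc m * (2 + l)) l≤m))
    where
    lem : ∀ l m → (2 + m) * suc l + m ≡ suc m * (2 + l) + l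
    lem = solve-∀

surj-pos : ∀ {n m} → m ≤ n → 0 < surj (suc n) (suc m)
surj-pos {n} {m} m≤n = *-mono-≤ (fall-diag-pos (suc m)) (S-pos m≤n)

-- Strictness comes from the coefficients in `surj-suc`, or for l = 0 from a vanishing left side;
-- `m ≤ suc n` keeps the remaining factors positive.
surj-logconcave-< : ∀ n {l m} → l < m → m ≤ suc n → surj (suc n) (suc m) * surj (suc n) l < surj (suc n) m * surj (suc n) (suc l)
surj-logconcave-< n {zero} {suc m} _ (s≤s m≤n) = ≤-trans (s≤s (≤-reflexive (*-zeroʳ (surj (suc n) (2 + m))))) (*-mono-≤ (surj-pos m≤n) (surj-pos {n} {0} z≤n))
surj-logconcave-< n {suc l} {suc m} (s≤s l<m) (s≤s m≤n) = subst₂ _<_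
    (trans (sym (swap-middle (2 + m) (suc l) (G₁ m) (G₀ l))) (sym (cong₂ _*_ (surj-suc n (suc m)) (surj-suc n l))))
    (trans (sym (swap-middle (suc m) (2 + l) (G₀ m) (G₁ l))) (sym (cong₂ _*_ (surj-suc n m) (surj-suc n (suc l))))) lt
  where
  G₀ G₁ : ℕ → ℕ
  G₀ i = surj n (1 + i) + surj n i
  G₁ i = surj n (2 + i) + surj n (1 + i)
  coef : ∀ {l m} → l < m → (2 + m) * suc l < suc m * (2 + l)
  coef {l} {m} l<m = +-cancelʳ-< m _ _ (≤-<-trans (≤-reflexive (lem l m)) (+-monoʳ-< (suc m * (2 + l)) l<m))
    where
    lem : ∀ l m → (2 + m) * suc l + m ≡ suc m * (2 + l) + l
    lem = solve-∀
  G-pos : ∀ i → i ≤ n → NonZero (G₀ i)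
  G-pos i i≤n with G₀ i in eq
  ... | suc _ = _
  ... | zero = contradiction (surj-pos i≤n) (<⇒≱ (s≤s (≤-reflexive (trans (surj-suc n i) (trans (cong (suc i *_) eq) (*-zeroʳ (suc i)))))))
  lt : (2 + m) * suc l * (G₁ m * G₀ l) < suc m * (2 + l) * (G₀ m * G₁ l)
  lt = ≤-<-trans (*-monoʳ-≤ ((2 + m) * suc l) (sum-logconcave (surj n) (surj-logconcave n) (<⇒≤ l<m)))
    (*-monoˡ-< (G₀ m * G₁ l) {{m*n≢0 (G₀ m) (G₁ l) {{G-pos m m≤n}} {{G-pos (suc l) (≤-trans l<m m≤n)}}}} (coef l<m))

-- For σ = `surj (suc n)` the quotient of S(n+2,i+1) by S(n+1,i) is 1 + σ(i+1)/σ(i), which decreases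
-- by log-concavity. Strictness is what later yields k_a = k_r in the case of equality.
S-ratio-decreasing : ∀ n {j i} → j < i → i ≤ suc n →
  S (2 + n) (suc i) * S (suc n) j < S (2 + n) (suc j) * S (suc n) i
S-ratio-decreasing n {j} {i} j<i i≤ = *-cancelˡ-< (fall i i * fall j j) _ _ (subst₂ _<_ (eq i j) (trans (eq j i) (cong (_* (S (2 + n) (suc j) * S (suc n) i)) (*-comm (fall j j) (fall i i))))
    (≤-<-trans (≤-reflexive (*-distribʳ-+ (σ j) (σ (suc i)) (σ i))) (<-≤-trans (+-monoˡ-< (σ i * σ j) (surj-logconcave-< n j<i i≤))
      (≤-reflexive (lem (σ i) (σ (suc j)) (σ j))))))
  where
  σ = surj (suc n)
  lem : ∀ a b c → a * b + a * c ≡ (b + c) * a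
  lem = solve-∀
  eq : ∀ i j → (σ (suc i) + σ i) * σ j ≡ fall i i * fall j j * (S (2 + n) (suc i) * S (suc n) j)
  eq i j = lem₂ (suc i) (fall i i) (S (suc n) (suc i)) (S (suc n) i) (fall j j) (S (suc n) j)
    where
    lem₂ : ∀ a f x y g z → (a * f * x + f * y) * (g * z) ≡ f * g * ((a * x + y) * z)
    lem₂ = solve-∀

-- Lists up to permutation

module _ {a} {A : Set a} where

  module _ {p q} {P : Pred A p} {Q : Pred A q} where

    any-─ : ∀ {ys} (p : Any P ys) → Any Q ys → Any (λ y → P y × Q y) ys ⊎ Any Q (ys Any.─ p)
    any-─ (here py)  (here qy)  = inj₁ (here (py , qy))
    any-─ (here py)  (there qs) = inj₂ qs
    any-─ (there ps) (here qy)  = inj₂ (here qy)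
    any-─ (there ps) (there qs) with any-─ ps qs
    ... | inj₁ both = inj₁ (there both)
    ... | inj₂ rest = inj₂ (there rest)

  length-─ : ∀ {p} {P : Pred A p} {ys} (p : Any P ys) → suc (length (ys Any.─ p)) ≡ length ys
  length-─ (here _)   = refl
  length-─ (there ps) = cong suc (length-─ ps)

module _ {a} {A : Set a} where

  AllPairs-↭ : ∀ {r} {R : A → A → Set r} → (∀ {x y} → R x y → R y x) →
    ∀ {xs ys} → xs ↭ ys → AllPairs R xs → AllPairs R ys
  AllPairs-↭ s _↭_.refl ps = ps
  AllPairs-↭ s (_↭_.prep x p) (h ∷ ps) = All-resp-↭ p h ∷ AllPairs-↭ s p ps
  AllPairs-↭ s (_↭_.swap x y p) ((xy ∷ h) ∷ h′ ∷ ps) = (s xy ∷ All-resp-↭ p h′) ∷ All-resp-↭ p h ∷ AllPairs-↭ s p ps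
  AllPairs-↭ s (_↭_.trans p q) ps = AllPairs-↭ s q (AllPairs-↭ s p ps)

  Unique-↭ : {xs ys : List A} → xs ↭ ys → Unique xs → Unique ys
  Unique-↭ = AllPairs-↭ (λ ne e → ne (sym e))

  ∈⇒↭ : ∀ {x : A} {xs} → x ∈L xs → ∃ λ ys → xs ↭ x ∷ ys
  ∈⇒↭ {x} x∈ with ∈-∃++ x∈
  ... | ys , zs , refl = ys ++ zs , shift x ys zs

  ⊆⇒↭ : ∀ {xs ys : List A} → Unique xs → All (_∈L ys) xs → ∃ λ zs → ys ↭ xs ++ zs
  ⊆⇒↭ {[]} {ys} _ _ = ys , ↭-refl
  ⊆⇒↭ {x ∷ xs} (x∉ ∷ u) (x∈ ∷ xs∈) with ∈⇒↭ x∈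
  ... | ys′ , p with ⊆⇒↭ u (All.zipWith tail∈ (x∉ , xs∈))
    where
    tail∈ : ∀ {z} → (x ≢ z) × (z ∈L _) → z ∈L ys′
    tail∈ (x≢z , z∈) with ∈-resp-↭ p z∈
    ... | here e   = ⊥-elim (x≢z (sym e))
    ... | there z∈′ = z∈′
  ... | zs , q = zs , ↭-trans p (prep x q)

  -- Each x takes its partner out of `ys`. The relation `_≈_` is left open because members of a
  -- family are kept apart by `SameBlocks`, not by inequality of lists.
  pigeonhole : ∀ {b e r} {B : Set b} {_≈_ : A → A → Set e} (R : A → B → Set r) →
    (∀ {x x′ y} → R x y → R x′ y → x ≈ x′) →
    ∀ {xs ys} → AllPairs (λ x x′ → ¬ (x ≈ x′)) xs → All (λ x → Any (R x) ys) xs → length xs ≤ length ys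
  pigeonhole R join {[]} _ _ = z≤n
  pigeonhole R join {x ∷ xs} (x≉ ∷ ps) (ax ∷ axs) =
    ≤-trans (s≤s (pigeonhole R join ps (All.zipWith move (x≉ , axs)))) (≤-reflexive (length-─ ax))
    where
    move : ∀ {z} → (¬ _) × Any (R z) _ → Any (R z) (_ Any.─ ax)
    move (x≉z , az) with any-─ ax az
    ... | inj₁ both = let (rx , rz) = proj₂ (Any.satisfied both) in ⊥-elim (x≉z (join rx rz))
    ... | inj₂ rest = rest

  unique-length-≤ : {xs ys : List A} → Unique xs → All (_∈L ys) xs → length xs ≤ length ys
  unique-length-≤ = pigeonhole _≡_ (λ e e′ → trans e (sym e′))

  module _ (_≟_ : DecidableEquality A) where
    open import Data.List.Membership.DecPropositional _≟_ using () renaming (_∈?_ to _∈L?_)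

    unique-⊆⇒⊇ : {xs ys : List A} → Unique xs → All (_∈L ys) xs → length ys ≤ length xs → All (_∈L xs) ys
    unique-⊆⇒⊇ {xs} {ys} u xs⊆ys le = All.tabulate λ {y} y∈ → case y ∈L? xs of λ where
      (yes y∈xs) → y∈xs
      (no  y∉xs) → contradiction (unique-length-≤ (¬Any⇒All¬ xs y∉xs ∷ u) (y∈ ∷ xs⊆ys)) (<⇒≱ (s≤s le))

-- Partitions of a subset U of [n]

Disjoint : ∀ {n} → Subset n → Subset n → Set
Disjoint B B′ = Empty (B ∩ B′)

-- Partitions are taken relative to a subset of a fixed ground set, so that removing a block or a
-- point needs no relabelling of the remaining points.
record PartOf {n} (U : Subset n) (P : List (Subset n)) : Set where
  constructor mkPart
  field
    nonempty : All Nonempty P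
    disjoint : AllPairs Disjoint P
    cover    : ∀ x → x ∈ₛ U → Any (x ∈ₛ_) P
    inside-U : All (_⊆ₛ U) P
open PartOf

variable
  n : ℕ

∉-─ : ∀ (p q : Subset n) {x} → x ∈ₛ p ─ q → x ∉ₛ q
∉-─ (_ ∷ p) (inside ∷ q) (there x∈) (there x∈′) = ∉-─ p q x∈ x∈′
∉-─ (_ ∷ p) (outside ∷ q) (there x∈) (there x∈′) = ∉-─ p q x∈ x∈′

∣─∣ : ∀ (p q : Subset n) → q ⊆ₛ p → ∣ p ─ q ∣ + ∣ q ∣ ≡ ∣ p ∣
∣─∣ [] [] _ = refl
∣─∣ (outside ∷ p) (inside ∷ q) q⊆p with q⊆p here
... | ()
∣─∣ (inside ∷ p) (inside ∷ q) q⊆p = trans (+-suc _ _) (cong suc (∣─∣ p q (λ x∈ → drop-there (q⊆p (there x∈)))))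
∣─∣ (outside ∷ p) (outside ∷ q) q⊆p = ∣─∣ p q (λ x∈ → drop-there (q⊆p (there x∈)))
∣─∣ (inside ∷ p) (outside ∷ q) q⊆p = cong suc (∣─∣ p q (λ x∈ → drop-there (q⊆p (there x∈))))

∣∣≡suc⇒Nonempty : ∀ (p : Subset n) {u} → ∣ p ∣ ≡ suc u → Nonempty p
∣∣≡suc⇒Nonempty (inside ∷ p) _ = Fin.zero , here
∣∣≡suc⇒Nonempty (outside ∷ p) e with ∣∣≡suc⇒Nonempty p e
... | x , x∈ = Fin.suc x , there x∈

∈⇒⁅⁆⊆ : ∀ {x : Fin n} {p} → x ∈ₛ p → ⁅ x ⁆ ⊆ₛ p
∈⇒⁅⁆⊆ {x = x} x∈p z∈ rewrite x∈⁅y⁆⇒x≡y x z∈ = x∈p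

∣∣-mono : {p q : Subset n} → p ⊆ₛ q → ∣ p ∣ ≤ ∣ q ∣
∣∣-mono = p⊆q⇒∣p∣≤∣q∣

Nonempty⇒1≤∣∣ : {p : Subset n} → Nonempty p → 1 ≤ ∣ p ∣
Nonempty⇒1≤∣∣ (x , x∈) = subst (_≤ _) (∣⁅x⁆∣≡1 x) (∣∣-mono (∈⇒⁅⁆⊆ x∈))

∣-∣ : ∀ (U : Subset n) {y u} → y ∈ₛ U → ∣ U ∣ ≡ suc u → ∣ U - y ∣ ≡ u
∣-∣ U {y} y∈U e = suc-injective (trans (trans (+-comm 1 _) (trans (cong (∣ U - y ∣ +_) (sym (∣⁅x⁆∣≡1 y))) (∣─∣ U ⁅ y ⁆ (∈⇒⁅⁆⊆ y∈U)))) e)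

Disjoint-sym : {B B′ : Subset n} → Disjoint B B′ → Disjoint B′ B
Disjoint-sym {B = B} {B′} d (x , x∈) = let (a , b) = x∈p∩q⁻ B′ B x∈ in d (x , x∈p∩q⁺ (b , a))

PartOf-↭ : ∀ {U : Subset n} {P Q} → P ↭ Q → PartOf U P → PartOf U Q
PartOf-↭ p (mkPart ne d c i) = mkPart (All-resp-↭ p ne) (AllPairs-↭ (λ {x} {y} → Disjoint-sym {B = x} {y}) p d)
  (λ x x∈ → Any-resp-↭ p (c x x∈)) (All-resp-↭ p i)

PartOf-tail : ∀ {U B : Subset n} {Q} → PartOf U (B ∷ Q) → PartOf (U ─ B) Q
PartOf-tail {U = U} {B} {Q} (mkPart (_ ∷ ne) (dB ∷ d) c (_ ∷ i)) = mkPart ne d cov (All.zipWith ins (dB , i))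
  where
  cov : ∀ x → x ∈ₛ U ─ B → Any (x ∈ₛ_) Q
  cov x x∈ with c x (p─q⊆p U B x∈)
  ... | here x∈B = ⊥-elim (∉-─ U B x∈ x∈B)
  ... | there a = a
  ins : ∀ {B′} → Disjoint B B′ × B′ ⊆ₛ U → B′ ⊆ₛ U ─ B
  ins (dis , B′⊆U) {x} x∈ = x∈p∧x∉q⇒x∈p─q (B′⊆U x∈) (λ x∈B → dis (x , x∈p∩q⁺ (x∈B , x∈)))

PartOf-shrink : ∀ {U B : Subset n} {Q y} → y ∈ₛ B → Nonempty (B - y) → PartOf U (B ∷ Q) → PartOf (U - y) ((B - y) ∷ Q)
PartOf-shrink {U = U} {B} {Q} {y} y∈B neB (mkPart (_ ∷ ne) (dB ∷ d) c (B⊆U ∷ i)) =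
  mkPart (neB ∷ ne) (All.map dis dB ∷ d) cov (sub ∷ All.zipWith ins (dB , i))
  where
  dis : ∀ {B′} → Disjoint B B′ → Disjoint (B - y) B′
  dis {B′} e (x , x∈) = let (a , b) = x∈p∩q⁻ (B - y) B′ x∈ in e (x , x∈p∩q⁺ (p─q⊆p B ⁅ y ⁆ a , b))
  cov : ∀ x → x ∈ₛ U - y → Any (x ∈ₛ_) ((B - y) ∷ Q)
  cov x x∈ with c x (p─q⊆p U ⁅ y ⁆ x∈)
  ... | here x∈B = here (x∈p∧x∉q⇒x∈p─q x∈B (∉-─ U ⁅ y ⁆ x∈))
  ... | there a = there a
  sub : B - y ⊆ₛ U - y
  sub x∈ = x∈p∧x∉q⇒x∈p─q (B⊆U (p─q⊆p B ⁅ y ⁆ x∈)) (∉-─ B ⁅ y ⁆ x∈)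
  ins : ∀ {B′} → Disjoint B B′ × B′ ⊆ₛ U → B′ ⊆ₛ U - y
  ins (e , B′⊆U) {x} x∈ = x∈p∧x∉q⇒x∈p─q (B′⊆U x∈) (λ x∈y → e (x , x∈p∩q⁺ (subst (_∈ₛ B) (sym (x∈⁅y⁆⇒x≡y y x∈y)) y∈B , x∈)))

-∪ : ∀ (B : Subset n) {y} → y ∈ₛ B → (B - y) ∪ ⁅ y ⁆ ≡ B
-∪ B {y} y∈B = ⊆ₛ-antisym to from
  where
  to : (B - y) ∪ ⁅ y ⁆ ⊆ₛ B
  to x∈ with x∈p∪q⁻ (B - y) ⁅ y ⁆ x∈
  ... | inj₁ a = p─q⊆p B ⁅ y ⁆ a
  ... | inj₂ b = ∈⇒⁅⁆⊆ y∈B b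
  from : B ⊆ₛ (B - y) ∪ ⁅ y ⁆
  from {x} x∈ with x ∈ₛ? ⁅ y ⁆
  ... | yes p = x∈p∪q⁺ (inj₂ p)
  ... | no ¬p = x∈p∪q⁺ (inj₁ (x∈p∧x∉q⇒x∈p─q x∈ ¬p))

inserts : Fin n → List (Subset n) → List (List (Subset n))
inserts y []      = []
inserts y (B ∷ Q) = ((B ∪ ⁅ y ⁆) ∷ Q) ∷ map (B ∷_) (inserts y Q)

length-inserts : ∀ (y : Fin n) Q → length (inserts y Q) ≡ length Q
length-inserts y [] = refl
length-inserts y (B ∷ Q) = cong suc (trans (length-map (B ∷_) (inserts y Q)) (length-inserts y Q))

inserts-lengths : ∀ (y : Fin n) Q → All (λ Q′ → length Q′ ≡ length Q) (inserts y Q)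
inserts-lengths y [] = []
inserts-lengths y (B ∷ Q) = refl ∷ Allₚ.map⁺ (All.map (cong suc) (inserts-lengths y Q))

inserts-∈ : ∀ (y : Fin n) {B Q} → B ∈L Q → ∃ λ R → Q ↭ B ∷ R × Any ((B ∪ ⁅ y ⁆ ∷ R) ↭_) (inserts y Q)
inserts-∈ y {Q = _ ∷ Q} (here refl) = Q , ↭-refl , here ↭-refl
inserts-∈ y {B} {D ∷ Q} (there B∈) with inserts-∈ y B∈
... | R , p , a = D ∷ R , ↭-trans (prep D p) (_↭_.swap D B ↭-refl) ,
      there (Anyₚ.map⁺ (Any.map (λ q → ↭-trans (_↭_.swap (B ∪ ⁅ y ⁆) D ↭-refl) (prep D q)) a))

length-concatMap : ∀ {a b} {A : Set a} {B : Set b} (f : A → List B) {k} xs → All (λ x → length (f x) ≡ k) xs →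
  length (concatMap f xs) ≡ length xs * k
length-concatMap f [] _ = refl
length-concatMap f (x ∷ xs) (e ∷ es) = trans (length-++ (f x)) (cong₂ _+_ e (length-concatMap f xs es))

-- Made for upper bounds only: `list` may repeat partitions or contain other lists, but every
-- partition with property R occurs in it up to the order of blocks.
record Enumeration {n} (U : Subset n) (k s : ℕ) (R : List (Subset n) → Set) : Set where
  field
    list     : List (List (Subset n))
    size     : length list ≡ s
    lengths  : All (λ Q → length Q ≡ k) list
    complete : ∀ P → PartOf U P → length P ≡ k → R P → Any (P ↭_) list
open Enumeration

Always : List (Subset n) → Set
Always _ = ⊤

-- A block B ∋ y other than {y} arises by inserting y into the block B - y of a partition of U - y.
enumerate-≢⁅y⁆ : ∀ {U : Subset n} {y k s} → y ∈ₛ U → Enumeration (U - y) k s Always → Enumeration U k (s * k) (λ P → ⁅ y ⁆ ∉L P)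
enumerate-≢⁅y⁆ {U = U} {y} {k} y∈U E = record
  { list = concatMap (inserts y) (list E)
  ; size = trans (length-concatMap (inserts y) (list E) (All.map (λ {Q} e → trans (length-inserts y Q) e) (lengths E))) (cong (_* k) (size E))
  ; lengths = Allₚ.concat⁺ (Allₚ.map⁺ (All.map (λ {Q} e → All.map (λ e′ → trans e′ e) (inserts-lengths y Q)) (lengths E)))
  ; complete = comp
  }
  where
  comp : ∀ P → PartOf U P → length P ≡ k → ⁅ y ⁆ ∉L P → Any (P ↭_) (concatMap (inserts y) (list E))
  comp P part len y∉P with find (cover part y y∈U)
  ... | B , B∈P , y∈B with ∈⇒↭ B∈P
  ... | Q , P↭ with nonempty? (B - y)
  ...   | no empty = ⊥-elim (y∉P (subst (_∈L P) B≡ B∈P))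
    where
    B≡ : B ≡ ⁅ y ⁆
    B≡ = ⊆ₛ-antisym (λ {x} x∈ → case x ∈ₛ? ⁅ y ⁆ of λ { (yes p) → p ; (no ¬p) → ⊥-elim (empty (x , x∈p∧x∉q⇒x∈p─q x∈ ¬p)) }) (∈⇒⁅⁆⊆ y∈B)
  ...   | yes ne = Anyₚ.concatMap⁺ (inserts y) (Any.map step (complete E ((B - y) ∷ Q) (PartOf-shrink y∈B ne (PartOf-↭ P↭ part)) (trans (sym (↭-length P↭)) len) tt))
    where
    step : ∀ {Q′} → (B - y) ∷ Q ↭ Q′ → Any (P ↭_) (inserts y Q′)
    step {Q′} p with inserts-∈ y (∈-resp-↭ p (here refl))
    ... | R , q , a = Any.map (λ w → ↭-trans P↭ (↭-trans (prep B (drop-∷ (↭-trans p q))) w))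
                        (subst (λ D → Any ((D ∷ R) ↭_) (inserts y Q′)) (-∪ B y∈B) a)

PartOf-full : ∀ {U : Subset n} → PartOf U [] → ∣ U ∣ ≡ 0
PartOf-full {U = U} part with ∣ U ∣ in eq
... | zero = refl
... | suc u with cover part _ (proj₂ (∣∣≡suc⇒Nonempty U eq))
...   | ()

PartOf-∣∣0 : ∀ {U : Subset n} {B Q} → ∣ U ∣ ≡ 0 → ¬ PartOf U (B ∷ Q)
PartOf-∣∣0 e (mkPart (ne ∷ _) _ _ (B⊆U ∷ _)) = contradiction (≤-trans (Nonempty⇒1≤∣∣ ne) (∣∣-mono B⊆U)) (<⇒≱ (s≤s (≤-reflexive e)))

enumerate : ∀ u (U : Subset n) → ∣ U ∣ ≡ u → ∀ k → Enumeration U k (S u k) Always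
enumerate zero U e zero = record { list = [] ∷ [] ; size = refl ; lengths = refl ∷ [] ; complete = λ where [] _ _ _ → here ↭-refl }
enumerate zero U e (suc k) = record { list = [] ; size = refl ; lengths = [] ; complete = λ where (B ∷ Q) part _ _ → ⊥-elim (PartOf-∣∣0 e part) }
enumerate (suc u) U e zero = record { list = [] ; size = refl ; lengths = [] ; complete = λ where [] part _ _ → ⊥-elim (case trans (sym (PartOf-full part)) e of λ ()) }
enumerate (suc u) U e (suc k) with ∣∣≡suc⇒Nonempty U e
... | y , y∈U = record
  { list = list E₁ ++ map (⁅ y ⁆ ∷_) (list E₂)
  ; size = trans (length-++ (list E₁)) (cong₂ _+_ (trans (size E₁) (*-comm (S u (suc k)) (suc k))) (trans (length-map _ (list E₂)) (size E₂)))
  ; lengths = Allₚ.++⁺ (lengths E₁) (Allₚ.map⁺ (All.map (cong suc) (lengths E₂)))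
  ; complete = comp
  }
  where
  E₁ = enumerate-≢⁅y⁆ y∈U (enumerate u (U - y) (∣-∣ U y∈U e) (suc k))
  E₂ = enumerate u (U - y) (∣-∣ U y∈U e) k
  comp : ∀ P → PartOf U P → length P ≡ suc k → Always P → Any (P ↭_) (list E₁ ++ map (⁅ y ⁆ ∷_) (list E₂))
  comp P part len _ with ⁅ y ⁆ ∈? P
  ... | no ∉P = Anyₚ.++⁺ˡ (complete E₁ P part len ∉P)
  ... | yes ∈P with ∈⇒↭ ∈P
  ...   | Q , P↭ = Anyₚ.++⁺ʳ (list E₁) (Anyₚ.map⁺ (Any.map (λ w → ↭-trans P↭ (prep ⁅ y ⁆ w))
                (complete E₂ Q (PartOf-tail (PartOf-↭ P↭ part)) (suc-injective (trans (sym (↭-length P↭)) len)) tt)))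

-- Families of partitions containing a given set of blocks

infix 4 _⊑_
_⊑_ : ∀ {a} {A : Set a} → List A → List A → Set a
X ⊑ A = All (_∈L A) X

infixl 5 _─*_
_─*_ : Subset n → List (Subset n) → Subset n
U ─* []      = U
U ─* (B ∷ X) = (U ─ B) ─* X

weight : List (Subset n) → ℕ
weight = sum ∘ map ∣_∣

PartOf-++ : ∀ {U : Subset n} X {R} → PartOf U (X ++ R) → PartOf (U ─* X) R
PartOf-++ []      part = part
PartOf-++ (B ∷ X) part = PartOf-++ X (PartOf-tail part)

∣─*∣ : ∀ {U : Subset n} X {R} → PartOf U (X ++ R) → ∣ U ─* X ∣ + weight X ≡ ∣ U ∣
∣─*∣ [] _ = +-identityʳ _
∣─*∣ {U = U} (B ∷ X) part = begin
  ∣ (U ─ B) ─* X ∣ + (∣ B ∣ + weight X) ≡⟨ cong (∣ (U ─ B) ─* X ∣ +_) (+-comm ∣ B ∣ _) ⟩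
  ∣ (U ─ B) ─* X ∣ + (weight X + ∣ B ∣) ≡⟨ sym (+-assoc ∣ (U ─ B) ─* X ∣ _ _) ⟩
  ∣ (U ─ B) ─* X ∣ + weight X + ∣ B ∣ ≡⟨ cong (_+ ∣ B ∣) (∣─*∣ X (PartOf-tail part)) ⟩
  ∣ U ─ B ∣ + ∣ B ∣ ≡⟨ ∣─∣ U B (All.head (inside-U part)) ⟩
  ∣ U ∣ ∎
  where open ≡-Reasoning

PartOf-weight : ∀ {U : Subset n} {P} → PartOf U P → weight P ≡ ∣ U ∣
PartOf-weight {U = U} {P} part = trans (cong (_+ weight P) (sym (PartOf-full (PartOf-++ P part′)))) (∣─*∣ P part′)
  where
  part′ : PartOf U (P ++ [])
  part′ = PartOf-↭ (↭-sym (++-comm P [])) part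

IsPartition⇒PartOf : ∀ {P : List (Subset n)} → IsPartition n P → PartOf full P
IsPartition⇒PartOf (_ , ne , d , c) = mkPart ne d (λ x _ → c x) (All.tabulate λ _ _ → ∈⊤)

↭⇒SameBlocks : ∀ {P Q : List (Subset n)} → P ↭ Q → SameBlocks P Q
↭⇒SameBlocks p = (λ B → ∈-resp-↭ p) , (λ B → ∈-resp-↭ (↭-sym p))

module _ {n k : ℕ} where

  -- Without X the members become partitions of `full ─* X`, and members with the same remainder
  -- have the same blocks.
  enumerated-length : ∀ {s R} X (E : Enumeration (full {n} ─* X) (k ∸ length X) s R) {𝓐} → IsKFamily n k 𝓐 → Unique X →
    All (λ A → X ⊑ A × (∀ Q → A ↭ X ++ Q → R Q)) 𝓐 → length 𝓐 ≤ s
  enumerated-length {R = R} X E {𝓐} (parts , distinct) uX ⊇X = ≤-trans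
    (pigeonhole (λ A Q → A ↭ X ++ Q) (λ p q → ↭⇒SameBlocks (↭-trans p (↭-sym q))) distinct (All.zipWith locate (parts , ⊇X)))
    (≤-reflexive (size E))
    where
    locate : ∀ {A} → IsKPartition n k A × (X ⊑ A × (∀ Q → A ↭ X ++ Q → R Q)) → Any (λ Q → A ↭ X ++ Q) (list E)
    locate {A} ((part , len) , X⊑A , r) with ⊆⇒↭ uX X⊑A
    ... | Q , p = Any.map (λ q → ↭-trans p (++⁺ˡ X q)) (complete E Q (PartOf-++ X (PartOf-↭ p (IsPartition⇒PartOf part)))
                    (trans (sym (m+n∸m≡n (length X) (length Q))) (cong (_∸ length X) (trans (sym (length-++ X)) (trans (sym (↭-length p)) len)))) (r Q p))

  ⊇-length : ∀ X {𝓐} → IsKFamily n k 𝓐 → Unique X → All (X ⊑_) 𝓐 → length 𝓐 ≤ S ∣ full {n} ─* X ∣ (k ∸ length X)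
  ⊇-length X fam uX ⊇X = enumerated-length X (enumerate _ _ refl _) fam uX (All.map (λ s → s , λ _ _ → tt) ⊇X)

-- Counting in filtered lists

module _ {a} {A : Set a} where

  module _ {p q} {P : Pred A p} {Q : Pred A q} (P? : Decidable P) (Q? : Decidable Q) where

    filter-length-mono : ∀ xs → (∀ {x} → x ∈L xs → P x → Q x) → length (filter P? xs) ≤ length (filter Q? xs)
    filter-length-mono [] h = z≤n
    filter-length-mono (x ∷ xs) h with P? x | Q? x
    ... | yes px | yes qx = s≤s (filter-length-mono xs (h ∘ there))
    ... | yes px | no ¬qx = contradiction (h (here refl) px) ¬qx
    ... | no ¬px | yes qx = m≤n⇒m≤1+n (filter-length-mono xs (h ∘ there))
    ... | no ¬px | no ¬qx = filter-length-mono xs (h ∘ there)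

    length-filter-∪ : ∀ xs → (∀ {x} → x ∈L xs → P x ⊎ Q x) → length xs ≤ length (filter P? xs) + length (filter Q? xs)
    length-filter-∪ [] h = z≤n
    length-filter-∪ (x ∷ xs) h with P? x | Q? x
    ... | yes px | yes qx = s≤s (≤-trans (length-filter-∪ xs (h ∘ there)) (+-monoʳ-≤ _ (n≤1+n _)))
    ... | yes px | no ¬qx = s≤s (length-filter-∪ xs (h ∘ there))
    ... | no ¬px | yes qx = ≤-trans (s≤s (length-filter-∪ xs (h ∘ there))) (≤-reflexive (sym (+-suc _ _)))
    ... | no ¬px | no ¬qx = contradiction (h (here refl)) [ ¬px , ¬qx ]′

  filter-filter-length : ∀ {p q r} {P : Pred A p} {Q : Pred A q} {R : Pred A r} (P? : Decidable P) (Q? : Decidable Q) (R? : Decidable R) xs →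
    (∀ {x} → x ∈L xs → P x → Q x → R x) → length (filter Q? (filter P? xs)) ≤ length (filter R? xs)
  filter-filter-length P? Q? R? [] h = z≤n
  filter-filter-length P? Q? R? (x ∷ xs) h with P? x
  ... | no _ with R? x
  ...   | yes _ = m≤n⇒m≤1+n (filter-filter-length P? Q? R? xs (h ∘ there))
  ...   | no _ = filter-filter-length P? Q? R? xs (h ∘ there)
  filter-filter-length P? Q? R? (x ∷ xs) h | yes px with Q? x | R? x
  ... | yes qx | yes rx = s≤s (filter-filter-length P? Q? R? xs (h ∘ there))
  ... | yes qx | no ¬rx = contradiction (h (here refl) px qx) ¬rx
  ... | no ¬qx | yes rx = m≤n⇒m≤1+n (filter-filter-length P? Q? R? xs (h ∘ there))
  ... | no ¬qx | no ¬rx = filter-filter-length P? Q? R? xs (h ∘ there)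

  filter-length-∪ : ∀ {p q r} {P : Pred A p} {Q : Pred A q} {R : Pred A r} (P? : Decidable P) (Q? : Decidable Q) (R? : Decidable R) xs →
    (∀ {x} → x ∈L xs → P x → Q x ⊎ R x) → length (filter P? xs) ≤ length (filter Q? xs) + length (filter R? xs)
  filter-length-∪ P? Q? R? xs h = ≤-trans
    (length-filter-∪ Q? R? (filter P? xs) (λ x∈ → let (x∈xs , px) = ∈-filter⁻ P? x∈ in h x∈xs px))
    (+-mono-≤ (filter-filter-length P? Q? Q? xs (λ _ _ q → q)) (filter-filter-length P? R? R? xs (λ _ _ r → r)))

  filter-none : ∀ {p} {P : Pred A p} (P? : Decidable P) xs → (∀ {x} → x ∈L xs → ¬ P x) → length (filter P? xs) ≡ 0
  filter-none P? [] h = refl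
  filter-none P? (x ∷ xs) h with P? x
  ... | yes px = contradiction px (h (here refl))
  ... | no _ = filter-none P? xs (h ∘ there)

  filter-length-∷ : ∀ {p} {P : Pred A p} (P? : Decidable P) x xs → length (filter P? xs) ≤ length (filter P? (x ∷ xs))
  filter-length-∷ P? x xs with P? x
  ... | yes _ = n≤1+n _
  ... | no _ = ≤-refl

module _ {a} {A : Set a} where

  sum-map-mono : ∀ {f g : A → ℕ} xs → (∀ {x} → x ∈L xs → f x ≤ g x) → sum (map f xs) ≤ sum (map g xs)
  sum-map-mono [] _ = z≤n
  sum-map-mono (x ∷ xs) h = +-mono-≤ (h (here refl)) (sum-map-mono xs (h ∘ there))

module _ {a} {A : Set a} where

  module _ {i} {I : Set i} {p} {P : Pred A p} (P? : Decidable P) {q} {Q : I → Pred A q} (Q? : ∀ z → Decidable (Q z)) where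

    filter-length-⋃ : ∀ Z xs → (∀ {x} → x ∈L xs → P x → Any (λ z → Q z x) Z) →
      length (filter P? xs) ≤ sum (map (λ z → length (filter (Q? z) xs)) Z)
    filter-length-⋃ Z [] h = z≤n
    filter-length-⋃ Z (x ∷ xs) h with P? x
    ... | no ¬px = ≤-trans (filter-length-⋃ Z xs (h ∘ there)) (sum-map-mono Z (λ {z} _ → filter-length-∷ (Q? z) x xs))
    ... | yes px = ≤-trans (s≤s (filter-length-⋃ Z xs (h ∘ there))) (sum-< (h (here refl) px))
      where
      sum-< : ∀ {Z} → Any (λ z → Q z x) Z → sum (map (λ z → length (filter (Q? z) xs)) Z) < sum (map (λ z → length (filter (Q? z) (x ∷ xs))) Z)
      sum-< {z ∷ Z} (here qz) with Q? z x
      ... | yes _ = s≤s (+-monoʳ-≤ _ (sum-map-mono Z (λ {z} _ → filter-length-∷ (Q? z) x xs)))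
      ... | no ¬q = contradiction qz ¬q
      sum-< {z ∷ Z} (there a) = ≤-trans (≤-reflexive (sym (+-suc _ _))) (+-mono-≤ (filter-length-∷ (Q? z) x xs) (sum-< a))

  sum-map-≤ : ∀ (f : A → ℕ) {M} Z → All (λ z → f z ≤ M) Z → sum (map f Z) ≤ length Z * M
  sum-map-≤ f [] _ = z≤n
  sum-map-≤ f (z ∷ Z) (h ∷ hs) = +-mono-≤ h (sum-map-≤ f Z hs)

-- Intersections and degrees

variable
  X X′ Y Z P Q : List (Subset n)
  𝓐 𝓑 : List (List (Subset n))

infix 4 _⊑?_
_⊑?_ : (X A : List (Subset n)) → Dec (X ⊑ A)
X ⊑? A = allL? (_∈? A) X

⊑-refl : X ⊑ X
⊑-refl = All.tabulate id

⊑-trans : X ⊑ Y → Y ⊑ Z → X ⊑ Z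
⊑-trans p q = All.map (All.lookup q) p

meet : List (Subset n) → List (Subset n) → ℕ
meet Z A = length (common Z A)

common-⊑ˡ : ∀ (Z A : List (Subset n)) → common Z A ⊑ Z
common-⊑ˡ Z A = All.tabulate (λ x∈ → proj₁ (∈-filter⁻ (_∈? A) x∈))

common-⊑ʳ : ∀ (Z A : List (Subset n)) → common Z A ⊑ A
common-⊑ʳ Z A = All.tabulate (λ x∈ → proj₂ (∈-filter⁻ (_∈? A) {xs = Z} x∈))

⊑-common : ∀ (Z A : List (Subset n)) → X ⊑ Z → X ⊑ A → X ⊑ common Z A
⊑-common Z A p q = All.zipWith (λ (a , b) → ∈-filter⁺ (_∈? A) a b) (p , q)

common-unique : ∀ (Z A : List (Subset n)) → Unique Z → Unique (common Z A)
common-unique Z A = Uniqueₚ.filter⁺ (_∈? A)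

⊑-length : {X Y : List (Subset n)} → Unique X → X ⊑ Y → length X ≤ length Y
⊑-length = unique-length-≤

⊑-flip : {X Y : List (Subset n)} → Unique X → X ⊑ Y → length Y ≤ length X → Y ⊑ X
⊑-flip = unique-⊆⇒⊇ _≟ₛ_

≤-meet : ∀ (Z A : List (Subset n)) → Unique X → X ⊑ Z → X ⊑ A → length X ≤ meet Z A
≤-meet Z A u p q = ⊑-length u (⊑-common Z A p q)

meet-sym : ∀ (Z A : List (Subset n)) → Unique Z → meet Z A ≤ meet A Z
meet-sym Z A uZ = ≤-meet A Z (common-unique Z A uZ) (common-⊑ʳ Z A) (common-⊑ˡ Z A)

meet-∈ : ∀ {B} (Z A : List (Subset n)) → B ∈L A → meet (B ∷ Z) A ≡ suc (meet Z A)
meet-∈ Z A B∈ = cong length (filter-accept (_∈? A) B∈)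

meet-∉ : ∀ {B} (Z A : List (Subset n)) → B ∉L A → meet (B ∷ Z) A ≡ meet Z A
meet-∉ Z A B∉ = cong length (filter-reject (_∈? A) B∉)

meet-↭ : ∀ {Z Z′ : List (Subset n)} A → Z ↭ Z′ → meet Z A ≡ meet Z′ A
meet-↭ A p = ↭-length (filter-↭ (_∈? A) p)

meet-full : ∀ (Z A : List (Subset n)) → Unique Z → length Z ≤ meet Z A → Z ⊑ A
meet-full Z A uZ le = ⊑-trans (⊑-flip (common-unique Z A uZ) (common-⊑ˡ Z A) le) (common-⊑ʳ Z A)

remove : Subset n → List (Subset n) → List (Subset n)
remove B = filter (λ D → ¬? (D ≟ₛ B))

remove-⊑ : ∀ B (Z : List (Subset n)) → remove B Z ⊑ Z
remove-⊑ B Z = All.tabulate (λ x∈ → proj₁ (∈-filter⁻ (λ D → ¬? (D ≟ₛ B)) x∈))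

remove-∌ : ∀ B (Z : List (Subset n)) → B ∉L remove B Z
remove-∌ B Z B∈ = proj₂ (∈-filter⁻ (λ D → ¬? (D ≟ₛ B)) {xs = Z} B∈) refl

remove-unique : ∀ B {Z : List (Subset n)} → Unique Z → Unique (remove B Z)
remove-unique B = Uniqueₚ.filter⁺ (λ D → ¬? (D ≟ₛ B))

remove-↭ : ∀ {B} {Z : List (Subset n)} → Unique Z → B ∈L Z → Z ↭ B ∷ remove B Z
remove-↭ {B = B} {Z} uZ B∈ with ∈⇒↭ B∈
... | Z′ , p with Unique-↭ p uZ
...   | B∉ ∷ _ = ↭-trans p (prep B (↭-sym (↭-trans (filter-↭ ≢B? p) (↭-reflexive (trans (filter-reject ≢B? (λ ne → ne refl)) (filter-all ≢B? (All.map (λ ne e → ne (sym e)) B∉)))))))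
  where
  ≢B? = λ D → ¬? (D ≟ₛ B)

length-remove : ∀ {B} {Z : List (Subset n)} → Unique Z → B ∈L Z → suc (length (remove B Z)) ≡ length Z
length-remove uZ B∈ = sym (↭-length (remove-↭ uZ B∈))

⊑-remove : ∀ {B} (Z : List (Subset n)) {A} → B ∉L A → common Z A ⊑ remove B Z
⊑-remove {B = B} Z {A} B∉ = All.tabulate λ {D} D∈ → ∈-filter⁺ (λ D → ¬? (D ≟ₛ B)) (All.lookup (common-⊑ˡ Z A) D∈) (λ e → B∉ (subst (_∈L A) e (All.lookup (common-⊑ʳ Z A) D∈)))

missing-one : ∀ {s} {Z A : List (Subset n)} → Unique Z → length Z ≡ suc s → s ≤ meet Z A → Z ⊑ A ⊎ Any (λ B → B ∉L A × remove B Z ⊑ A) Z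
missing-one {s = s} {Z} {A} uZ len le with Z ⊑? A
... | yes p = inj₁ p
... | no ¬p = let (B , B∈ , B∉) = find (¬All⇒Any¬ (_∈? A) Z ¬p) in
  inj₂ (lose B∈ (B∉ , ⊑-trans (⊑-flip (common-unique Z A uZ) (⊑-remove Z B∉)
    (≤-trans (≤-reflexive (suc-injective (trans (length-remove uZ B∈) len))) le)) (common-⊑ʳ Z A)))

deg : List (List (Subset n)) → List (Subset n) → ℕ
deg 𝓐 X = length (filter (X ⊑?_) 𝓐)

length≤deg : (𝓐 : List (List (Subset n))) → All (X ⊑_) 𝓐 → length 𝓐 ≤ deg 𝓐 X
length≤deg {X = X} 𝓐 h = ≤-reflexive (cong length (sym (filter-all (X ⊑?_) h)))

nC0≡1 : ∀ n → n C 0 ≡ 1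
nC0≡1 n = trans (nCk≡nC[n∸k] {0} {n} z≤n) (nCn≡1 n)

countMeet : List (List (Subset n)) → (Z : List (Subset n)) → ℕ → List (Subset n) → ℕ
countMeet 𝓐 Z s Y = length (filter (λ A → (Y ⊑? A) ×-dec (s ≤? meet Z A)) 𝓐)

-- Each block of Z in turn joins Y or is dropped, and the two counts add up by Pascal's rule. As Z
-- avoids Y, a block that joins is new.
countMeet-≤ : ∀ (𝓐 : List (List (Subset n))) Z s Y {M} → Unique Y → Unique Z → All (_∉L Y) Z →
  (∀ X → Unique X → length X ≡ s + length Y → Y ⊑ X → deg 𝓐 X ≤ M) →
  countMeet 𝓐 Z s Y ≤ (length Z C s) * M
countMeet-≤ 𝓐 Z zero Y {M} uY uZ Z∉Y h = ≤-trans (filter-length-mono _ (Y ⊑?_) 𝓐 (λ _ → proj₁))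
  (≤-trans (h Y uY refl ⊑-refl) (≤-reflexive (trans (sym (+-identityʳ M)) (cong (_* M) (sym (nC0≡1 (length Z)))))))
countMeet-≤ 𝓐 [] (suc s) Y uY uZ Z∉Y h = ≤-trans (≤-reflexive (filter-none _ 𝓐 λ { _ (_ , ()) })) z≤n
countMeet-≤ 𝓐 (B ∷ Z) (suc s) Y {M} uY (B∉Z ∷ uZ) (B∉Y ∷ Z∉Y) h = begin
  countMeet 𝓐 (B ∷ Z) (suc s) Y ≤⟨ filter-length-∪ _ _ _ 𝓐 (λ {A} _ → split {A}) ⟩
  countMeet 𝓐 Z s (B ∷ Y) + countMeet 𝓐 Z (suc s) Y
    ≤⟨ +-mono-≤ (countMeet-≤ 𝓐 Z s (B ∷ Y) (¬Any⇒All¬ Y B∉Y ∷ uY) uZ (All.zipWith notin (B∉Z , Z∉Y)) (λ X uX e → λ where (_ ∷ Y⊑X) → h X uX (trans e (+-suc s _)) Y⊑X))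
                (countMeet-≤ 𝓐 Z (suc s) Y uY uZ Z∉Y h) ⟩
  (length Z C s) * M + (length Z C suc s) * M ≡⟨ sym (*-distribʳ-+ M (length Z C s) _) ⟩
  (length Z C s + length Z C suc s) * M ≡⟨ cong (_* M) (nCk+nC[k+1]≡[n+1]C[k+1] (length Z) s) ⟩
  (suc (length Z) C suc s) * M ∎
  where
  open ≤-Reasoning
  notin : ∀ {D} → (B ≢ D) × (D ∉L Y) → D ∉L (B ∷ Y)
  notin (ne , D∉Y) (here e) = ne (sym e)
  notin (ne , D∉Y) (there D∈) = D∉Y D∈
  split : ∀ {A} → (Y ⊑ A) × (suc s ≤ meet (B ∷ Z) A) → ((B ∷ Y) ⊑ A × s ≤ meet Z A) ⊎ (Y ⊑ A × suc s ≤ meet Z A)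
  split {A} (Y⊑A , le) = case B ∈? A of λ where
    (yes B∈A) → inj₁ (B∈A ∷ Y⊑A , s≤s⁻¹ (≤-trans le (≤-reflexive (meet-∈ Z A B∈A))))
    (no B∉A) → inj₂ (Y⊑A , ≤-trans le (≤-reflexive (meet-∉ Z A B∉A)))

length≤countMeet : ∀ (𝓐 : List (List (Subset n))) Z s → All (λ A → s ≤ meet Z A) 𝓐 → length 𝓐 ≤ countMeet 𝓐 Z s []
length≤countMeet 𝓐 Z s h = ≤-reflexive (cong length (sym (filter-all _ (All.map (λ le → [] , le) h))))

C≤^ : ∀ d s → (d + s) C s ≤ (d + s) ^ d
C≤^ zero s = ≤-reflexive (nCn≡1 s)
C≤^ (suc d) zero = ≤-trans (≤-reflexive (nC0≡1 (suc d + 0))) (m^n>0 (suc d + 0) (suc d))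
C≤^ (suc d) (suc s) = begin
  suc (d + suc s) C suc s ≡⟨ sym (nCk+nC[k+1]≡[n+1]C[k+1] (d + suc s) s) ⟩
  (d + suc s) C s + (d + suc s) C suc s ≤⟨ +-mono-≤ (≤-trans (≤-reflexive (cong (_C s) (+-suc d s))) (C≤^ (suc d) s)) (C≤^ d (suc s)) ⟩
  (suc d + s) ^ suc d + (d + suc s) ^ d ≡⟨ cong (λ z → z ^ suc d + (d + suc s) ^ d) (sym (+-suc d s)) ⟩
  (d + suc s) * (d + suc s) ^ d + (d + suc s) ^ d ≡⟨ +-comm _ ((d + suc s) ^ d) ⟩
  suc (d + suc s) * (d + suc s) ^ d ≤⟨ *-monoʳ-≤ (suc (d + suc s)) (^-monoˡ-≤ d (n≤1+n (d + suc s))) ⟩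
  suc (d + suc s) ^ suc d ∎
  where open ≤-Reasoning

-- Branching: enlarging a set of blocks inside the members of a family

Extends : ℕ → List (List (Subset n)) → List (Subset n) → Set
Extends {n} q 𝓐 X = ∃ λ D → length D ≤ q × (∀ {A} → A ∈L 𝓐 → X ⊑ A → Any (λ B → B ∉L X × B ∈L A) D)

deg-extend : ∀ {q M} (𝓐 : List (List (Subset n))) → Extends q 𝓐 X → (∀ B → B ∉L X → deg 𝓐 (B ∷ X) ≤ M) → deg 𝓐 X ≤ q * M
deg-extend {X = X} {q} {M} 𝓐 (D , lenD , hit) h = begin
  deg 𝓐 X ≤⟨ filter-length-⋃ (X ⊑?_) (λ B → (B ∷ X) ⊑?_) D′ 𝓐 cov ⟩
  sum (map (λ B → deg 𝓐 (B ∷ X)) D′) ≤⟨ sum-map-≤ _ D′ (All.tabulate (λ {B} B∈ → h B (proj₂ (∈-filter⁻ (λ B → ¬? (B ∈? X)) {xs = D} B∈)))) ⟩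
  length D′ * M ≤⟨ *-monoˡ-≤ M (≤-trans (length-filter _ D) lenD) ⟩
  q * M ∎
  where
  open ≤-Reasoning
  D′ = filter (λ B → ¬? (B ∈? X)) D
  cov : ∀ {A} → A ∈L 𝓐 → X ⊑ A → Any (λ B → (B ∷ X) ⊑ A) D′
  cov A∈ X⊑A with find (hit A∈ X⊑A)
  ... | B , B∈D , B∉X , B∈A = lose (∈-filter⁺ (λ B → ¬? (B ∈? X)) B∈D B∉X) (B∈A ∷ X⊑A)

-- A search tree of depth e with at most q children per node and the sets X′ as leaves. Inner nodes
-- have fewer than α blocks, which is where `Extends` is available.
branch : ∀ {q α M} (𝓐 : List (List (Subset n))) → (∀ X → Unique X → length X < α → Extends q 𝓐 X) →
  ∀ e X → Unique X → e + length X ≤ α → (∀ X′ → Unique X′ → length X′ ≡ e + length X → X ⊑ X′ → deg 𝓐 X′ ≤ M) → deg 𝓐 X ≤ q ^ e * M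
branch {M = M} 𝓐 ext zero X uX le h = ≤-trans (h X uX refl ⊑-refl) (≤-reflexive (sym (+-identityʳ M)))
branch {q = q} {M = M} 𝓐 ext (suc e) X uX le h = ≤-trans
  (deg-extend 𝓐 (ext X uX (≤-trans (s≤s (m≤n+m (length X) e)) le)) (λ B B∉X →
    branch 𝓐 ext e (B ∷ X) (¬Any⇒All¬ X B∉X ∷ uX) (≤-trans (≤-reflexive (+-suc e _)) le)
      (λ X′ uX′ eq → λ where (_ ∷ X⊑) → h X′ uX′ (trans eq (+-suc e _)) X⊑)))
  (≤-reflexive (sym (*-assoc q (q ^ e) M)))

-- X contains fewer than s blocks of D, but every member of 𝓐 contains s of them, so one of these
-- lies outside X.
extends-by : ∀ {s q} {X D : List (Subset n)} {𝓐} → length D ≤ q → meet X D < s →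
  (∀ {A} → A ∈L 𝓐 → ∃ λ Q → Unique Q × s ≤ length Q × Q ⊑ A × Q ⊑ D) → Extends q 𝓐 X
extends-by {s = s} {X = X} {D} lenD small cross = D , lenD , λ {A} A∈ X⊑A →
  case anyL? (λ B → ¬? (B ∈? X) ×-dec (B ∈? A)) D of λ where
    (yes a) → a
    (no ¬a) → let (Q , uQ , s≤Q , Q⊑A , Q⊑D) = cross A∈ in
      contradiction (≤-trans s≤Q (≤-meet X D uQ (All.tabulate λ {B} B∈ → case B ∈? X of λ where
          (yes p) → p
          (no ¬p) → ⊥-elim (¬a (lose (All.lookup Q⊑D B∈) (¬p , All.lookup Q⊑A B∈)))) Q⊑D))
        (<⇒≱ small)

-- Degrees in families of partitions

∸-suc : ∀ {l k} → l < k → suc (k ∸ suc l) ≡ k ∸ l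
∸-suc {zero} {suc k} _ = refl
∸-suc {suc l} {suc k} (s≤s lt) = ∸-suc lt

IsKFamily-filter : ∀ {k p} {P : Pred (List (Subset n)) p} (P? : Decidable P) → IsKFamily n k 𝓐 → IsKFamily n k (filter P? 𝓐)
IsKFamily-filter P? (parts , distinct) = Allₚ.filter⁺ P? parts , AllPairsₚ.filter⁺ P? distinct

partition-unique : ∀ {k} → IsKPartition n k P → Unique P
partition-unique ((u , _) , _) = u

partition-PartOf : ∀ {k} → IsKPartition n k P → PartOf full P
partition-PartOf (p , _) = IsPartition⇒PartOf p

weight-++ : ∀ (X Y : List (Subset n)) → weight (X ++ Y) ≡ weight X + weight Y
weight-++ X Y = trans (cong sum (map-++ ∣_∣ X Y)) (sum-++ (map ∣_∣ X) (map ∣_∣ Y))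

weight-↭ : {X Y : List (Subset n)} → X ↭ Y → weight X ≡ weight Y
weight-↭ p = sum-↭ (map⁺ ∣_∣ p)

length≤weight : All Nonempty X → length X ≤ weight X
length≤weight [] = z≤n
length≤weight (ne ∷ nes) = +-mono-≤ (Nonempty⇒1≤∣∣ ne) (length≤weight nes)

─*-weight : ∀ {k} → IsKPartition n k P → Unique X → X ⊑ P → ∣ full {n} ─* X ∣ ≡ n ∸ weight X
─*-weight {n = n} {P = P} {X = X} part uX X⊑P with ⊆⇒↭ uX X⊑P
... | R , p = trans (sym (m+n∸n≡m _ (weight X))) (cong (_∸ weight X) (trans (∣─*∣ X (PartOf-↭ p (partition-PartOf part))) (∣⊤∣≡n n)))

nonempty-⊑ : ∀ {k} → IsKPartition n k P → X ⊑ P → All Nonempty X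
nonempty-⊑ ((_ , ne , _) , _) X⊑P = All.map (All.lookup ne) X⊑P

module _ {n k : ℕ} {𝓐 : List (List (Subset n))} (fam : IsKFamily n k 𝓐) where

  deg-≤-─* : ∀ X → Unique X → deg 𝓐 X ≤ S ∣ full {n} ─* X ∣ (k ∸ length X)
  deg-≤-─* X uX = ⊇-length X (IsKFamily-filter (X ⊑?_) fam) uX (Allₚ.all-filter (X ⊑?_) 𝓐)

  -- The number of points left by X is known from `─*-weight` only if X lies in a partition; when no
  -- member contains X, the degree is 0.
  deg-member : ∀ X {M} → (∀ {A} → IsKPartition n k A → X ⊑ A → deg 𝓐 X ≤ M) → deg 𝓐 X ≤ M
  deg-member X {M} h with filter (X ⊑?_) 𝓐 in eq
  ... | [] = z≤n
  ... | A ∷ As = let (A∈ , X⊑A) = ∈-filter⁻ (X ⊑?_) {xs = 𝓐} (subst (A ∈L_) (sym eq) (here refl)) in h (All.lookup (proj₁ fam) A∈) X⊑A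

  -- The blocks of X use `weight X` points, each further block of X′ at least one. At least one
  -- block must remain, because S is not monotone in its first argument for zero blocks: S 0 0 = 1,
  -- but S 1 0 = 0.
  deg-≤ : ∀ X X′ → Unique X → Unique X′ → X ⊑ X′ → length X′ < k →
    deg 𝓐 X′ ≤ S (n ∸ weight X ∸ (length X′ ∸ length X)) (k ∸ length X′)
  deg-≤ X X′ uX uX′ X⊑X′ lt = deg-member X′ λ {A} part X′⊑A → ≤-trans (deg-≤-─* X′ uX′)
    (subst (λ z → S ∣ full {n} ─* X′ ∣ z ≤ S (n ∸ weight X ∸ (length X′ ∸ length X)) z) (∸-suc lt)
      (S-mono _ (≤-trans (≤-reflexive (─*-weight part uX′ X′⊑A)) (less part X′⊑A))))
    where
    less : ∀ {A} → IsKPartition n k A → X′ ⊑ A → n ∸ weight X′ ≤ n ∸ weight X ∸ (length X′ ∸ length X)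
    less part X′⊑A with ⊆⇒↭ uX X⊑X′
    ... | Y , p = ≤-trans (∸-monoʳ-≤ n (≤-trans (+-monoʳ-≤ (weight X) (≤-trans (≤-reflexive lenY) (length≤weight neY))) (≤-reflexive (trans (sym (weight-++ X Y)) (sym (weight-↭ p))))))
                    (≤-reflexive (sym (∸-+-assoc n (weight X) _)))
      where
      lenY : length X′ ∸ length X ≡ length Y
      lenY = trans (cong (_∸ length X) (trans (↭-length p) (length-++ X))) (m+n∸m≡n (length X) (length Y))
      neY : All Nonempty Y
      neY = Allₚ.++⁻ʳ X (All-resp-↭ p (nonempty-⊑ part X′⊑A))

  deg-≤-length : ∀ X → Unique X → length X < k → deg 𝓐 X ≤ S (n ∸ length X) (k ∸ length X)
  deg-≤-length X uX lt = deg-≤ [] X [] uX [] lt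

  deg≤1 : ∀ X → Unique X → k ≤ suc (length X) → deg 𝓐 X ≤ 1
  deg≤1 X uX k≤ with k ∸ length X | m≤n+o⇒m∸n≤o k (length X) (≤-trans k≤ (≤-reflexive (+-comm 1 _))) | deg-≤-─* X uX
  ... | zero | _ | le = ≤-trans le (S0≤1 ∣ full {n} ─* X ∣)
  ... | suc zero | _ | le = ≤-trans le (S1≤1 ∣ full {n} ─* X ∣)
  ... | suc (suc _) | s≤s () | _

-- If P and Q differed, they would be a family of two members through at least k - 1 common blocks,
-- where `deg≤1` leaves room for one.
same-by-meet : ∀ {k} {P Q : List (Subset n)} → IsKPartition n k P → IsKPartition n k Q → k ≤ suc (meet P Q) → SameBlocks P Q
same-by-meet {n = n} {k} {P} {Q} partP partQ le with allL? (_∈? Q) P | allL? (_∈? P) Q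
... | yes P⊑Q | yes Q⊑P = (λ B → All.lookup P⊑Q) , (λ B → All.lookup Q⊑P)
... | yes P⊑Q | no ¬Q⊑P = ⊥-elim (¬Q⊑P (⊑-flip (partition-unique partP) P⊑Q (≤-reflexive (trans (proj₂ partQ) (sym (proj₂ partP))))))
... | no ¬P⊑Q | _ = contradiction
    (≤-trans (≤-reflexive (cong length (sym (filter-all (common P Q ⊑?_) (common-⊑ˡ P Q ∷ common-⊑ʳ P Q ∷ [])))))
             (deg≤1 {𝓐 = P ∷ Q ∷ []} (partP ∷ partQ ∷ [] , ((λ same → ¬P⊑Q (All.tabulate (proj₁ same _))) ∷ []) ∷ [] ∷ []) (common P Q) (common-unique P Q (partition-unique partP)) le))
    λ { (s≤s ()) }

-- Cross-intersecting pairs of families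

Cross : ℕ → List (List (Subset n)) → List (List (Subset n)) → Set
Cross s 𝓐 𝓑 = ∀ {A B} → A ∈L 𝓐 → B ∈L 𝓑 → s ≤ meet A B

Cover : ℕ → List (Subset n) → List (List (Subset n)) → Set
Cover s Z 𝓑 = All (λ B → s ≤ meet Z B) 𝓑

Cross-sym : ∀ {s k} → IsKFamily n k 𝓐 → Cross s 𝓐 𝓑 → Cross s 𝓑 𝓐
Cross-sym fam cr {B} {A} B∈ A∈ = ≤-trans (cr A∈ B∈) (meet-sym A B (partition-unique (All.lookup (proj₁ fam) A∈)))

-- Uniting the sets one after another costs a point each time, hence the subtraction of `length xs`.
sum-S-≤ : ∀ m d x xs → 1 ≤ x → All (1 ≤_) xs →
  sum (map (λ y → S (y ∸ d) (2 + m)) (x ∷ xs)) ≤ S (sum (x ∷ xs) ∸ length xs ∸ d) (2 + m)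
sum-S-≤ m d x [] _ _ = ≤-reflexive (trans (+-identityʳ _) (cong (λ z → S (z ∸ d) (2 + m)) (sym (+-identityʳ x))))
sum-S-≤ m d x (y ∷ xs) 1≤x (1≤y ∷ h) = begin
  S (x ∸ d) (2 + m) + sum (map (λ y → S (y ∸ d) (2 + m)) (y ∷ xs)) ≤⟨ +-monoʳ-≤ _ (sum-S-≤ m d y xs 1≤y h) ⟩
  S (x ∸ d) (2 + m) + S (b ∸ d) (2 + m) ≤⟨ S-superadditive-∸ m d x b 1≤x 1≤b ⟩
  S (x + b ∸ 1 ∸ d) (2 + m) ≡⟨ cong (λ z → S (z ∸ d) (2 + m)) eq ⟩
  S (x + sum (y ∷ xs) ∸ suc (length xs) ∸ d) (2 + m) ∎
  where
  open ≤-Reasoning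
  b = sum (y ∷ xs) ∸ length xs
  length≤sum : ∀ {xs} → All (1 ≤_) xs → length xs ≤ sum xs
  length≤sum [] = z≤n
  length≤sum (p ∷ ps) = +-mono-≤ p (length≤sum ps)
  len< : suc (length xs) ≤ sum (y ∷ xs)
  len< = +-mono-≤ 1≤y (length≤sum h)
  1≤b : 1 ≤ b
  1≤b = m<n⇒0<n∸m len<
  eq : x + b ∸ 1 ≡ x + sum (y ∷ xs) ∸ suc (length xs)
  eq = trans (cong (_∸ 1) (sym (+-∸-assoc x (<⇒≤ len<)))) (trans (∸-+-assoc (x + sum (y ∷ xs)) (length xs) 1) (cong (x + sum (y ∷ xs) ∸_) (+-comm (length xs) 1)))

all-same-length : ∀ {k} {P : List (Subset n)} → IsKFamily n k 𝓐 → All (λ A → SameBlocks A P) 𝓐 → length 𝓐 ≤ 1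
all-same-length {P = P} (_ , distinct) same = pigeonhole SameBlocks (λ (a , a′) (b , b′) → (λ B → b′ B ∘ a B) , (λ B → a′ B ∘ b B)) {ys = P ∷ []} distinct (All.map here same)

-- The budget of factors K, and the product bound for two families

module Bounds (K c : ℕ) (3≤K : 3 ≤ K) (big : K ^ (2 * K) ≤ 2 ^ (2 * K + c)) where
  open Growth K c 3≤K big

  instance
    K-nonZero : NonZero K
    K-nonZero = >-nonZero (≤-trans (s≤s z≤n) 3≤K)

  N : ℕ
  N = K + 5 + c

  K<N : K < N
  K<N = ≤-trans (m≤m+n (suc K) (4 + c)) (≤-reflexive (lem K c))
    where
    lem : ∀ K c → suc K + (4 + c) ≡ K + 5 + c
    lem = solve-∀

  -- bounds the number of k-partitions of [n] with j given blocks, for j < k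
  g : ℕ → ℕ → ℕ
  g k j = S (N ∸ j) (k ∸ j)

  g-pos : ∀ {k j} → k ≤ K → j < k → 0 < g k j
  g-pos {k} {j} k≤K j<k = subst₂ (λ a b → 0 < S a b) (∸-suc (≤-trans j<k k≤N)) (∸-suc j<k) (S-pos (∸-monoˡ-≤ (suc j) k≤N))
    where
    k≤N = ≤-trans k≤K (<⇒≤ K<N)

  -- The number of points demanded by `S-growth` amounts to k + 5 + c ≤ N, an equality for k = K;
  -- here the constant 5 of the hypothesis is used. The condition 1 ≤ j gives `2 + p ≤ K`.
  g-step : ∀ {k j} → k ≤ K → 1 ≤ j → 2 + j ≤ k → K * K * g k (suc j) ≤ g k j
  g-step {k} {j} k≤K 1≤j 2+j≤k = subst₂ (λ a b → K * K * g k (suc j) ≤ S a b) (∸-suc (≤-trans (<⇒≤ 2+j≤k) (≤-trans k≤K (<⇒≤ K<N)))) (∸-suc (<⇒≤ 2+j≤k))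
    (S-growth p (N ∸ suc j) (m<n⇒0<n∸m 2+j≤k) (≤-trans (≤-trans (+-monoˡ-≤ p (s≤s 1≤j)) (≤-reflexive p+)) k≤K)
      (+-cancelˡ-≤ (suc j) _ _ (begin
        suc j + (4 + c + suc p) ≡⟨ lem j c p ⟩
        suc j + p + 5 + c ≡⟨ cong (λ z → z + 5 + c) p+ ⟩
        k + 5 + c ≤⟨ +-monoˡ-≤ c (+-monoˡ-≤ 5 k≤K) ⟩
        N ≡⟨ sym (m+[n∸m]≡n (≤-trans (<⇒≤ 2+j≤k) (≤-trans k≤K (<⇒≤ K<N)))) ⟩
        suc j + (N ∸ suc j) ∎)))
    where
    open ≤-Reasoning
    p = k ∸ suc j
    p+ : suc j + p ≡ k
    p+ = m+[n∸m]≡n (<⇒≤ 2+j≤k)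
    lem : ∀ j c p → suc j + (4 + c + suc p) ≡ suc j + p + 5 + c
    lem = solve-∀

  g-iter : ∀ {k s} d → k ≤ K → 1 ≤ s → d + s < k → (K * K) ^ d * g k (d + s) ≤ g k s
  g-iter zero k≤K 1≤s lt = ≤-reflexive (+-identityʳ _)
  g-iter {k} {s} (suc d) k≤K 1≤s lt = begin
    K * K * (K * K) ^ d * g k (suc d + s) ≡⟨ lem (K * K) ((K * K) ^ d) _ ⟩
    (K * K) ^ d * (K * K * g k (suc d + s)) ≤⟨ *-monoʳ-≤ ((K * K) ^ d) (g-step k≤K (≤-trans 1≤s (m≤n+m s d)) lt) ⟩
    (K * K) ^ d * g k (d + s) ≤⟨ g-iter d k≤K 1≤s (<⇒≤ lt) ⟩
    g k s ∎
    where
    open ≤-Reasoning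
    lem : ∀ a b x → a * b * x ≡ b * (a * x)
    lem = solve-∀

  g-last : ∀ {k s} d → k ≤ K → 1 ≤ s → 2 + d + s ≡ k → K ^ 4 * (K * K) ^ d ≤ g k s
  g-last {k} {s} d k≤K 1≤s eq = ≤-trans (≤-trans (≤-reflexive (*-comm (K ^ 4) _)) (*-monoʳ-≤ ((K * K) ^ d) gd)) (g-iter d k≤K 1≤s lt)
    where
    lt : d + s < k
    lt = ≤-trans (n≤1+n _) (≤-reflexive eq)
    le : suc (d + s) + (6 + c) ≤ N
    le = ≤-trans (≤-reflexive (trans (lem d s c) (cong (λ z → z + 5 + c) eq))) (+-monoˡ-≤ c (+-monoˡ-≤ 5 k≤K))
      where
      lem : ∀ d s c → suc (d + s) + (6 + c) ≡ 2 + d + s + 5 + c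
      lem = solve-∀
    gd : K ^ 4 ≤ g k (d + s)
    gd = subst₂ (λ a b → K ^ 4 ≤ S a b) (∸-suc (≤-trans lt (≤-trans k≤K (<⇒≤ K<N)))) (sym (trans (cong (_∸ (d + s)) (sym eq)) (m+n∸n≡m 2 (d + s))))
      (S2-growth (N ∸ suc (d + s)) (≤-trans (≤-reflexive (sym (m+n∸m≡n (suc (d + s)) (6 + c)))) (∸-monoˡ-≤ (suc (d + s)) le)))

  g-last≤1 : ∀ {k s} → k ≤ suc s → g k s ≤ 1
  g-last≤1 {k} {s} k≤ with k ∸ s | m≤n+o⇒m∸n≤o k s (≤-trans k≤ (≤-reflexive (+-comm 1 s)))
  ... | zero | _ = S0≤1 (N ∸ s)
  ... | suc zero | _ = S1≤1 (N ∸ s)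
  ... | suc (suc _) | s≤s ()

  C≤K^ : ∀ {α s d} → α ≤ K → α ≤ d + s → s ≤ α → α C s ≤ K ^ d
  C≤K^ {α} {s} {d} α≤K α≤ s≤α = begin
    α C s ≡⟨ cong (_C s) (sym (m∸n+n≡m s≤α)) ⟩
    (α ∸ s + s) C s ≤⟨ C≤^ (α ∸ s) s ⟩
    (α ∸ s + s) ^ (α ∸ s) ≡⟨ cong (_^ (α ∸ s)) (m∸n+n≡m s≤α) ⟩
    α ^ (α ∸ s) ≤⟨ ^-monoˡ-≤ (α ∸ s) α≤K ⟩
    K ^ (α ∸ s) ≤⟨ ^-monoʳ-≤ K (m≤n+o⇒m∸n≤o α s (≤-trans α≤ (≤-reflexive (+-comm d s)))) ⟩
    K ^ d ∎
    where open ≤-Reasoning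

  cost-< : ∀ {k s q α} d → k ≤ K → q ≤ K → 1 ≤ s → d + s < k → s ≤ α → α ≤ d + s → (α C s) * (q ^ d * g k (d + s)) ≤ g k s
  cost-< {k} {s} {q} {α} d k≤K q≤K 1≤s lt s≤α α≤ = begin
    (α C s) * (q ^ d * g k (d + s)) ≤⟨ *-mono-≤ (C≤K^ (≤-trans α≤ (≤-trans (<⇒≤ lt) k≤K)) α≤ s≤α) (*-monoˡ-≤ (g k (d + s)) (^-monoˡ-≤ d q≤K)) ⟩
    K ^ d * (K ^ d * g k (d + s)) ≡⟨ sym (*-assoc (K ^ d) (K ^ d) _) ⟩
    K ^ d * K ^ d * g k (d + s) ≡⟨ cong (_* g k (d + s)) (sym (^-distribʳ d K K)) ⟩
    (K * K) ^ d * g k (d + s) ≤⟨ g-iter d k≤K 1≤s lt ⟩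
    g k s ∎
    where open ≤-Reasoning

  -- The extra factor K pays in `pair-small` for the sum over the blocks of A₀. The whole cost,
  -- K^(2d+4), is exactly what `g-last` provides.
  cost-last : ∀ {k s q α} d → k ≤ K → q ≤ K → 1 ≤ s → 2 + d + s ≡ k → s ≤ α → α ≤ k → (α C s) * (K * q ^ suc d) ≤ g k s
  cost-last {k} {s} {q} {α} d k≤K q≤K 1≤s eq s≤α α≤k = begin
    (α C s) * (K * q ^ suc d) ≤⟨ *-mono-≤ (C≤K^ {d = 2 + d} (≤-trans α≤k k≤K) (≤-trans α≤k (≤-reflexive (sym eq))) s≤α) (*-monoʳ-≤ K (^-monoˡ-≤ (suc d) q≤K)) ⟩
    K ^ (2 + d) * (K * K ^ suc d) ≡⟨ lem K (K ^ d) ⟩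
    K ^ 4 * (K ^ d * K ^ d) ≡⟨ cong (K ^ 4 *_) (sym (^-distribʳ d K K)) ⟩
    K ^ 4 * (K * K) ^ d ≤⟨ g-last d k≤K 1≤s eq ⟩
    g k s ∎
    where
    open ≤-Reasoning
    lem : ∀ K x → K * (K * x) * (K * (K * x)) ≡ K * (K * (K * (K * 1))) * (x * x)
    lem = solve-∀

  -- The factor α C s, paid by the other family for a cover of size α, is absorbed in the branching up to min(α, k - 1).
  cover-cost : ∀ {k s q α} → k ≤ K → q ≤ K → 1 ≤ s → 2 + s ≤ k → s ≤ α → α ≤ k →
    ∃ λ d → d + s ≤ α × d + s < k × (α C s) * (q ^ d * g k (d + s)) ≤ g k s
  cover-cost {k} {s} {q} {α} k≤K q≤K 1≤s 2+s≤k s≤α α≤k with m≤n⇒m<n∨m≡n α≤k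
  ... | inj₁ α<k = α ∸ s , ≤-reflexive e , ≤-trans (s≤s (≤-reflexive e)) α<k ,
        cost-< (α ∸ s) k≤K q≤K 1≤s (≤-trans (s≤s (≤-reflexive e)) α<k) s≤α (≤-reflexive (sym e))
    where e = m∸n+n≡m s≤α
  ... | inj₂ refl = suc d , <⇒≤ lt , lt ,
        ≤-trans (*-monoʳ-≤ (α C s) (≤-trans (*-monoʳ-≤ (q ^ suc d) (g-last≤1 {α} (≤-reflexive (sym eq)))) (≤-trans (≤-reflexive (*-identityʳ _)) (m≤n*m (q ^ suc d) K))))
          (cost-last d k≤K q≤K 1≤s eq s≤α α≤k)
    where
    d = α ∸ (2 + s)
    eq : 2 + d + s ≡ α
    eq = trans (lem d s) (m∸n+n≡m 2+s≤k)
      where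
      lem : ∀ d s → 2 + d + s ≡ d + (2 + s)
      lem = solve-∀
    lt : suc d + s < α
    lt = ≤-reflexive eq

  private variable
    k l s : ℕ

  cover-≥ : ∀ Z {B : List (Subset N)} → Cover s Z 𝓑 → B ∈L 𝓑 → s ≤ length Z
  cover-≥ Z {B} cov B∈ = ≤-trans (All.lookup cov B∈) (length-filter (_∈? B) Z)

  not-cover : ∀ {X : List (Subset N)} → IsKFamily N k 𝓐 → IsKFamily N l 𝓑 → Cross s 𝓐 𝓑 → ¬ Cover s X 𝓑 → Extends l 𝓐 X
  not-cover {𝓑 = 𝓑} {s = s} {X = X} famA famB cr ¬cov with find (¬All⇒Any¬ (λ B → s ≤? meet X B) 𝓑 ¬cov)
  ... | B , B∈ , ¬le = extends-by (≤-reflexive (proj₂ (All.lookup (proj₁ famB) B∈))) (≰⇒> ¬le) λ {A} A∈ →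
        common A B , common-unique A B (partition-unique (All.lookup (proj₁ famA) A∈)) , cr A∈ B∈ , common-⊑ˡ A B , common-⊑ʳ A B

  -- Smallest covers are not searched for. The claim is decidable, so it may be assumed to fail; a
  -- smaller cover would then prove it by recursion, and Z and W can be treated as smallest. The
  -- start is A₀ as a cover of 𝓑 and B₀ as a cover of 𝓐.
  pair-generic : IsKFamily N k 𝓐 → IsKFamily N l 𝓑 → Cross s 𝓐 𝓑 → k ≤ K → l ≤ K → 1 ≤ s → 2 + s ≤ k → 2 + s ≤ l →
    ∀ {A₀ B₀} → A₀ ∈L 𝓐 → B₀ ∈L 𝓑 → length 𝓐 * length 𝓑 ≤ g k s * g l s
  pair-generic {k = k} {𝓐} {l} {𝓑} {s} famA famB cr k≤K l≤K 1≤s 2+s≤k 2+s≤l {A₀} {B₀} A₀∈ B₀∈ =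
    go (suc (k + l)) A₀ B₀ (s≤s (≤-reflexive (cong₂ _+_ (len famA A₀∈) (len famB B₀∈)))) (uniq famA A₀∈) (uniq famB B₀∈)
      (≤-reflexive (len famA A₀∈)) (≤-reflexive (len famB B₀∈)) (All.tabulate (cr A₀∈)) (All.tabulate (Cross-sym famA cr B₀∈))
    where
    uniq : ∀ {j 𝓕} {F : List (Subset N)} → IsKFamily N j 𝓕 → F ∈L 𝓕 → Unique F
    uniq fam F∈ = partition-unique (All.lookup (proj₁ fam) F∈)
    len : ∀ {j 𝓕} {F : List (Subset N)} → IsKFamily N j 𝓕 → F ∈L 𝓕 → length F ≡ j
    len fam F∈ = proj₂ (All.lookup (proj₁ fam) F∈)
    half : ∀ {k l 𝓐 𝓑 d} {Z W : List (Subset N)} → IsKFamily N k 𝓐 → IsKFamily N l 𝓑 → Cross s 𝓐 𝓑 →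
      (∀ X → Unique X → length X < length Z → ¬ Cover s X 𝓑) → Unique W → Cover s W 𝓐 → d + s ≤ length Z → d + s < k →
      length 𝓐 ≤ (length W C s) * (l ^ d * g k (d + s))
    half {k} {l} {𝓐} {𝓑} {d} {Z} {W} famA famB cr none uW covW d≤ d< = ≤-trans (length≤countMeet 𝓐 W s covW)
      (countMeet-≤ 𝓐 W s [] [] uW (All.tabulate λ _ ()) λ X uX eq _ →
        branch 𝓐 (λ X′ uX′ lt → not-cover famA famB cr (none X′ uX′ lt)) d X uX
          (≤-trans (≤-reflexive (cong (d +_) (trans eq (+-identityʳ s)))) d≤)
          (λ X′ uX′ eq′ _ → subst (λ j → deg 𝓐 X′ ≤ g k j) (trans eq′ (cong (d +_) (trans eq (+-identityʳ s))))
            (deg-≤-length famA X′ uX′ (≤-trans (s≤s (≤-reflexive (trans eq′ (cong (d +_) (trans eq (+-identityʳ s)))))) d<))))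
    go : ∀ f Z W → length Z + length W < f → Unique Z → Unique W → length Z ≤ k → length W ≤ l → Cover s Z 𝓑 → Cover s W 𝓐 →
      length 𝓐 * length 𝓑 ≤ g k s * g l s
    go (suc f) Z W (s≤s lt) uZ uW Z≤k W≤l covZ covW = decidable-stable (_ ≤? _) λ ¬goal →
      let
        noneZ : ∀ X → Unique X → length X < length Z → ¬ Cover s X 𝓑
        noneZ X uX l< cov = ¬goal (go f X W (<-≤-trans (+-monoˡ-< (length W) l<) lt) uX uW (≤-trans (<⇒≤ l<) Z≤k) W≤l cov covW)
        noneW : ∀ X → Unique X → length X < length W → ¬ Cover s X 𝓐
        noneW X uX l< cov = ¬goal (go f Z X (<-≤-trans (+-monoʳ-< (length Z) l<) lt) uZ uX Z≤k (≤-trans (<⇒≤ l<) W≤l) covZ cov)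
        (d , d≤ , d< , costZ) = cover-cost {k} {s} {l} {length Z} k≤K l≤K 1≤s 2+s≤k (cover-≥ Z covZ B₀∈) Z≤k
        (e , e≤ , e< , costW) = cover-cost {l} {s} {k} {length W} l≤K k≤K 1≤s 2+s≤l (cover-≥ W covW A₀∈) W≤l
      in ¬goal (begin
        length 𝓐 * length 𝓑 ≤⟨ *-mono-≤ (half {Z = Z} famA famB cr noneZ uW covW d≤ d<) (half {Z = W} famB famA (Cross-sym famA cr) noneW uZ covZ e≤ e<) ⟩
        (length W C s) * (l ^ d * g k (d + s)) * ((length Z C s) * (k ^ e * g l (e + s)))
          -- The binomial coefficients change places: 𝓐 is counted through W but branches to a depth
          -- set by |Z|, so its degree bound can absorb C(|Z|,s), and likewise for 𝓑.
          ≡⟨ rearrange (length W C s) (l ^ d * g k (d + s)) (length Z C s) (k ^ e * g l (e + s)) ⟩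
        (length Z C s) * (l ^ d * g k (d + s)) * ((length W C s) * (k ^ e * g l (e + s))) ≤⟨ *-mono-≤ costZ costW ⟩
        g k s * g l s ∎)
      where
      open ≤-Reasoning
      rearrange : ∀ a x b y → a * x * (b * y) ≡ b * x * (a * y)
      rearrange = solve-∀

  -- k = s + 1: the members of 𝓑 containing A₀ - y split the block y, and Σ_y S(|y|, m) ≤ S(n - s, m).
  pair-small : IsKFamily N (suc s) 𝓐 → IsKFamily N l 𝓑 → Cross s 𝓐 𝓑 → suc s ≤ K → l ≤ K → 1 ≤ s → 2 + s ≤ l →
    ∀ {A₀ B₀} → A₀ ∈L 𝓐 → B₀ ∈L 𝓑 → length 𝓐 * length 𝓑 ≤ g l s
  pair-small {s = s} {𝓐} {l} {𝓑} famA famB cr k≤K l≤K 1≤s 2+s≤l {A₀} {B₀} A₀∈ B₀∈ =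
    go (suc l) B₀ (s≤s (≤-reflexive lenB)) (partition-unique partB) (≤-reflexive lenB) (All.tabulate (Cross-sym famA cr B₀∈))
    where
    k′ = suc s
    partA = All.lookup (proj₁ famA) A₀∈
    partB = All.lookup (proj₁ famB) B₀∈
    lenA = proj₂ partA
    lenB = proj₂ partB
    uA = partition-unique partA
    crBA = Cross-sym famA cr
    contains : ∀ {B} → B ∈L 𝓑 → Any (λ y → remove y A₀ ⊑ B) A₀
    contains {B} B∈ with missing-one uA lenA (cr A₀∈ B∈)
    ... | inj₂ a = Any.map proj₂ a
    ... | inj₁ A₀⊑B with ∣∣≡suc⇒∈ A₀ lenA
      where
      ∣∣≡suc⇒∈ : ∀ (xs : List (Subset N)) {m} → length xs ≡ suc m → ∃ λ x → x ∈L xs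
      ∣∣≡suc⇒∈ (x ∷ xs) _ = x , here refl
    ...   | y , y∈ = lose y∈ (⊑-trans (remove-⊑ y A₀) A₀⊑B)
    B≤Σ : length 𝓑 ≤ sum (map (λ y → deg 𝓑 (remove y A₀)) A₀)
    B≤Σ = ≤-trans (≤-reflexive (cong length (sym (filter-all always? {xs = 𝓑} (All.tabulate λ _ → tt)))))
      (filter-length-⋃ always? (λ y → remove y A₀ ⊑?_) A₀ 𝓑 (λ B∈ _ → contains B∈))
      where
      always? : ∀ (B : List (Subset N)) → Dec ⊤
      always? _ = yes tt
    module _ (W : List (Subset N)) (noneW : ∀ X → Unique X → length X < length W → ¬ Cover s X 𝓐) where
      deg-remove : ∀ d → d + s ≤ length W → d + s < l → ∀ {y} → y ∈L A₀ → deg 𝓑 (remove y A₀) ≤ k′ ^ d * S (∣ y ∣ ∸ d) (l ∸ (d + s))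
      deg-remove d d≤ d< {y} y∈ = branch 𝓑 (λ X uX lt → not-cover famB famA crBA (noneW X uX lt)) d X₀ uX₀
          (≤-trans (≤-reflexive (cong (d +_) lenX)) d≤)
          (λ X uX eq X₀⊑X → let eq′ = trans eq (cong (d +_) lenX) in
            ≤-trans (deg-≤ famB X₀ X uX₀ uX X₀⊑X (≤-trans (s≤s (≤-reflexive eq′)) d<))
              (≤-reflexive (cong₂ S (cong₂ _∸_ rest-size (trans (cong₂ _∸_ eq′ lenX) (m+n∸n≡m d s))) (cong (l ∸_) eq′))))
        where
        X₀ = remove y A₀
        uX₀ = remove-unique y uA
        lenX : length X₀ ≡ s
        lenX = suc-injective (trans (length-remove uA y∈) lenA)
        rest-size : N ∸ weight X₀ ≡ ∣ y ∣
        rest-size = trans (cong (_∸ weight X₀) (trans (sym (trans (PartOf-weight (partition-PartOf partA)) (∣⊤∣≡n N))) (weight-↭ (remove-↭ uA y∈)))) (m+n∸n≡m ∣ y ∣ (weight X₀))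
    Σ-split : ∀ d m → 2 + m + (d + s) ≡ l → sum (map (λ y → k′ ^ d * S (∣ y ∣ ∸ d) (2 + m)) A₀) ≤ k′ ^ d * g l (d + s)
    Σ-split d m eq = ≤-trans (≤-reflexive (sum-*ˡ (k′ ^ d) (λ y → S (∣ y ∣ ∸ d) (2 + m)) A₀)) (*-monoʳ-≤ (k′ ^ d) (sizes A₀ lenA (PartOf-weight (partition-PartOf partA)) (PartOf.nonempty (partition-PartOf partA))))
      where
      sum-*ˡ : ∀ x (f : Subset N → ℕ) zs → sum (map (λ y → x * f y) zs) ≡ x * sum (map f zs)
      sum-*ˡ x f [] = sym (*-zeroʳ x)
      sum-*ˡ x f (z ∷ zs) = trans (cong (x * f z +_) (sum-*ˡ x f zs)) (sym (*-distribˡ-+ x (f z) _))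
      map-map : ∀ (zs : List (Subset N)) → sum (map (λ y → S (∣ y ∣ ∸ d) (2 + m)) zs) ≡ sum (map (λ y → S (y ∸ d) (2 + m)) (map ∣_∣ zs))
      map-map [] = refl
      map-map (z ∷ zs) = cong (S (∣ z ∣ ∸ d) (2 + m) +_) (map-map zs)
      sizes : ∀ (A : List (Subset N)) → length A ≡ suc s → weight A ≡ ∣ full {N} ∣ → All Nonempty A → sum (map (λ y → S (∣ y ∣ ∸ d) (2 + m)) A) ≤ g l (d + s)
      sizes (x ∷ xs) len w (ne ∷ nes) = ≤-trans (≤-reflexive (map-map (x ∷ xs))) (≤-trans
        (sum-S-≤ m d ∣ x ∣ (map ∣_∣ xs) (Nonempty⇒1≤∣∣ ne) (Allₚ.map⁺ (All.map Nonempty⇒1≤∣∣ nes)))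
        (≤-reflexive (cong₂ S (trans (cong₂ (λ a b → a ∸ b ∸ d) (trans w (∣⊤∣≡n N)) (trans (length-map ∣_∣ xs) (suc-injective len))) (trans (∸-+-assoc N s d) (cong (N ∸_) (+-comm s d))))
          (trans (sym (m+n∸n≡m (2 + m) (d + s))) (cong (_∸ (d + s)) eq)))))
    go : ∀ f W → length W < f → Unique W → length W ≤ l → Cover s W 𝓐 → length 𝓐 * length 𝓑 ≤ g l s
    go (suc f) W (s≤s lt) uW W≤l covW = decidable-stable (_ ≤? _) λ ¬goal →
      let
        noneW : ∀ X → Unique X → length X < length W → ¬ Cover s X 𝓐
        noneW X uX l< cov = ¬goal (go f X (<-≤-trans l< lt) uX (≤-trans (<⇒≤ l<) W≤l) cov)
      in ¬goal (bound noneW)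
      where
      open ≤-Reasoning
      s≤W : s ≤ length W
      s≤W = cover-≥ W covW A₀∈
      A≤ : length 𝓐 ≤ length W C s
      A≤ = ≤-trans (length≤countMeet 𝓐 W s covW) (≤-trans (countMeet-≤ 𝓐 W s [] [] uW (All.tabulate λ _ ())
        λ X uX eq _ → deg≤1 famA X uX (s≤s (≤-reflexive (sym (trans eq (+-identityʳ s)))))) (≤-reflexive (*-identityʳ _)))
      bound : (∀ X → Unique X → length X < length W → ¬ Cover s X 𝓐) → length 𝓐 * length 𝓑 ≤ g l s
      -- Superadditivity needs two remaining blocks. If |W| ≥ l - 1, the branching goes down to one
      -- remaining block instead; all Stirling numbers are then at most 1, and the sum has at most K
      -- terms.
      bound noneW with 2 + length W ≤? l
      ... | yes 2+W≤l = begin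
        length 𝓐 * length 𝓑 ≤⟨ *-mono-≤ A≤ (≤-trans B≤Σ (≤-trans (sum-map-mono A₀ (λ {y} y∈ → ≤-trans (deg-remove W noneW d d≤ d< y∈) (≤-reflexive (cong (λ z → k′ ^ d * S (∣ y ∣ ∸ d) z) l∸)))) (Σ-split d m eq))) ⟩
        (length W C s) * (k′ ^ d * g l (d + s)) ≤⟨ cost-< d l≤K k≤K 1≤s d< s≤W (≤-reflexive (sym W≡)) ⟩
        g l s ∎
        where
        d = length W ∸ s
        m = l ∸ (2 + length W)
        W≡ : d + s ≡ length W
        W≡ = m∸n+n≡m s≤W
        d≤ = ≤-reflexive W≡
        d< : d + s < l
        d< = ≤-trans (s≤s d≤) (≤-trans (n≤1+n _) 2+W≤l)
        eq : 2 + m + (d + s) ≡ l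
        eq = trans (cong (2 + m +_) W≡) (trans (lem m (length W)) (m∸n+n≡m 2+W≤l))
          where
          lem : ∀ m w → 2 + m + w ≡ m + (2 + w)
          lem = solve-∀
        l∸ : l ∸ (d + s) ≡ 2 + m
        l∸ = trans (cong (_∸ (d + s)) (sym eq)) (m+n∸n≡m (2 + m) (d + s))
      ... | no 2+W≰l = begin
        length 𝓐 * length 𝓑 ≤⟨ *-mono-≤ A≤ (≤-trans B≤Σ (sum-map-≤ _ A₀ (All.tabulate λ {y} y∈ → ≤-trans (deg-remove W noneW (suc d) d≤ d< y∈) (last y)))) ⟩
        (length W C s) * (length A₀ * k′ ^ suc d) ≤⟨ *-monoʳ-≤ (length W C s) (*-monoˡ-≤ (k′ ^ suc d) (≤-trans (≤-reflexive lenA) k≤K)) ⟩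
        (length W C s) * (K * k′ ^ suc d) ≤⟨ cost-last d l≤K k≤K 1≤s eq s≤W W≤l ⟩
        g l s ∎
        where
        d = l ∸ (2 + s)
        eq : 2 + d + s ≡ l
        eq = trans (lem d s) (m∸n+n≡m 2+s≤l)
          where
          lem : ∀ d s → 2 + d + s ≡ d + (2 + s)
          lem = solve-∀
        d< : suc d + s < l
        d< = ≤-reflexive eq
        d≤ : suc d + s ≤ length W
        d≤ = s≤s⁻¹ (≤-trans d< (s≤s⁻¹ (≰⇒> 2+W≰l)))
        last : ∀ y → k′ ^ suc d * S (∣ y ∣ ∸ suc d) (l ∸ (suc d + s)) ≤ k′ ^ suc d
        last y rewrite trans (cong (_∸ (suc d + s)) (sym eq)) (m+n∸n≡m 1 (suc d + s)) = ≤-trans (*-monoʳ-≤ (k′ ^ suc d) (S1≤1 (∣ y ∣ ∸ suc d))) (≤-reflexive (*-identityʳ _))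

  g-suc≡1 : s < N → g (suc s) s ≡ 1
  g-suc≡1 {s} s<N = subst₂ (λ a b → S a b ≡ 1) (∸-suc s<N) (sym (m+n∸n≡m 1 s)) (S1≡1 (N ∸ suc s))

  -- For k = s + 1 the factor `g k s` is 1 and absorbs nothing, so 𝓑 has to pay for both families.
  -- For k = l = s + 1 neither can pay, but then partitions with s common blocks coincide.
  pair-bound : IsKFamily N k 𝓐 → IsKFamily N l 𝓑 → Cross s 𝓐 𝓑 → k ≤ K → l ≤ K → 1 ≤ s → s < k → s < l →
    length 𝓐 * length 𝓑 ≤ g k s * g l s
  pair-bound {𝓐 = []} _ _ _ _ _ _ _ _ = z≤n
  pair-bound {𝓐 = A ∷ 𝓐} {𝓑 = []} _ _ _ _ _ _ _ _ = ≤-trans (≤-reflexive (*-zeroʳ (length (A ∷ 𝓐)))) z≤n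
  pair-bound {k} {𝓐@(A ∷ _)} {l} {𝓑@(B ∷ _)} {s} famA famB cr k≤K l≤K 1≤s s<k s<l with m≤n⇒m<n∨m≡n s<k | m≤n⇒m<n∨m≡n s<l
  ... | inj₁ p | inj₁ q = pair-generic famA famB cr k≤K l≤K 1≤s p q (here refl) (here refl)
  ... | inj₂ refl | inj₁ q = ≤-trans (pair-small famA famB cr k≤K l≤K 1≤s q (here refl) (here refl))
        (≤-reflexive (trans (sym (*-identityˡ _)) (cong (_* g l s) (sym (g-suc≡1 (≤-trans s<k (≤-trans k≤K (<⇒≤ K<N))))))))
  ... | inj₁ p | inj₂ refl = ≤-trans (≤-reflexive (*-comm (length 𝓐) (length 𝓑))) (≤-trans (pair-small famB famA (Cross-sym famA cr) l≤K k≤K 1≤s p (here refl) (here refl))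
        (≤-reflexive (trans (sym (*-identityʳ _)) (cong (g k s *_) (sym (g-suc≡1 (≤-trans s<l (≤-trans l≤K (<⇒≤ K<N)))))))))
  ... | inj₂ refl | inj₂ refl = ≤-trans
        (*-mono-≤ (all-same-length famA (All.tabulate λ A∈ → same-by-meet (All.lookup (proj₁ famA) A∈) (All.head (proj₁ famB)) (s≤s (cr A∈ (here refl)))))
                  (all-same-length famB (All.tabulate λ B∈ → same-by-meet (All.lookup (proj₁ famB) B∈) (All.head (proj₁ famA)) (s≤s (Cross-sym famA cr B∈ (here refl))))))
        (≤-reflexive (sym (cong₂ _*_ (g-suc≡1 s<N) (g-suc≡1 s<N))))
    where s<N = ≤-trans s<k (≤-trans k≤K (<⇒≤ K<N))

-- Families meeting a (t+1)-set of blocks in at least t of them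

sucC : ∀ s → suc s C s ≡ suc s
sucC zero = nC0≡1 1
sucC (suc s) = trans (sym (nCk+nC[k+1]≡[n+1]C[k+1] (suc s) s)) (trans (cong₂ _+_ (sucC s) (nCn≡1 (suc s))) (+-comm (suc s) 1))

2+C : ∀ s → 2 * ((2 + s) C s) ≡ (1 + s) * (2 + s)
2+C zero = cong (2 *_) (nC0≡1 2)
2+C (suc s) = trans (cong (2 *_) (trans (sym (nCk+nC[k+1]≡[n+1]C[k+1] (2 + s) s)) (cong ((2 + s) C s +_) (sucC (suc s)))))
  (trans (*-distribˡ-+ 2 ((2 + s) C s) (2 + s)) (trans (cong (_+ 2 * (2 + s)) (2+C s)) (lem s)))
  where
  lem : ∀ s → (1 + s) * (2 + s) + 2 * (2 + s) ≡ (2 + s) * (3 + s)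
  lem = solve-∀

Singleton : Subset n → Set
Singleton B = ∃ λ x → B ≡ ⁅ x ⁆

singleton-or-2≤ : ∀ {B : Subset n} → Nonempty B → Singleton B ⊎ 2 ≤ ∣ B ∣
singleton-or-2≤ {B = B} (x , x∈) with nonempty? (B - x)
... | yes ne = inj₂ (≤-trans (+-mono-≤ (Nonempty⇒1≤∣∣ ne) (≤-reflexive (sym (∣⁅x⁆∣≡1 x)))) (≤-reflexive (∣─∣ B ⁅ x ⁆ (∈⇒⁅⁆⊆ x∈))))
... | no ¬ne = inj₁ (x , ⊆ₛ-antisym (λ {z} z∈ → case z ∈ₛ? ⁅ x ⁆ of λ { (yes p) → p ; (no ¬p) → ⊥-elim (¬ne (z , x∈p∧x∉q⇒x∈p─q z∈ ¬p)) }) (∈⇒⁅⁆⊆ x∈))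

singletons-or-2≤ : All Nonempty X → All Singleton X ⊎ Any (λ B → 2 ≤ ∣ B ∣) X
singletons-or-2≤ [] = inj₁ []
singletons-or-2≤ (ne ∷ nes) with singleton-or-2≤ ne | singletons-or-2≤ nes
... | inj₂ b | _ = inj₂ (here b)
... | inj₁ _ | inj₂ a = inj₂ (there a)
... | inj₁ s | inj₁ ss = inj₁ (s ∷ ss)

singletons-weight : All Singleton X → weight X ≡ length X
singletons-weight [] = refl
singletons-weight ((x , refl) ∷ ss) = cong₂ _+_ (∣⁅x⁆∣≡1 x) (singletons-weight ss)

∈-─* : ∀ {U : Subset n} {x} → x ∈ₛ U → All (x ∉ₛ_) X → x ∈ₛ U ─* X
∈-─* x∈ [] = x∈
∈-─* x∈ (x∉ ∷ h) = ∈-─* (x∈p∧x∉q⇒x∈p─q x∈ x∉) h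

split-head : ∀ {s B} {T A : List (Subset n)} → suc s ≤ meet (B ∷ T) A → suc s ≤ meet T A ⊎ (B ∈L A × s ≤ meet T A)
split-head {B = B} {T} {A} le = case B ∈? A of λ where
  (yes B∈) → inj₂ (B∈ , s≤s⁻¹ (≤-trans le (≤-reflexive (meet-∈ T A B∈))))
  (no B∉) → inj₁ (≤-trans le (≤-reflexive (meet-∉ T A B∉)))

-- The blocks of P cover [n], so Q has no points left for a further block.
⊑-Same : ∀ {k l} {P Q : List (Subset n)} → IsKPartition n k P → IsKPartition n l Q → P ⊑ Q → SameBlocks P Q × k ≡ l
⊑-Same {n = n} {P = P} {Q} partP partQ P⊑Q with ⊆⇒↭ (partition-unique partP) P⊑Q
... | [] , p = ↭⇒SameBlocks (↭-trans (++-comm [] P) (↭-sym p)) , trans (sym (proj₂ partP)) (trans (↭-length (↭-trans (++-comm [] P) (↭-sym p))) (proj₂ partQ))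
... | x ∷ R , p = ⊥-elim (PartOf-∣∣0 (PartOf-full (PartOf-++ P (PartOf-↭ (↭-sym (++-comm P [])) (partition-PartOf partP)))) (PartOf-++ P (PartOf-↭ p (partition-PartOf partQ))))

argmin : ∀ {a} {A : Set a} (f : A → ℕ) x xs → ∃ λ z → z ∈L (x ∷ xs) × All (λ y → f z ≤ f y) (x ∷ xs)
argmin f x [] = x , here refl , ≤-refl ∷ []
argmin f x (y ∷ ys) with argmin f y ys
... | z , z∈ , h with f x ≤? f z
...   | yes p = x , here refl , ≤-refl ∷ All.map (≤-trans p) h
...   | no ¬p = z , there z∈ , <⇒≤ (≰⇒> ¬p) ∷ h

module Intersecting (K c : ℕ) (3≤K : 3 ≤ K) (big : K ^ (2 * K) ≤ 2 ^ (2 * K + c)) (t : ℕ) (1≤t : 1 ≤ t) where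
  open Growth K c 3≤K big using (not-all-small)
  open Bounds K c 3≤K big

  private variable
    k : ℕ

  -- `W₊` is the factor (t+1)A₊ - tB₊ of the theorem, freed of subtraction by A₊ = (k-t)R₊ + B₊.
  -- Given t singletons and a further point x, (k-t)R₊ counts the completions to a k-partition
  -- without the block {x}, and B₊ those with it.
  A₊ B₊ R₊ W₊ : ℕ → ℕ
  A₊ k = g k t
  B₊ k = g k (suc t)
  R₊ k = S (N ∸ suc t) (k ∸ t)
  W₊ k = suc t * ((k ∸ t) * R₊ k) + B₊ k

  t<N : 2 + t ≤ k → k ≤ K → t < N
  t<N p q = ≤-trans (<⇒≤ p) (≤-trans q (<⇒≤ K<N))

  A≡ : 2 + t ≤ k → k ≤ K → A₊ k ≡ (k ∸ t) * R₊ k + B₊ k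
  A≡ {k} p q = trans (cong₂ S (sym (∸-suc (t<N p q))) (sym (∸-suc (<⇒≤ p)))) (cong (λ z → z * S (N ∸ suc t) z + B₊ k) (∸-suc (<⇒≤ p)))

  W≡ : 2 + t ≤ k → k ≤ K → W₊ k ≡ A₊ k + t * ((k ∸ t) * R₊ k)
  W≡ {k} p q = trans (lem t ((k ∸ t) * R₊ k) (B₊ k)) (cong (_+ t * ((k ∸ t) * R₊ k)) (sym (A≡ p q)))
    where
    lem : ∀ t x b → suc t * x + b ≡ x + b + t * x
    lem = solve-∀

  R-pos : 2 + t ≤ k → k ≤ K → 0 < R₊ k
  R-pos {k} p q = subst₂ (λ a b → 0 < S a b) (∸-suc (≤-trans p (≤-trans q (<⇒≤ K<N)))) (∸-suc (<⇒≤ p)) (S-pos (∸-monoˡ-≤ (2 + t) (≤-trans (s≤s q) K<N)))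

  B-pos : 2 + t ≤ k → k ≤ K → 0 < B₊ k
  B-pos p q = g-pos q p

  R<mR : 2 + t ≤ k → k ≤ K → R₊ k + R₊ k ≤ (k ∸ t) * R₊ k
  R<mR {k} p q = ≤-trans (≤-reflexive (cong (R₊ k +_) (sym (+-identityʳ (R₊ k))))) (*-monoˡ-≤ (R₊ k) 2≤)
    where
    2≤ : 2 ≤ k ∸ t
    2≤ = ≤-trans (≤-reflexive (sym (m+n∸n≡m 2 t))) (∸-monoˡ-≤ t p)

  A<W : 2 + t ≤ k → k ≤ K → A₊ k < W₊ k
  A<W {k} p q = ≤-trans (≤-reflexive (+-comm 1 (A₊ k))) (≤-trans (+-monoʳ-≤ (A₊ k) (*-mono-≤ 1≤t (≤-trans (R-pos p q) (≤-trans (m≤m+n (R₊ k) (R₊ k)) (R<mR p q))))) (≤-reflexive (sym (W≡ p q))))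

  -- Since k - t ≥ 2, W₊ exceeds A₊ by at least 2tR₊. One tR₊ is for a set T with a non-singleton,
  -- the other is room for the partitions counted by e.
  A+tR<W : 2 + t ≤ k → k ≤ K → ∀ {e} → e < t * R₊ k → A₊ k + t * R₊ k + e < W₊ k
  A+tR<W {k} p q {e} e< = <-≤-trans (+-monoʳ-< (A₊ k + t * R₊ k) e<) (≤-trans (≤-reflexive (lem (A₊ k) t (R₊ k))) (≤-trans (+-monoʳ-≤ (A₊ k) (*-monoʳ-≤ t (R<mR p q))) (≤-reflexive (sym (W≡ p q)))))
    where
    lem : ∀ a t r → a + t * r + t * r ≡ a + t * (r + r)
    lem = solve-∀

  0<tR : 2 + t ≤ k → k ≤ K → 0 < t * R₊ k
  0<tR p q = *-mono-≤ 1≤t (R-pos p q)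

  deg≤A : IsKFamily N k 𝓐 → 2 + t ≤ k → ∀ X → Unique X → length X ≡ t → deg 𝓐 X ≤ A₊ k
  deg≤A {k} {𝓐} fam p X uX eq = subst (λ j → deg 𝓐 X ≤ g k j) eq (deg-≤-length fam X uX (≤-trans (s≤s (≤-reflexive eq)) (<⇒≤ p)))

  deg≤B : IsKFamily N k 𝓐 → 2 + t ≤ k → ∀ X → Unique X → length X ≡ suc t → deg 𝓐 X ≤ B₊ k
  deg≤B {k} {𝓐} fam p X uX eq = subst (λ j → deg 𝓐 X ≤ g k j) eq (deg-≤-length fam X uX (≤-trans (s≤s (≤-reflexive eq)) p))

  length≤B : IsKFamily N k 𝓐 → 2 + t ≤ k → ∀ X → Unique X → length X ≡ suc t → All (X ⊑_) 𝓐 → length 𝓐 ≤ B₊ k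
  length≤B {𝓐 = 𝓐} fam p X uX eq h = ≤-trans (length≤deg 𝓐 h) (deg≤B fam p X uX eq)

  module _ {k : ℕ} {𝓕 : List (List (Subset N))} (fam : IsKFamily N k 𝓕) (2+t≤k : 2 + t ≤ k) (k≤K : k ≤ K)
           {T : List (Subset N)} (uT : Unique T) (lenT : length T ≡ suc t) (meets : All (λ F → t ≤ meet T F) 𝓕) where

    -- At most B₊ members contain T. Any other one misses a single block {x} of T, and beyond the
    -- rest of T it is a partition of n - t points in which x is not alone.
    singletons-bound : All Singleton T → length 𝓕 ≤ W₊ k
    singletons-bound ss = begin
      length 𝓕 ≤⟨ length-filter-∪ (T ⊑?_) (λ F → anyL? (λ B → bad? B F) T) 𝓕 (λ F∈ → missing-one uT lenT (All.lookup meets F∈)) ⟩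
      deg 𝓕 T + length (filter (λ F → anyL? (λ B → bad? B F) T) 𝓕)
        ≤⟨ +-mono-≤ (deg≤B fam 2+t≤k T uT lenT) (≤-trans (filter-length-⋃ (λ F → anyL? (λ B → bad? B F) T) bad? T 𝓕 (λ _ → id))
             (≤-trans (sum-map-≤ (λ B → length (filter (bad? B) 𝓕)) T (All.tabulate (λ B∈ → one B∈))) (≤-reflexive (cong (_* ((k ∸ t) * R₊ k)) lenT)))) ⟩
      B₊ k + suc t * ((k ∸ t) * R₊ k) ≡⟨ +-comm (B₊ k) _ ⟩
      W₊ k ∎
      where
      open ≤-Reasoning
      bad? : ∀ B F → Dec (B ∉L F × remove B T ⊑ F)
      bad? B F = ¬? (B ∈? F) ×-dec (remove B T ⊑? F)
      one : ∀ {B} → B ∈L T → length (filter (bad? B) 𝓕) ≤ (k ∸ t) * R₊ k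
      one {B} B∈ with filter (bad? B) 𝓕 in eq
      ... | [] = z≤n
      ... | F ∷ Fs = subst (λ z → length z ≤ (k ∸ t) * R₊ k) eq bound
        where
        X₀ = remove B T
        lenX : length X₀ ≡ t
        lenX = suc-injective (trans (length-remove uT B∈) lenT)
        F∈ : F ∈L 𝓕 × (B ∉L F × X₀ ⊑ F)
        F∈ = ∈-filter⁻ (bad? B) {xs = 𝓕} (subst (F ∈L_) (sym eq) (here refl))
        x = proj₁ (All.lookup ss B∈)
        B≡ : B ≡ ⁅ x ⁆
        B≡ = proj₂ (All.lookup ss B∈)
        x∉X₀ : All (x ∉ₛ_) X₀
        x∉X₀ = All.tabulate λ {D} D∈ x∈D → let (y , D≡) = All.lookup ss (All.lookup (remove-⊑ B T) D∈) in
          remove-∌ B T (subst (_∈L X₀) (trans D≡ (sym (trans B≡ (cong ⁅_⁆ (x∈⁅y⁆⇒x≡y y (subst (x ∈ₛ_) D≡ x∈D)))))) D∈)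
        U = full ─* X₀
        ∣U∣ : ∣ U ∣ ≡ N ∸ t
        ∣U∣ = trans (─*-weight (All.lookup (proj₁ fam) (proj₁ F∈)) (remove-unique B uT) (proj₂ (proj₂ F∈)))
                (cong (N ∸_) (trans (singletons-weight (All.tabulate (λ D∈ → All.lookup ss (All.lookup (remove-⊑ B T) D∈)))) lenX))
        x∈U : x ∈ₛ U
        x∈U = ∈-─* ∈⊤ x∉X₀
        E : Enumeration U (k ∸ length X₀) (S (N ∸ suc t) (k ∸ t) * (k ∸ t)) (λ P → ⁅ x ⁆ ∉L P)
        E = subst (λ j → Enumeration U j (S (N ∸ suc t) (k ∸ t) * (k ∸ t)) (λ P → ⁅ x ⁆ ∉L P)) (cong (k ∸_) (sym lenX))
              (enumerate-≢⁅y⁆ x∈U (enumerate (N ∸ suc t) (U - x) (∣-∣ U x∈U (trans ∣U∣ (sym (∸-suc (t<N 2+t≤k k≤K))))) (k ∸ t)))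
        bound : length (filter (bad? B) 𝓕) ≤ (k ∸ t) * R₊ k
        bound = ≤-trans (enumerated-length X₀ E (IsKFamily-filter (bad? B) fam) (remove-unique B uT)
            (All.map (λ {F} (B∉ , X₀⊑F) → X₀⊑F , λ Q p x∈Q → B∉ (subst (_∈L F) (sym B≡) (∈-resp-↭ (↭-sym p) (∈-++⁺ʳ X₀ x∈Q)))) (Allₚ.all-filter (bad? B) 𝓕)))
          (≤-reflexive (*-comm (R₊ k) (k ∸ t)))

    -- A member contains all t blocks of T other than B, or it contains B and at least t - 1 of
    -- those t blocks; the second case gives t sets of size t through B.
    split-bound : ∀ {B M} → B ∈L T → (∀ X → Unique X → length X ≡ t → B ∷ [] ⊑ X → deg 𝓕 X ≤ M) →
      length 𝓕 ≤ deg 𝓕 (remove B T) + t * M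
    split-bound {B} {M} B∈ deg≤ = begin
      length 𝓕 ≤⟨ length-filter-∪ (T′ ⊑?_) (λ F → (B ∷ [] ⊑? F) ×-dec (t ∸ 1 ≤? meet T′ F)) 𝓕 split ⟩
      deg 𝓕 T′ + countMeet 𝓕 T′ (t ∸ 1) (B ∷ []) ≤⟨ +-monoʳ-≤ (deg 𝓕 T′)
        (countMeet-≤ 𝓕 T′ (t ∸ 1) (B ∷ []) ([] ∷ []) uT′ (All.tabulate λ { D∈ (here e) → remove-∌ B T (subst (_∈L T′) e D∈) })
          (λ X uX eq → deg≤ X uX (trans eq (trans (+-comm (t ∸ 1) 1) suc-t∸1)))) ⟩
      deg 𝓕 T′ + (length T′ C (t ∸ 1)) * M ≡⟨ cong (λ z → deg 𝓕 T′ + z * M) tC ⟩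
      deg 𝓕 T′ + t * M ∎
      where
      open ≤-Reasoning
      T′ = remove B T
      uT′ = remove-unique B uT
      lenT′ : length T′ ≡ t
      lenT′ = suc-injective (trans (length-remove uT B∈) lenT)
      suc-t∸1 : suc (t ∸ 1) ≡ t
      suc-t∸1 = m+[n∸m]≡n 1≤t
      tC : length T′ C (t ∸ 1) ≡ t
      tC = trans (cong (_C (t ∸ 1)) (trans lenT′ (sym suc-t∸1))) (trans (sucC (t ∸ 1)) suc-t∸1)
      split : ∀ {F} → F ∈L 𝓕 → T′ ⊑ F ⊎ (B ∷ [] ⊑ F × t ∸ 1 ≤ meet T′ F)
      split {F} F∈ with split-head {B = B} {T′} {F} (≤-trans (≤-reflexive suc-t∸1) (≤-trans (All.lookup meets F∈) (≤-reflexive (meet-↭ F (remove-↭ uT B∈)))))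
      ... | inj₁ le = inj₁ (meet-full T′ F uT′ (≤-trans (≤-reflexive (trans lenT′ (sym suc-t∸1))) le))
      ... | inj₂ (B∈F , le) = inj₂ (B∈F ∷ [] , le)

    -- Take B in T with |B| ≥ 2. A set of t blocks through B uses at least t + 1 points, so R₊
    -- replaces A₊ for t of the t + 1 subsets of size t.
    nonsingleton-bound : Any (λ B → 2 ≤ ∣ B ∣) T → length 𝓕 ≤ A₊ k + t * R₊ k
    nonsingleton-bound a with find a
    ... | B , B∈ , 2≤B = ≤-trans (split-bound B∈ deg≤)
        (+-monoˡ-≤ (t * R₊ k) (deg≤A fam 2+t≤k (remove B T) (remove-unique B uT) (suc-injective (trans (length-remove uT B∈) lenT))))
      where
      deg≤ : ∀ X → Unique X → length X ≡ t → B ∷ [] ⊑ X → deg 𝓕 X ≤ R₊ k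
      deg≤ X uX lenX B⊑ = ≤-trans (deg-≤ fam (B ∷ []) X ([] ∷ []) uX B⊑ (≤-trans (s≤s (≤-reflexive lenX)) (<⇒≤ 2+t≤k)))
        (subst (λ z → S (N ∸ weight (B ∷ []) ∸ (length X ∸ 1)) (k ∸ length X) ≤ S (N ∸ suc t) z) (cong (k ∸_) lenX)
          (subst (λ z → S (N ∸ weight (B ∷ []) ∸ (length X ∸ 1)) z ≤ S (N ∸ suc t) z) (∸-suc (≤-trans (s≤s (≤-reflexive lenX)) (<⇒≤ 2+t≤k)))
            (S-mono _ (≤-trans (≤-reflexive (∸-+-assoc N (weight (B ∷ [])) _)) (∸-monoʳ-≤ N le)))))
        where
        le : suc t ≤ weight (B ∷ []) + (length X ∸ 1)
        le = ≤-trans (≤-reflexive (trans (cong suc (sym (m+[n∸m]≡n 1≤t))) (cong (λ z → 2 + (z ∸ 1)) (sym lenX)))) (+-monoˡ-≤ _ (≤-trans 2≤B (m≤m+n ∣ B ∣ 0)))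

    T-bound : All Nonempty T → (All Singleton T × length 𝓕 ≤ W₊ k) ⊎ length 𝓕 < W₊ k
    T-bound ne with singletons-or-2≤ ne
    ... | inj₁ ss = inj₁ (ss , singletons-bound ss)
    ... | inj₂ a = inj₂ (≤-<-trans (≤-trans (nonsingleton-bound a) (≤-reflexive (sym (+-identityʳ _)))) (A+tR<W 2+t≤k k≤K (0<tR 2+t≤k k≤K)))

  Star : ℕ → List (List (Subset N)) → Set
  Star k 𝓕 = ∃ λ T → Unique T × length T ≡ suc t × All Singleton T × All (λ F → t ≤ meet T F) 𝓕 × length 𝓕 ≤ W₊ k

  -- The threshold is the one for `nonsingleton<`: there t(t+1)/2 sets of blocks have degree at most
  -- R₊/2^(|y|-2), and the total stays below tR₊ as soon as t + 1 < 2^(|y|-1).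
  big-block : ∀ {P : List (Subset N)} → IsKPartition N (2 + t) P → 2 + t ≤ K → Any (λ y → 2 * suc t < 2 ^ ∣ y ∣) P
  big-block {P} part 2+t≤K with anyL? (λ y → 2 * suc t <? 2 ^ ∣ y ∣) P
  ... | yes a = a
  ... | no ¬a = contradiction
      (subst₂ (λ a b → 2 ^ a ≤ (2 * suc t) ^ b) (trans (PartOf-weight (partition-PartOf part)) (∣⊤∣≡n N)) (proj₂ part) (pow P (¬Any⇒All¬ P ¬a)))
      (not-all-small (suc t) 2+t≤K)
    where
    pow : ∀ P → All (λ (y : Subset N) → ¬ (2 * suc t < 2 ^ ∣ y ∣)) P → 2 ^ weight P ≤ (2 * suc t) ^ length P
    pow [] _ = ≤-refl
    pow (y ∷ P) (h ∷ hs) = ≤-trans (≤-reflexive (^-distribˡ-+-* 2 ∣ y ∣ (weight P))) (*-mono-≤ (≮⇒≥ h) (pow P hs))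

  -- Few partitions contain a huge block y of P, so P - y plays the role of T.
  full-cover : ∀ {P 𝓕} → IsKPartition N (2 + t) P → IsKFamily N k 𝓕 → 2 + t ≤ k → k ≤ K →
    All (λ F → t ≤ meet P F) 𝓕 → Star k 𝓕 ⊎ length 𝓕 < W₊ k
  full-cover {k} {P} {𝓕} partP fam 2+t≤k k≤K meets with find (big-block partP (≤-trans 2+t≤k k≤K))
  ... | y , y∈ , y-big = cases (singletons-or-2≤ (nonempty-⊑ partP (remove-⊑ y P)))
    where
    uP = partition-unique partP
    T = remove y P
    uT = remove-unique y uP
    lenT : length T ≡ suc t
    lenT = suc-injective (trans (length-remove uP y∈) (proj₂ partP))
    suc-t∸1 : suc (t ∸ 1) ≡ t
    suc-t∸1 = m+[n∸m]≡n 1≤t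
    weightP : ∣ y ∣ + weight T ≡ N
    weightP = trans (sym (weight-↭ (remove-↭ uP y∈))) (trans (PartOf-weight (partition-PartOf partP)) (∣⊤∣≡n N))
    split : ∀ {F} → F ∈L 𝓕 → t ≤ meet T F ⊎ (y ∈L F × t ∸ 1 ≤ meet T F)
    split {F} F∈ with split-head {B = y} {T} {F} (≤-trans (≤-reflexive suc-t∸1) (≤-trans (All.lookup meets F∈) (≤-reflexive (meet-↭ F (remove-↭ uP y∈)))))
    ... | inj₁ le = inj₁ (≤-trans (≤-reflexive (sym suc-t∸1)) le)
    ... | inj₂ r = inj₂ r

    -- If F contains y and t - 1 of the singletons then two points remain, so F = P.
    singletons-meet : All Singleton T → ∀ {F} → F ∈L 𝓕 → t ≤ meet T F
    singletons-meet ss {F} F∈ with t ≤? meet T F | split F∈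
    ... | yes p | _ = p
    ... | no ¬p | inj₁ p = ⊥-elim (¬p p)
    ... | no ¬p | inj₂ (y∈F , le) = ⊥-elim (impossible (m≤n⇒m<n∨m≡n 2+t≤k))
      where
      partF = All.lookup (proj₁ fam) F∈
      X₀ = y ∷ common T F
      lenC : length (common T F) ≡ t ∸ 1
      lenC = ≤-antisym (s≤s⁻¹ (≤-trans (≰⇒> ¬p) (≤-reflexive (sym suc-t∸1)))) le
      lenX : length X₀ ≡ t
      lenX = trans (cong suc lenC) suc-t∸1
      X₀⊑F : X₀ ⊑ F
      X₀⊑F = y∈F ∷ common-⊑ʳ T F
      X₀⊑P : X₀ ⊑ P
      X₀⊑P = y∈ ∷ ⊑-trans (common-⊑ˡ T F) (remove-⊑ y P)
      uX : Unique X₀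
      uX = ¬Any⇒All¬ _ (λ y∈C → remove-∌ y P (All.lookup (common-⊑ˡ T F) y∈C)) ∷ common-unique T F uT
      rest : N ∸ weight X₀ ≡ 2
      rest = trans (cong₂ (λ a b → a ∸ (∣ y ∣ + b)) (trans (sym weightP) (cong (∣ y ∣ +_) (trans (singletons-weight ss) (trans lenT (cong suc (sym suc-t∸1))))))
               (trans (singletons-weight (All.tabulate λ D∈ → All.lookup ss (All.lookup (common-⊑ˡ T F) D∈))) lenC))
             (trans (cong (_∸ (∣ y ∣ + (t ∸ 1))) (lem ∣ y ∣ (t ∸ 1))) (m+n∸n≡m 2 (∣ y ∣ + (t ∸ 1))))
        where
        lem : ∀ a b → a + suc (suc b) ≡ 2 + (a + b)
        lem = solve-∀
      deg≤S2 : ∀ {𝓖} → IsKFamily N k 𝓖 → deg 𝓖 X₀ ≤ S 2 (k ∸ t)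
      deg≤S2 {𝓖} famG = ≤-trans (deg-≤-─* famG X₀ uX) (≤-reflexive (cong₂ S (trans (─*-weight partF uX X₀⊑F) rest) (cong (k ∸_) lenX)))
      impossible : 2 + t < k ⊎ 2 + t ≡ k → ⊥₀
      impossible (inj₁ lt) = contradiction (≤-trans (≤-reflexive (cong length (sym (filter-all (X₀ ⊑?_) (X₀⊑F ∷ []))))) (≤-trans (deg≤S2 {F ∷ []} (partF ∷ [] , [] ∷ [])) (≤-reflexive zeroS))) λ ()
        where
        zeroS : S 2 (k ∸ t) ≡ 0
        zeroS = S-zero (≤-trans (≤-reflexive (sym (m+n∸n≡m 3 t))) (∸-monoˡ-≤ t lt))
      impossible (inj₂ refl) = contradiction (≤-trans (≤-reflexive (cong length (sym (filter-all (X₀ ⊑?_) {xs = F ∷ P ∷ []} (X₀⊑F ∷ X₀⊑P ∷ [])))))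
          (≤-trans (deg≤S2 {F ∷ P ∷ []} (partF ∷ partP ∷ [] , ((λ same → ¬p (≤-trans (≤-trans (n≤1+n t) (≤-reflexive (sym lenT)))
            (≤-meet T F uT ⊑-refl (All.tabulate λ D∈ → proj₂ same _ (All.lookup (remove-⊑ y P) D∈))))) ∷ []) ∷ [] ∷ []))
            (≤-reflexive (cong (S 2) (m+n∸n≡m 2 t))))) λ { (s≤s ()) }

    -- The members with y and t - 1 blocks of T are few: y and these blocks use at least |y| - 2
    -- points more than the t + 1 points missing in R₊, and each such point is worth a factor k - t
    -- ≥ 2.
    nonsingleton< : Any (λ B → 2 ≤ ∣ B ∣) T → length 𝓕 < W₊ k
    nonsingleton< a = ≤-<-trans (begin
      length 𝓕 ≤⟨ length-filter-∪ (λ F → t ≤? meet T F) (λ F → (y ∷ [] ⊑? F) ×-dec (t ∸ 1 ≤? meet T F)) 𝓕 (λ F∈ → [ inj₁ , (λ (y∈F , le) → inj₂ (y∈F ∷ [] , le)) ]′ (split F∈)) ⟩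
      length (filter (λ F → t ≤? meet T F) 𝓕) + countMeet 𝓕 T (t ∸ 1) (y ∷ [])
        ≤⟨ +-mono-≤ (nonsingleton-bound (IsKFamily-filter (λ F → t ≤? meet T F) fam) 2+t≤k k≤K uT lenT (Allₚ.all-filter (λ F → t ≤? meet T F) 𝓕) a)
                    (countMeet-≤ 𝓕 T (t ∸ 1) (y ∷ []) ([] ∷ []) uT (All.tabulate λ { D∈ (here e) → remove-∌ y P (subst (_∈L T) e D∈) }) deg≤) ⟩
      A₊ k + t * R₊ k + (length T C (t ∸ 1)) * r ∎) (A+tR<W 2+t≤k k≤K small)
      where
      open ≤-Reasoning
      r = S (N ∸ ∣ y ∣ ∸ (t ∸ 1)) (k ∸ t)
      deg≤ : ∀ X → Unique X → length X ≡ t ∸ 1 + 1 → y ∷ [] ⊑ X → deg 𝓕 X ≤ r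
      deg≤ X uX eq y⊑ = ≤-trans (deg-≤ fam (y ∷ []) X ([] ∷ []) uX y⊑ (≤-trans (s≤s (≤-reflexive lenX)) (<⇒≤ 2+t≤k)))
        (≤-reflexive (cong₂ S (cong₂ (λ a b → N ∸ a ∸ b) (+-identityʳ ∣ y ∣) (cong (_∸ 1) lenX)) (cong (k ∸_) lenX)))
        where
        lenX : length X ≡ t
        lenX = trans eq (trans (+-comm (t ∸ 1) 1) suc-t∸1)
      e = ∣ y ∣ ∸ 2
      2≤y : 2 ≤ ∣ y ∣
      2≤y = ≰⇒> λ y≤1 → contradiction y-big (≤⇒≯ (≤-trans (^-monoʳ-≤ 2 y≤1) (m≤m*n 2 (suc t))))
      2+e : 2 + e ≡ ∣ y ∣
      2+e = m+[n∸m]≡n 2≤y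
      t<2^ : suc t < 2 * 2 ^ e
      t<2^ = *-cancelˡ-< 2 _ _ (<-≤-trans y-big (≤-reflexive (cong (2 ^_) (sym 2+e))))
      2^r≤R : 2 ^ e * r ≤ R₊ k
      2^r≤R = subst (λ z → 2 ^ e * S (N ∸ ∣ y ∣ ∸ (t ∸ 1)) z ≤ S (N ∸ suc t) z) (∸-suc (<⇒≤ 2+t≤k))
        (≤-trans (*-monoˡ-≤ _ (^-monoˡ-≤ e (≤-trans (≤-reflexive (sym (m+n∸n≡m 2 t))) (≤-trans (∸-monoˡ-≤ t 2+t≤k) (≤-reflexive (sym (∸-suc (<⇒≤ 2+t≤k))))))))
          (≤-trans (S-pow (k ∸ suc t) e (N ∸ ∣ y ∣ ∸ (t ∸ 1))) (≤-reflexive (cong (λ z → S z (suc (k ∸ suc t))) sizes))))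
        where
        le : ∣ y ∣ + (t ∸ 1) ≤ N
        le = ≤-trans (+-monoʳ-≤ ∣ y ∣ (≤-trans (≤-trans (m∸n≤m t 1) (≤-trans (n≤1+n t) (≤-reflexive (sym lenT)))) (length≤weight (nonempty-⊑ partP (remove-⊑ y P))))) (≤-reflexive weightP)
        sizes : e + (N ∸ ∣ y ∣ ∸ (t ∸ 1)) ≡ N ∸ suc t
        sizes = trans (cong (e +_) (∸-+-assoc N ∣ y ∣ (t ∸ 1))) (trans (sym (m+n∸m≡n (suc t) _)) (cong (_∸ suc t)
          (trans (trans (cong (λ z → suc z + (e + (N ∸ (∣ y ∣ + (t ∸ 1))))) (sym suc-t∸1)) (trans (lem (t ∸ 1) e (N ∸ (∣ y ∣ + (t ∸ 1)))) (cong (λ z → z + (t ∸ 1) + (N ∸ (∣ y ∣ + (t ∸ 1)))) 2+e))) (m+[n∸m]≡n le))))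
          where
          lem : ∀ u e x → suc (suc u) + (e + x) ≡ 2 + e + u + x
          lem = solve-∀
      2C : 2 * (length T C (t ∸ 1)) ≡ t * suc t
      2C = trans (cong (λ z → 2 * (z C (t ∸ 1))) (trans lenT (cong suc (sym suc-t∸1)))) (trans (2+C (t ∸ 1)) (cong (λ z → z * suc z) suc-t∸1))
      small : (length T C (t ∸ 1)) * r < t * R₊ k
      small with r in eq
      ... | zero = ≤-<-trans (≤-reflexive (*-zeroʳ (length T C (t ∸ 1)))) (0<tR 2+t≤k k≤K)
      ... | suc r′ = *-cancelˡ-< 2 _ _ (begin-strict
        2 * ((length T C (t ∸ 1)) * suc r′) ≡⟨ sym (*-assoc 2 (length T C (t ∸ 1)) (suc r′)) ⟩
        2 * (length T C (t ∸ 1)) * suc r′ ≡⟨ cong (_* suc r′) 2C ⟩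
        t * suc t * suc r′ <⟨ *-monoˡ-< (suc r′) (*-monoʳ-< t {{>-nonZero 1≤t}} t<2^) ⟩
        t * (2 * 2 ^ e) * suc r′ ≡⟨ lem t (2 ^ e) (suc r′) ⟩
        2 * (t * (2 ^ e * suc r′)) ≤⟨ *-monoʳ-≤ 2 (*-monoʳ-≤ t (≤-trans (≤-reflexive (cong (2 ^ e *_) (sym eq))) 2^r≤R)) ⟩
        2 * (t * R₊ k) ∎)
        where
        lem : ∀ t x r → t * (2 * x) * r ≡ 2 * (t * (x * r))
        lem = solve-∀

    cases : All Singleton T ⊎ Any (λ B → 2 ≤ ∣ B ∣) T → Star k 𝓕 ⊎ length 𝓕 < W₊ k
    cases (inj₂ a) = inj₂ (nonsingleton< a)
    cases (inj₁ ss) = inj₁ (T , uT , lenT , ss , ms , singletons-bound fam 2+t≤k k≤K uT lenT ms ss)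
      where
      ms = All.tabulate (singletons-meet ss)

-- Triples of families

*-<-≤ : ∀ {a b x y} → a < b → x ≤ y → 0 < y → a * x < b * y
*-<-≤ {a} {b} {x} {y} a<b x≤y 0<y = ≤-<-trans (*-monoʳ-≤ a x≤y) (*-monoˡ-< y {{>-nonZero 0<y}} a<b)

module Triples (K c : ℕ) (3≤K : 3 ≤ K) (big : K ^ (2 * K) ≤ 2 ^ (2 * K + c)) (t : ℕ) (1≤t : 1 ≤ t) where
  open Bounds K c 3≤K big
  open Intersecting K c 3≤K big t 1≤t

  Family : Set
  Family = List (List (Subset N))

  private variable
    𝓓 : Family
    ka kb kd : ℕ

  Cross₃ : Family → Family → Family → Set
  Cross₃ 𝓐 𝓑 𝓓 = ∀ {A B D} → A ∈L 𝓐 → B ∈L 𝓑 → D ∈L 𝓓 → ∃ λ Q → Unique Q × t ≤ length Q × Q ⊑ A × Q ⊑ B × Q ⊑ D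

  Admissible : ℕ → Set
  Admissible k = 2 + t ≤ k × k ≤ K

  BB-pos : Admissible kb → Admissible kd → 0 < B₊ kb * B₊ kd
  BB-pos (p , q) (p′ , q′) = *-mono-≤ (B-pos p q) (B-pos p′ q′)

  K²B≤A : Admissible ka → K * K * B₊ ka ≤ A₊ ka
  K²B≤A (p , q) = g-step q 1≤t p

  covered-length : ∀ {k 𝓕} {Z : List (Subset N)} → IsKFamily N k 𝓕 → 2 + t ≤ k → Unique Z → length Z ≤ K → t ≤ length Z →
    All (λ F → t ≤ meet Z F) 𝓕 → length 𝓕 ≤ K ^ (length Z ∸ t) * A₊ k
  covered-length {k} {𝓕} {Z} fam p uZ Z≤K t≤Z h = ≤-trans (length≤countMeet 𝓕 Z t h) (≤-trans
    (countMeet-≤ 𝓕 Z t [] [] uZ (All.tabulate λ _ ()) (λ X uX eq _ → deg≤A fam p X uX (trans eq (+-identityʳ t))))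
    (*-monoˡ-≤ (A₊ k) (C≤K^ Z≤K (≤-reflexive (sym (m∸n+n≡m t≤Z))) t≤Z)))

  -- d = |B₀ ∩ D₀| - t; the pair (𝓑, 𝓓) is even (x + t + 1)-cross intersecting.
  far-pair : ∀ {a b e d} x → Admissible ka → Admissible kb → Admissible kd → 1 ≤ x → d ≤ x + 2 →
    x + suc t < kb → x + suc t < kd → a ≤ K ^ d * A₊ ka → b * e ≤ g kb (x + suc t) * g kd (x + suc t) →
    a * (b * e) < W₊ ka * (B₊ kb * B₊ kd)
  far-pair {ka} {kb} {kd} {a} {b} {e} {d} x@(suc x′) (pa , qa) (pb , qb) (pd , qd) 1≤x d≤ lb ld a≤ be≤ = begin-strict
    a * (b * e) ≤⟨ *-mono-≤ (≤-trans a≤ (*-monoˡ-≤ (A₊ ka) (^-monoʳ-≤ K d≤))) be≤ ⟩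
    K ^ (x + 2) * A₊ ka * (gb * gd) ≤⟨ *-monoˡ-≤ (gb * gd) (*-monoˡ-≤ (A₊ ka) Kpow) ⟩
    (K * K) ^ x * (K * K) ^ x * A₊ ka * (gb * gd) ≡⟨ lem ((K * K) ^ x) (A₊ ka) gb gd ⟩
    A₊ ka * ((K * K) ^ x * gb * ((K * K) ^ x * gd)) ≤⟨ *-monoʳ-≤ (A₊ ka) (*-mono-≤ (g-iter x qb (s≤s z≤n) lb) (g-iter x qd (s≤s z≤n) ld)) ⟩
    A₊ ka * (B₊ kb * B₊ kd) <⟨ *-<-≤ (A<W pa qa) ≤-refl (BB-pos (pb , qb) (pd , qd)) ⟩
    W₊ ka * (B₊ kb * B₊ kd) ∎
    where
    open ≤-Reasoning
    gb = g kb (x + suc t)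
    gd = g kd (x + suc t)
    lem : ∀ z a b d → z * z * a * (b * d) ≡ a * (z * b * (z * d))
    lem = solve-∀
    lem₂ : ∀ x → suc x + 2 + 3 * x + 1 ≡ 2 * (suc x + suc x)
    lem₂ = solve-∀
    Kpow : K ^ (x + 2) ≤ (K * K) ^ x * (K * K) ^ x
    Kpow = ≤-trans (^-monoʳ-≤ K (≤-trans (≤-trans (m≤m+n (x + 2) (3 * x′ + 1)) (≤-reflexive (trans (sym (+-assoc (x + 2) (3 * x′) 1)) (lem₂ x′)))) ≤-refl))
      (≤-reflexive (trans (sym (^-*-assoc K 2 (x + x))) (trans (^-distribˡ-+-* (K ^ 2) x x) (cong (λ z → z ^ x * z ^ x) (cong (K *_) (*-identityʳ K))))))

  -- T₀ is a smallest intersection of a member of 𝓑 with one of 𝓓, so 𝓑 and 𝓓 are even cross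
  -- |T₀|-intersecting. A larger T₀ costs 𝓐 a factor K per block but gains K² per block in both 𝓑
  -- and 𝓓. So only |T₀| = t + 1 is critical, unless kb or kd is t + 2 and leaves no such gain.
  good-pair : IsKFamily N ka 𝓐 → IsKFamily N kb 𝓑 → IsKFamily N kd 𝓓 → Admissible ka → Admissible kb → Admissible kd →
    Cross₃ 𝓐 𝓑 𝓓 → Cross (suc t) 𝓑 𝓓 → ∀ {B D} → B ∈L 𝓑 → D ∈L 𝓓 →
    (Star ka 𝓐 × length 𝓑 * length 𝓓 ≤ B₊ kb * B₊ kd) ⊎ length 𝓐 * (length 𝓑 * length 𝓓) < W₊ ka * (B₊ kb * B₊ kd)
  good-pair {ka} {𝓐} {kb} {𝓑} {kd} {𝓓} famA famB famD adA@(pa , qa) adB@(pb , qb) adD@(pd , qd) cr₃ good {B} {D} B∈ D∈ = by-size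
    where
    pairs = cartesianProduct 𝓑 𝓓
    size′ : List (Subset N) × List (Subset N) → ℕ
    size′ (B , D) = meet B D
    minimal : ∃ λ BD → BD ∈L pairs × (∀ {BD′} → BD′ ∈L pairs → size′ BD ≤ size′ BD′)
    minimal with pairs | ∈-cartesianProduct⁺ B∈ D∈
    ... | BD ∷ BDs | _ = let (z , z∈ , h) = argmin size′ BD BDs in z , z∈ , All.lookup h
    B₀ = proj₁ (proj₁ minimal)
    D₀ = proj₂ (proj₁ minimal)
    B₀∈ : B₀ ∈L 𝓑
    B₀∈ = proj₁ (∈-cartesianProduct⁻ 𝓑 𝓓 (proj₁ (proj₂ minimal)))
    D₀∈ : D₀ ∈L 𝓓
    D₀∈ = proj₂ (∈-cartesianProduct⁻ 𝓑 𝓓 (proj₁ (proj₂ minimal)))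
    partB = All.lookup (proj₁ famB) B₀∈
    partD = All.lookup (proj₁ famD) D₀∈
    T₀ = common B₀ D₀
    uT : Unique T₀
    uT = common-unique B₀ D₀ (partition-unique partB)
    cross-T : Cross (length T₀) 𝓑 𝓓
    cross-T B∈ D∈ = proj₂ (proj₂ minimal) (∈-cartesianProduct⁺ B∈ D∈)
    T≤kb : length T₀ ≤ kb
    T≤kb = ≤-trans (length-filter (_∈? D₀) B₀) (≤-reflexive (proj₂ partB))
    T≤kd : length T₀ ≤ kd
    T≤kd = ≤-trans (≤-trans (meet-sym B₀ D₀ (partition-unique partB)) (length-filter (_∈? B₀) D₀)) (≤-reflexive (proj₂ partD))
    meetsT : All (λ A → t ≤ meet T₀ A) 𝓐
    meetsT = All.tabulate λ {A} A∈ → let (Q , uQ , t≤Q , Q⊑A , Q⊑B , Q⊑D) = cr₃ A∈ B₀∈ D₀∈ in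
      ≤-trans t≤Q (≤-meet T₀ A uQ (⊑-common B₀ D₀ Q⊑B Q⊑D) Q⊑A)
    a≤ : length 𝓐 ≤ K ^ (length T₀ ∸ t) * A₊ ka
    a≤ = covered-length famA pa uT (≤-trans T≤kb qb) (<⇒≤ (good B₀∈ D₀∈)) meetsT
    pair≤ : length 𝓑 * length 𝓓 ≤ B₊ kb * B₊ kd
    pair≤ = pair-bound famB famD good qb qd (s≤s z≤n) pb pd
    far : ∀ x → 1 ≤ x → length T₀ ∸ t ≤ x + 2 → x + suc t ≤ length T₀ → x + suc t < kb → x + suc t < kd →
      length 𝓐 * (length 𝓑 * length 𝓓) < W₊ ka * (B₊ kb * B₊ kd)
    far x 1≤x d≤ x≤ lb ld = far-pair {a = length 𝓐} {length 𝓑} {length 𝓓} x adA adB adD 1≤x d≤ lb ld a≤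
      (pair-bound famB famD (λ B∈ D∈ → ≤-trans x≤ (cross-T B∈ D∈)) qb qd (≤-trans 1≤x (m≤m+n x (suc t))) lb ld)
    finish : length 𝓑 * length 𝓓 ≤ B₊ kb * B₊ kd → Star ka 𝓐 ⊎ length 𝓐 < W₊ ka →
      (Star ka 𝓐 × length 𝓑 * length 𝓓 ≤ B₊ kb * B₊ kd) ⊎ length 𝓐 * (length 𝓑 * length 𝓓) < W₊ ka * (B₊ kb * B₊ kd)
    finish le (inj₁ s) = inj₁ (s , le)
    finish le (inj₂ lt) = inj₂ (*-<-≤ lt le (BB-pos adB adD))

    -- All members of 𝓑 and 𝓓 are one and the same (t+2)-partition.
    degenerate : length T₀ ≡ 2 + t → kb ≡ 2 + t ⊎ kd ≡ 2 + t →
      (Star ka 𝓐 × length 𝓑 * length 𝓓 ≤ B₊ kb * B₊ kd) ⊎ length 𝓐 * (length 𝓑 * length 𝓓) < W₊ ka * (B₊ kb * B₊ kd)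
    degenerate lenT e = finish (≤-trans ones (BB-pos adB adD))
        (full-cover partB′ famA pa qa (All.map (λ {A} le → ≤-trans le (≤-meet B₀ A (common-unique T₀ A uT) (⊑-trans (common-⊑ˡ T₀ A) (common-⊑ˡ B₀ D₀)) (common-⊑ʳ T₀ A))) meetsT))
      where
      same : ∀ {B D} → B ∈L 𝓑 → D ∈L 𝓓 → SameBlocks B D × kb ≡ kd
      same {B} {D} B∈ D∈ = case e of λ where
          (inj₁ refl) → ⊑-Same pB pD (meet-full B D (partition-unique pB) (≤-trans (≤-reflexive (trans (proj₂ pB) (sym lenT))) (cross-T B∈ D∈)))
          (inj₂ refl) → let ((f , h) , e′) = ⊑-Same pD pB (meet-full D B (partition-unique pD) (≤-trans (≤-trans (≤-reflexive (trans (proj₂ pD) (sym lenT))) (cross-T B∈ D∈)) (meet-sym B D (partition-unique pB)))) in (h , f) , sym e′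
        where
        pB = All.lookup (proj₁ famB) B∈
        pD = All.lookup (proj₁ famD) D∈
      kb≡ : kb ≡ 2 + t
      kb≡ = [ id , (λ e′ → trans (proj₂ (same B₀∈ D₀∈)) e′) ]′ e
      partB′ : IsKPartition N (2 + t) B₀
      partB′ = subst (λ k → IsKPartition N k B₀) kb≡ partB
      ones : length 𝓑 * length 𝓓 ≤ 1
      ones = *-mono-≤ (all-same-length famB (All.tabulate λ B∈ → proj₁ (same B∈ D₀∈)))
                      (all-same-length famD (All.tabulate λ D∈ → let (f , h) = proj₁ (same B₀∈ D∈) in h , f))

    by-size : (Star ka 𝓐 × length 𝓑 * length 𝓓 ≤ B₊ kb * B₊ kd) ⊎ length 𝓐 * (length 𝓑 * length 𝓓) < W₊ ka * (B₊ kb * B₊ kd)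
    by-size with m≤n⇒m<n∨m≡n (good B₀∈ D₀∈)
    ... | inj₂ e with T-bound famA pa qa uT (sym e) meetsT (nonempty-⊑ partB (common-⊑ˡ B₀ D₀))
    ...   | inj₁ (ss , le) = inj₁ ((T₀ , uT , sym e , ss , meetsT , le) , pair≤)
    ...   | inj₂ lt = inj₂ (*-<-≤ lt pair≤ (BB-pos adB adD))
    by-size | inj₁ 2+t≤T with m≤n⇒m<n∨m≡n 2+t≤T
    -- `x` stays one below the surplus of |T₀| over t + 1, because `pair-bound` wants s below kb and
    -- kd, and T₀ may have as many blocks as these.
    ... | inj₁ 3+t≤T = inj₂ (far x (m<n⇒0<n∸m 3+t≤T) (≤-reflexive dx) (≤-trans (n≤1+n _) (≤-reflexive xt)) (≤-trans (≤-reflexive xt) T≤kb) (≤-trans (≤-reflexive xt) T≤kd))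
      where
      x = length T₀ ∸ (2 + t)
      xt : suc (x + suc t) ≡ length T₀
      xt = trans (sym (+-suc x (suc t))) (m∸n+n≡m 2+t≤T)
      dx : length T₀ ∸ t ≡ x + 2
      dx = trans (cong (_∸ t) (trans (sym (m∸n+n≡m 2+t≤T)) (sym (+-assoc x 2 t)))) (m+n∸n≡m (x + 2) t)
    ... | inj₂ e with m≤n⇒m<n∨m≡n pb | m≤n⇒m<n∨m≡n pd
    ...   | inj₂ e′ | _ = degenerate (sym e) (inj₁ (sym e′))
    ...   | _ | inj₂ e′ = degenerate (sym e) (inj₂ (sym e′))
    -- Here the full surplus 1 is used, since one less would gain nothing; kb and kd exceed t + 2,
    -- which permits it.
    ...   | inj₁ lb | inj₁ ld = inj₂ (far 1 ≤-refl (≤-trans (≤-reflexive (trans (cong (_∸ t) (sym e)) (m+n∸n≡m 2 t))) (n≤1+n 2)) (≤-reflexive e) lb ld)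

  -- Triples of families in which all pairs are bad

  -- The common blocks of B and D are given by a universal property, because `common B D` and
  -- `common D B` may differ as lists and the notion has to be symmetric. All other families contain
  -- `core`, so the non-triviality of the whole system reduces to the field `nontrivial`.
  record Bad (𝓑 𝓓 : Family) : Set where
    field
      {B D} : List (Subset N)
      B∈ : B ∈L 𝓑
      D∈ : D ∈L 𝓓
      core : List (Subset N)
      core-unique : Unique core
      core-small : length core ≤ t
      core⊑B : core ⊑ B
      core⊑D : core ⊑ D
      core-greatest : ∀ {Q} → Q ⊑ B → Q ⊑ D → Q ⊑ core
      nontrivial : ¬ (All (core ⊑_) 𝓑 × All (core ⊑_) 𝓓)

  Bad-sym : Bad 𝓑 𝓓 → Bad 𝓓 𝓑
  Bad-sym b = record
    { B∈ = D∈ ; D∈ = B∈ ; core = core ; core-unique = core-unique ; core-small = core-small ; core⊑B = core⊑D ; core⊑D = core⊑B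
    ; core-greatest = λ p q → core-greatest q p ; nontrivial = λ (p , q) → nontrivial (q , p) }
    where open Bad b

  record BadTriple (𝓐 𝓑 𝓓 : Family) (ka kb kd : ℕ) : Set where
    field
      famA : IsKFamily N ka 𝓐
      famB : IsKFamily N kb 𝓑
      famD : IsKFamily N kd 𝓓
      adA : Admissible ka
      adB : Admissible kb
      adD : Admissible kd
      cross : Cross₃ 𝓐 𝓑 𝓓
      badBD : Bad 𝓑 𝓓
      badAD : Bad 𝓐 𝓓
      badAB : Bad 𝓐 𝓑

  rotate : BadTriple 𝓐 𝓑 𝓓 ka kb kd → BadTriple 𝓑 𝓓 𝓐 kb kd ka
  rotate τ = record
    { famA = famB ; famB = famD ; famD = famA ; adA = adB ; adB = adD ; adD = adA
    ; cross = λ B∈ D∈ A∈ → let (Q , u , l , a , b , d) = cross A∈ B∈ D∈ in Q , u , l , b , d , a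
    ; badBD = Bad-sym badAD ; badAD = Bad-sym badAB ; badAB = badBD }
    where open BadTriple τ

  flip₂₃ : BadTriple 𝓐 𝓑 𝓓 ka kb kd → BadTriple 𝓐 𝓓 𝓑 ka kd kb
  flip₂₃ τ = record
    { famA = famA ; famB = famD ; famD = famB ; adA = adA ; adB = adD ; adD = adB
    ; cross = λ A∈ D∈ B∈ → let (Q , u , l , a , b , d) = cross A∈ B∈ D∈ in Q , u , l , a , d , b
    ; badBD = Bad-sym badBD ; badAD = badAB ; badAB = badAD }
    where open BadTriple τ

  coreA : BadTriple 𝓐 𝓑 𝓓 ka kb kd → List (Subset N)
  coreA τ = Bad.core (BadTriple.badBD τ)

  -- The blocks common to A, B and D are at least t in number and lie in `core`, which has at most t
  -- blocks; so they are the core.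
  coreA⊑ : (τ : BadTriple 𝓐 𝓑 𝓓 ka kb kd) → All (coreA τ ⊑_) 𝓐 × t ≡ length (coreA τ) ⊎ length 𝓐 ≡ 0
  coreA⊑ {𝓐 = []} τ = inj₂ refl
  coreA⊑ {𝓐 = A₀ ∷ 𝓐} τ = inj₁ (All.tabulate ⊒core , ≤-antisym t≤ core-small)
    where
    open BadTriple τ
    open Bad badBD
    t≤ : t ≤ length core
    t≤ = let (Q , u , l , a , b , d) = cross (here refl) B∈ D∈ in ≤-trans l (⊑-length u (core-greatest b d))
    ⊒core : ∀ {A} → A ∈L A₀ ∷ 𝓐 → core ⊑ A
    ⊒core A∈ = let (Q , u , l , a , b , d) = cross A∈ B∈ D∈ in ⊑-trans (⊑-flip u (core-greatest b d) (≤-trans core-small l)) a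

  -- The cores are numbered by the family opposite to the bad pair: `X₁`, `X₂`, `X₃` lie in all
  -- members of 𝓐, 𝓑, 𝓓 respectively. For the last two this is read off the rotated triples.
  module Core {𝓐 𝓑 𝓓 : Family} {ka kb kd : ℕ} (τ : BadTriple 𝓐 𝓑 𝓓 ka kb kd) where
    open BadTriple τ
    X₁ X₂ X₃ : List (Subset N)
    X₁ = Bad.core badBD
    X₂ = Bad.core badAD
    X₃ = Bad.core badAB

    ⊒X₁ : ∀ {A} → A ∈L 𝓐 → X₁ ⊑ A
    ⊒X₁ A∈ with coreA⊑ τ
    ... | inj₁ (h , _) = All.lookup h A∈
    ... | inj₂ e = contradiction (∈-length A∈) (<⇒≱ (s≤s (≤-reflexive e)))

    lenX₁ : t ≡ length X₁
    lenX₁ with coreA⊑ τ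
    ... | inj₁ (_ , e) = e
    ... | inj₂ e = contradiction (∈-length (Bad.B∈ badAB)) (<⇒≱ (s≤s (≤-reflexive e)))

  module _ {𝓐 𝓑 𝓓 : Family} {ka kb kd : ℕ} (τ : BadTriple 𝓐 𝓑 𝓓 ka kb kd) where
    open BadTriple τ
    open Core τ using (X₁; X₂; X₃; ⊒X₁; lenX₁)
    open Core (rotate τ) using () renaming (⊒X₁ to ⊒X₂; lenX₁ to lenX₂)
    open Core (rotate (rotate τ)) using () renaming (⊒X₁ to ⊒X₃; lenX₁ to lenX₃)

    -- Otherwise X₁ lies in both partitions that define X₃ and so equals X₃, which is then contained
    -- in all members of 𝓐 and of 𝓑, against non-triviality.
    X₁⋢X₂ : ¬ X₁ ⊑ X₂
    X₁⋢X₂ h = Bad.nontrivial badAB (All.tabulate (λ A∈ → ⊑-trans X₃⊑X₁ (⊒X₁ A∈)) , All.tabulate (λ B∈ → ⊑-trans X₃⊑X₁ (⊑-trans h (⊒X₂ B∈))))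
      where
      X₁⊑X₃ : X₁ ⊑ X₃
      X₁⊑X₃ = Bad.core-greatest badAB (⊒X₁ (Bad.B∈ badAB)) (⊑-trans h (⊒X₂ (Bad.D∈ badAB)))
      X₃⊑X₁ : X₃ ⊑ X₁
      X₃⊑X₁ = ⊑-flip (Bad.core-unique badBD) X₁⊑X₃ (≤-reflexive (trans (sym lenX₃) lenX₁))

    -- D′ = Bad.D badAD does not contain X₁, so every member of 𝓐 has a further block in D′.
    X₁⋢D′ : ¬ X₁ ⊑ Bad.D badAD
    X₁⋢D′ h = X₁⋢X₂ (Bad.core-greatest badAD (⊒X₁ (Bad.B∈ badAD)) h)

    X₁-small : ∀ {D} → ¬ X₁ ⊑ D → meet X₁ D < t
    X₁-small {D} ¬h = ≰⇒> λ le → ¬h (meet-full X₁ D (Bad.core-unique badBD) (≤-trans (≤-reflexive (sym lenX₁)) le))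

    X₁-extends : Extends K 𝓐 X₁
    X₁-extends = extends-by (≤-trans (≤-reflexive (proj₂ (All.lookup (proj₁ famD) (Bad.D∈ badAD)))) (proj₂ adD)) (X₁-small X₁⋢D′)
      (λ A∈ → let (Q , u , l , a , b , d) = cross A∈ (Bad.B∈ badBD) (Bad.D∈ badAD) in Q , u , l , a , d)

    length≤KB : length 𝓐 ≤ K * B₊ ka
    length≤KB = ≤-trans (length≤deg 𝓐 (All.tabulate ⊒X₁)) (deg-extend 𝓐 X₁-extends
      (λ B B∉ → deg≤B famA (proj₁ adA) (B ∷ X₁) (¬Any⇒All¬ X₁ B∉ ∷ Bad.core-unique badBD) (cong suc (sym lenX₁))))

  module _ {𝓐 𝓑 𝓓 : Family} {ka kb kd : ℕ} (τ : BadTriple 𝓐 𝓑 𝓓 ka kb kd) where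
    open BadTriple τ
    open Core τ using (X₁; X₂; X₃; ⊒X₁; lenX₁)
    open Core (rotate τ) using () renaming (⊒X₁ to ⊒X₂; lenX₁ to lenX₂)
    open Core (rotate (rotate τ)) using () renaming (⊒X₁ to ⊒X₃; lenX₁ to lenX₃)

    private
      uX₁ = Bad.core-unique badBD

    Covers : Subset N → Set
    Covers E = ∀ {B D} → B ∈L 𝓑 → D ∈L 𝓓 → t ≤ meet (E ∷ X₁) (common B D)

    common-∈ : ∀ E B D → t ≤ meet (E ∷ X₁) (common B D) → ¬ X₁ ⊑ B ⊎ ¬ X₁ ⊑ D → E ∈L B × E ∈L D
    common-∈ E B D le ¬h = case E ∈? common B D of λ where
        (yes E∈) → All.lookup (common-⊑ˡ B D) E∈ , All.lookup (common-⊑ʳ B D) E∈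
        (no E∉) → ⊥-elim ([ (λ ¬B → ¬B (⊑-trans (X₁⊑ E∉) (common-⊑ˡ B D))) , (λ ¬D → ¬D (⊑-trans (X₁⊑ E∉) (common-⊑ʳ B D))) ]′ ¬h)
      where
      X₁⊑ : E ∉L common B D → X₁ ⊑ common B D
      X₁⊑ E∉ = meet-full X₁ (common B D) uX₁ (≤-trans (≤-reflexive (sym lenX₁)) (≤-trans le (≤-reflexive (meet-∉ X₁ (common B D) E∉))))

    -- Such an E would lie in all members of 𝓑 and 𝓓. As both families are too large to share t + 1
    -- blocks, E belongs to X₂ and X₃; then it is common to the two partitions that define X₁, hence
    -- in X₁.
    no-cover : B₊ kb < length 𝓑 → B₊ kd < length 𝓓 → ∀ {E} → E ∉L X₁ → ¬ Covers E
    no-cover b> d> {E} E∉X₁ cov = E∉X₁ (All.head (Bad.core-greatest badBD {Q = E ∷ []}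
        (All.lookup (⊒X₂ (Bad.B∈ badBD)) E∈X₂ ∷ []) (All.lookup (⊒X₃ (Bad.D∈ badBD)) E∈X₃ ∷ [])))
      where
      E∈𝓑 : ∀ {B} → B ∈L 𝓑 → E ∈L B
      E∈𝓑 {B} B∈ = proj₁ (common-∈ E B (Bad.D badAD) (cov B∈ (Bad.D∈ badAD)) (inj₂ (X₁⋢D′ τ)))
      E∈𝓓 : ∀ {D} → D ∈L 𝓓 → E ∈L D
      E∈𝓓 {D} D∈ = proj₂ (common-∈ E (Bad.D badAB) D (cov (Bad.D∈ badAB) D∈) (inj₁ (X₁⋢D′ (flip₂₃ τ))))
      E∈X₂ : E ∈L X₂
      E∈X₂ = case E ∈? X₂ of λ where
        (yes p) → p
        (no ¬p) → contradiction b> (≤⇒≯ (length≤B famB (proj₁ adB) (E ∷ X₂) (¬Any⇒All¬ X₂ ¬p ∷ Bad.core-unique badAD) (cong suc (sym lenX₂))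
          (All.tabulate λ B∈ → E∈𝓑 B∈ ∷ ⊒X₂ B∈)))
      E∈X₃ : E ∈L X₃
      E∈X₃ = case E ∈? X₃ of λ where
        (yes p) → p
        (no ¬p) → contradiction d> (≤⇒≯ (length≤B famD (proj₁ adD) (E ∷ X₃) (¬Any⇒All¬ X₃ ¬p ∷ Bad.core-unique badAB) (cong suc (sym lenX₃))
          (All.tabulate λ D∈ → E∈𝓓 D∈ ∷ ⊒X₃ D∈)))

    -- The three bounds `length≤KB` cost K³ together, but A₊ ≥ K²B₊ pays only K². If 𝓑 and 𝓓 are
    -- both large, `no-cover` permits a second branching step in 𝓐, and
    -- `K * K * g ka (2 + t) ≤ B₊ ka` removes the factor K of 𝓐.
    one-small : 3 + t ≤ ka → length 𝓐 ≤ B₊ ka ⊎ (length 𝓑 ≤ B₊ kb ⊎ length 𝓓 ≤ B₊ kd)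
    one-small 3+t≤ka with length 𝓑 ≤? B₊ kb | length 𝓓 ≤? B₊ kd
    ... | yes p | _ = inj₂ (inj₁ p)
    ... | no _ | yes p = inj₂ (inj₂ p)
    ... | no ¬b | no ¬d = inj₁ (begin
      length 𝓐 ≤⟨ length≤deg 𝓐 (All.tabulate ⊒X₁) ⟩
      deg 𝓐 X₁ ≤⟨ deg-extend 𝓐 (X₁-extends τ) (λ E E∉ → deg-extend 𝓐 (extend E∉) (λ E′ E′∉ → deg≤ E′ (¬Any⇒All¬ _ E′∉ ∷ ¬Any⇒All¬ X₁ E∉ ∷ uX₁))) ⟩
      K * (K * g ka (2 + t)) ≡⟨ sym (*-assoc K K _) ⟩
      K * K * g ka (2 + t) ≤⟨ g-step (proj₂ adA) (s≤s z≤n) 3+t≤ka ⟩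
      B₊ ka ∎)
      where
      open ≤-Reasoning
      deg≤ : ∀ {E} E′ → Unique (E′ ∷ E ∷ X₁) → deg 𝓐 (E′ ∷ E ∷ X₁) ≤ g ka (2 + t)
      deg≤ {E} E′ u = subst (λ j → deg 𝓐 (E′ ∷ E ∷ X₁) ≤ g ka (2 + j)) (sym lenX₁) (deg-≤-length famA (E′ ∷ E ∷ X₁) u (≤-trans (s≤s (≤-reflexive (cong (2 +_) (sym lenX₁)))) 3+t≤ka))
      extend : ∀ {E} → E ∉L X₁ → Extends K 𝓐 (E ∷ X₁)
      extend {E} E∉ with allL? (λ B → allL? (λ D → t ≤? meet (E ∷ X₁) (common B D)) 𝓓) 𝓑
      ... | yes cov = ⊥-elim (no-cover (≰⇒> ¬b) (≰⇒> ¬d) E∉ (λ B∈ D∈ → All.lookup (All.lookup cov B∈) D∈))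
      ... | no ¬cov with find (¬All⇒Any¬ (λ B → allL? (λ D → t ≤? meet (E ∷ X₁) (common B D)) 𝓓) 𝓑 ¬cov)
      ...   | B , B∈ , ¬covB with find (¬All⇒Any¬ (λ D → t ≤? meet (E ∷ X₁) (common B D)) 𝓓 ¬covB)
      ...     | D , D∈ , ¬le = extends-by
          (≤-trans (length-filter (_∈? D) B) (≤-trans (≤-reflexive (proj₂ (All.lookup (proj₁ famB) B∈))) (proj₂ adB))) (≰⇒> ¬le)
          (λ A∈ → let (Q , u , l , a , b , d) = cross A∈ B∈ D∈ in Q , u , l , a , ⊑-common B D b d)

  triple-bound : BadTriple 𝓐 𝓑 𝓓 ka kb kd → length 𝓐 * (length 𝓑 * length 𝓓) < W₊ ka * (B₊ kb * B₊ kd)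
  triple-bound {𝓐} {𝓑} {𝓓} {ka} {kb} {kd} τ = ≤-<-trans bound (*-<-≤ (A<W (proj₁ adA) (proj₂ adA)) ≤-refl (BB-pos adB adD))
    where
    open BadTriple τ
    open ≤-Reasoning
    a≤ = length≤KB τ
    b≤ = length≤KB (rotate τ)
    d≤ = length≤KB (rotate (rotate τ))
    two : ∀ {x y z} → x * (y * z) ≤ K * K * (B₊ ka * (B₊ kb * B₊ kd)) → x * (y * z) ≤ A₊ ka * (B₊ kb * B₊ kd)
    two h = ≤-trans h (≤-trans (≤-reflexive (sym (*-assoc (K * K) (B₊ ka) _))) (*-monoˡ-≤ _ (K²B≤A adA)))
    small : length 𝓐 ≤ B₊ ka ⊎ (length 𝓑 ≤ B₊ kb ⊎ length 𝓓 ≤ B₊ kd) → length 𝓐 * (length 𝓑 * length 𝓓) ≤ A₊ ka * (B₊ kb * B₊ kd)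
    small (inj₁ p) = two {length 𝓐} {length 𝓑} {length 𝓓} (≤-trans (*-mono-≤ p (*-mono-≤ b≤ d≤)) (≤-reflexive (lem K (B₊ ka) (B₊ kb) (B₊ kd))))
      where
      lem : ∀ K a b d → a * (K * b * (K * d)) ≡ K * K * (a * (b * d))
      lem = solve-∀
    small (inj₂ (inj₁ p)) = two {length 𝓐} {length 𝓑} {length 𝓓} (≤-trans (*-mono-≤ a≤ (*-mono-≤ p d≤)) (≤-reflexive (lem K (B₊ ka) (B₊ kb) (B₊ kd))))
      where
      lem : ∀ K a b d → K * a * (b * (K * d)) ≡ K * K * (a * (b * d))
      lem = solve-∀
    small (inj₂ (inj₂ p)) = two {length 𝓐} {length 𝓑} {length 𝓓} (≤-trans (*-mono-≤ a≤ (*-mono-≤ b≤ p)) (≤-reflexive (lem K (B₊ ka) (B₊ kb) (B₊ kd))))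
      where
      lem : ∀ K a b d → K * a * (K * b * d) ≡ K * K * (a * (b * d))
      lem = solve-∀
    bound : length 𝓐 * (length 𝓑 * length 𝓓) ≤ A₊ ka * (B₊ kb * B₊ kd)
    bound with m≤n⇒m<n∨m≡n (proj₁ adA) | m≤n⇒m<n∨m≡n (proj₁ adB) | m≤n⇒m<n∨m≡n (proj₁ adD)
    ... | inj₁ lt | _ | _ = small (one-small τ lt)
    ... | inj₂ _ | inj₁ lt | _ = small ([ inj₂ ∘ inj₁ , [ inj₂ ∘ inj₂ , inj₁ ]′ ]′ (one-small (rotate τ) lt))
    ... | inj₂ _ | inj₂ _ | inj₁ lt = small ([ inj₂ ∘ inj₂ , [ inj₁ , inj₂ ∘ inj₁ ]′ ]′ (one-small (rotate (rotate τ)) lt))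
    -- All three parameters are t + 2, so no second branching step is available. But `B₊ ka` is at
    -- most 1 and `A₊ ka` at least K^4, which pays for K³.
    ... | inj₂ ea | inj₂ eb | inj₂ ed = begin
      length 𝓐 * (length 𝓑 * length 𝓓) ≤⟨ *-mono-≤ (≤-trans a≤ (*-monoʳ-≤ K (g-last≤1 (≤-reflexive (sym ea))))) (*-mono-≤ b≤ d≤) ⟩
      K * 1 * (K * B₊ kb * (K * B₊ kd)) ≡⟨ lem K (B₊ kb) (B₊ kd) ⟩
      K * (K * K) * (B₊ kb * B₊ kd) ≤⟨ *-monoˡ-≤ (B₊ kb * B₊ kd) (≤-trans (≤-trans (m≤n*m _ K) (≤-reflexive (lem₂ K))) (g-last 0 (proj₂ adA) 1≤t ea)) ⟩
      A₊ ka * (B₊ kb * B₊ kd) ∎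
      where
      lem : ∀ K b d → K * 1 * (K * b * (K * d)) ≡ K * (K * K) * (b * d)
      lem = solve-∀
      lem₂ : ∀ K → K * (K * (K * K)) ≡ K * (K * (K * (K * 1))) * 1
      lem₂ = solve-∀

-- Products over the index set

module _ {a} {I : Set a} where

  product-mono : ∀ {f g : I → ℕ} xs → All (λ i → f i ≤ g i) xs → product (map f xs) ≤ product (map g xs)
  product-mono [] _ = ≤-refl
  product-mono (x ∷ xs) (h ∷ hs) = *-mono-≤ h (product-mono xs hs)

  product-pos : ∀ {g : I → ℕ} xs → All (λ i → 0 < g i) xs → 0 < product (map g xs)
  product-pos [] _ = s≤s z≤n
  product-pos (x ∷ xs) (h ∷ hs) = *-mono-≤ h (product-pos xs hs)

  product-tight : ∀ {f g : I → ℕ} xs → All (λ i → f i ≤ g i) xs → All (λ i → 0 < g i) xs →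
    product (map g xs) ≤ product (map f xs) → All (λ i → g i ≤ f i) xs
  product-tight [] _ _ _ = []
  product-tight {f} {g} (x ∷ xs) (h ∷ hs) (p ∷ ps) le = gx≤fx ∷ product-tight xs hs ps
      (*-cancelˡ-≤ (g x) {{>-nonZero p}} (≤-trans le (*-monoˡ-≤ (product (map f xs)) h)))
    where
    gx≤fx : g x ≤ f x
    gx≤fx = *-cancelʳ-≤ (g x) (f x) (product (map g xs)) {{>-nonZero (product-pos xs ps)}}
      (≤-trans le (*-monoʳ-≤ (f x) (product-mono xs hs)))

∈-allSubsets : ∀ (B : Subset n) → B ∈L allSubsets n
∈-allSubsets [] = here refl
∈-allSubsets (inside ∷ B) = ∈-++⁺ˡ (∈-map⁺ (true ∷_) (∈-allSubsets B))
∈-allSubsets {suc n} (outside ∷ B) = ∈-++⁺ʳ (map (true ∷_) (allSubsets n)) (∈-map⁺ (false ∷_) (∈-allSubsets B))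

SameBlocks? : ∀ (P Q : List (Subset n)) → Dec (SameBlocks P Q)
SameBlocks? P Q = mapDec (λ (p , q) → (λ _ → All.lookup p) , (λ _ → All.lookup q)) (λ (p , q) → All.tabulate (p _) , All.tabulate (q _)) ((P ⊑? Q) ×-dec (Q ⊑? P))

module _ {r : ℕ} where
  open import Data.List.Membership.DecPropositional (_≟ᶠ_ {r}) using () renaming (_∈?_ to _∈ᶠ?_)

  length-allFin : length (allFin r) ≡ r
  length-allFin = length-tabulate id

  fresh : ∀ (xs : List (Fin r)) → length xs < r → ∃ λ m → m ∉L xs
  fresh xs lt with anyL? (λ m → ¬? (m ∈ᶠ? xs)) (allFin r)
  ... | yes a = let (m , _ , m∉) = find a in m , m∉
  ... | no ¬a = contradiction (≤-trans (≤-reflexive (sym length-allFin)) (unique-length-≤ (allFin⁺ r) (All.map (λ {m} ¬∉ → decidable-stable (m ∈ᶠ? xs) ¬∉) (¬Any⇒All¬ _ ¬a)))) (<⇒≱ lt)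

  -- Padding by arbitrary indices spares a separate treatment of fewer than three large families.
  extend-to-3 : 3 ≤ r → ∀ d (xs : List (Fin r)) → Unique xs → d + length xs ≡ 3 → ∃ λ ys → Unique ys × length ys ≡ 3 × All (_∈L ys) xs
  extend-to-3 3≤r zero xs u e = xs , u , e , All.tabulate id
  extend-to-3 3≤r (suc d) xs u e with fresh xs (≤-trans (≤-trans (s≤s (m≤n+m (length xs) d)) (≤-reflexive e)) 3≤r)
  ... | m , m∉ with extend-to-3 3≤r d (m ∷ xs) (¬Any⇒All¬ xs m∉ ∷ u) (trans (+-suc d _) e)
  ...   | ys , uys , len , h = ys , uys , len , All.tail h

-- Assembling the theorem

module Assembly (K c : ℕ) (3≤K : 3 ≤ K) (big : K ^ (2 * K) ≤ 2 ^ (2 * K + c)) (t : ℕ) (1≤t : 1 ≤ t)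
  (r : ℕ) (h : 3 ≤ r) (k : Fin r → ℕ)
  (admissible : ∀ i → Triples.Admissible K c 3≤K big t 1≤t (k i)) (k-last≤ : ∀ i → k (lastIdx r h) ≤ k i)
  (𝓕 : Fin r → Triples.Family K c 3≤K big t 1≤t) (fam : ∀ i → IsKFamily (Bounds.N K c 3≤K big) (k i) (𝓕 i))
  (cross : CrossIntersecting r h t 𝓕) (nontrivial : NonTrivial r t 𝓕) where

  open Bounds K c 3≤K big
  open Intersecting K c 3≤K big t 1≤t
  open Triples K c 3≤K big t 1≤t

  f A′ B′ W′ : Fin r → ℕ
  f i = length (𝓕 i)
  A′ i = A₊ (k i)
  B′ i = B₊ (k i)
  W′ i = W₊ (k i)

  B′-pos : ∀ i → 0 < B′ i
  B′-pos i = B-pos (proj₁ (admissible i)) (proj₂ (admissible i))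

  last : Fin r
  last = lastIdx r h

  RHS : ℕ
  RHS = W′ last * ∏init B′

  W+tB≡ : ∀ {j} → Admissible j → W₊ j + t * B₊ j ≡ suc t * A₊ j
  W+tB≡ {j} (p , q) = trans (lem t ((j ∸ t) * R₊ j) (B₊ j)) (cong (suc t *_) (sym (A≡ p q)))
    where
    lem : ∀ t x b → suc t * x + b + t * b ≡ suc t * (x + b)
    lem = solve-∀

  A-ratio : ∀ {i j} → Admissible i → Admissible j → i < j → A₊ j * B₊ i < A₊ i * B₊ j
  A-ratio {i} {j} (pi , qi) (pj , qj) i<j =
    subst₂ (λ x y → S x y * B₊ i < A₊ i * B₊ j) (∸-suc (t<N pj qj)) (∸-suc (<⇒≤ pj))
      (subst₂ (λ x y → S (suc (N ∸ suc t)) (suc (j ∸ suc t)) * B₊ i < S x y * B₊ j) (∸-suc (t<N pi qi)) (∸-suc (<⇒≤ pi))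
        (subst (λ m → S (suc m) (suc (j ∸ suc t)) * S m (i ∸ suc t) < S (suc m) (suc (i ∸ suc t)) * S m (j ∸ suc t)) (∸-suc 2+t≤N)
          (S-ratio-decreasing (N ∸ (2 + t)) (∸-monoˡ-< i<j (<⇒≤ pi)) (≤-trans (∸-monoˡ-≤ (suc t) (≤-trans qj (<⇒≤ K<N))) (≤-reflexive (sym (∸-suc 2+t≤N)))))))
    where
    2+t≤N : 2 + t ≤ N
    2+t≤N = ≤-trans pj (≤-trans qj (<⇒≤ K<N))

  -- The quotient W₊/B₊ is (t+1)A₊/B₊ - t and inherits the strict decrease of A₊/B₊.
  W-ratio : ∀ {i j} → Admissible i → Admissible j → i < j → W₊ j * B₊ i < W₊ i * B₊ j
  W-ratio {i} {j} ai aj i<j = +-cancelʳ-< (t * B₊ j * B₊ i) _ _ (begin-strict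
    W₊ j * B₊ i + t * B₊ j * B₊ i ≡⟨ sym (*-distribʳ-+ (B₊ i) (W₊ j) (t * B₊ j)) ⟩
    (W₊ j + t * B₊ j) * B₊ i ≡⟨ cong (_* B₊ i) (W+tB≡ aj) ⟩
    suc t * A₊ j * B₊ i ≡⟨ *-assoc (suc t) (A₊ j) (B₊ i) ⟩
    suc t * (A₊ j * B₊ i) <⟨ *-monoʳ-< (suc t) (A-ratio ai aj i<j) ⟩
    suc t * (A₊ i * B₊ j) ≡⟨ sym (*-assoc (suc t) (A₊ i) (B₊ j)) ⟩
    suc t * A₊ i * B₊ j ≡⟨ cong (_* B₊ j) (sym (W+tB≡ ai)) ⟩
    (W₊ i + t * B₊ i) * B₊ j ≡⟨ lem (W₊ i) t (B₊ i) (B₊ j) ⟩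
    W₊ i * B₊ j + t * B₊ j * B₊ i ∎)
    where
    open ≤-Reasoning
    lem : ∀ w t b d → (w + t * b) * d ≡ w * d + t * d * b
    lem = solve-∀

  allFin-last : ∃ λ rest → allFin r ↭ last ∷ rest × ∏init B′ ≡ product (map B′ rest)
  allFin-last with ∈⇒↭ (∈-allFin last)
  ... | rest , p = rest , p , product-↭ (map⁺ B′ (↭-trans (filter-↭ before? p) (↭-reflexive (trans (filter-reject before? ¬before-last) (filter-all before? before-rest)))))
    where
    before? = λ i → suc (toℕ i) <? r
    toℕ-last : ∀ r (h : 3 ≤ r) → suc (toℕ (lastIdx r h)) ≡ r
    toℕ-last (suc r) h = cong suc (toℕ-fromℕ r)
    ¬before-last : ¬ (suc (toℕ last) < r)
    ¬before-last lt = <-irrefl (toℕ-last r h) lt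
    before-rest : All (λ i → suc (toℕ i) < r) rest
    before-rest with Unique-↭ p (allFin⁺ r)
    ... | ≢last ∷ _ = All.map (λ {i} ne → ≤∧≢⇒< (toℕ<n i) (λ e → ne (toℕ-injective (suc-injective (trans (toℕ-last r h) (sym e)))))) ≢last

  -- moving the exceptional index to the last one, where k is smallest, increases the bound
  W-last-max : ∀ {a rest} → allFin r ↭ a ∷ rest → (k a ≡ k last × W′ a * product (map B′ rest) ≡ RHS) ⊎ W′ a * product (map B′ rest) < RHS
  W-last-max {a} {rest} p with allFin-last
  ... | rest′ , p′ , e rewrite e = by-cases (m≤n⇒m<n∨m≡n (k-last≤ a))
    where
    Π = product (map B′ rest)
    Π′ = product (map B′ rest′)
    same : B′ a * Π ≡ B′ last * Π′
    same = product-↭ (map⁺ B′ (↭-trans (↭-sym p) p′))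
    by-cases : k last < k a ⊎ k last ≡ k a → (k a ≡ k last × W′ a * Π ≡ W′ last * Π′) ⊎ W′ a * Π < W′ last * Π′
    by-cases (inj₂ e′) = inj₁ (sym e′ , cong₂ _*_ (cong W₊ (sym e′)) (*-cancelˡ-≡ Π Π′ (B′ a) {{>-nonZero (B′-pos a)}} (trans same (cong (λ j → B₊ j * Π′) e′))))
    by-cases (inj₁ lt) = inj₂ (*-cancelʳ-< (B′ a * B′ last) (W′ a * Π) (W′ last * Π′) (begin-strict
      W′ a * Π * (B′ a * B′ last) ≡⟨ lem (W′ a) Π (B′ a) (B′ last) ⟩
      W′ a * B′ last * (B′ a * Π) <⟨ *-monoˡ-< (B′ a * Π) {{>-nonZero (*-mono-≤ (B′-pos a) (product-pos rest (All.tabulate λ {i} _ → B′-pos i)))}} (W-ratio (admissible last) (admissible a) lt) ⟩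
      W′ last * B′ a * (B′ a * Π) ≡⟨ cong (W′ last * B′ a *_) same ⟩
      W′ last * B′ a * (B′ last * Π′) ≡⟨ lem₂ (W′ last) (B′ a) (B′ last) Π′ ⟩
      W′ last * Π′ * (B′ a * B′ last) ∎))
      where
      open ≤-Reasoning
      lem : ∀ w p a b → w * p * (a * b) ≡ w * b * (a * p)
      lem = solve-∀
      lem₂ : ∀ w a b p → w * a * (b * p) ≡ w * p * (a * b)
      lem₂ = solve-∀

  RHS-pos : 0 < RHS
  RHS-pos with allFin-last
  ... | rest , _ , e = *-mono-≤ (≤-trans (s≤s z≤n) (A<W (proj₁ (admissible last)) (proj₂ (admissible last))))
      (≤-trans (product-pos rest (All.tabulate λ {i} _ → B′-pos i)) (≤-reflexive (sym e)))

  EqualityCase : Set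
  EqualityCase = ∃[ a ] (k a ≡ k last
               × ∃[ T ] (SingletonPartition (t + 1) T
                  × (∀ P → P ∈L 𝓕 a → t ≤ length (common T P))
                  × (∀ P → IsKPartition N (k a) P → t ≤ length (common T P)
                       → Any (SameBlocks P) (𝓕 a))
                  × (∀ i → i ≢ a
                       → (∀ P → P ∈L 𝓕 i → All (_∈L P) T)
                          × (∀ P → IsKPartition N (k i) P → All (_∈L P) T
                               → Any (SameBlocks P) (𝓕 i)))))

  module NonEmpty (member : ∀ i → ∃ λ P → P ∈L 𝓕 i) where

    -- The other r - 3 families contribute arbitrary members, which is where non-emptiness of all
    -- families enters.
    with-members : ∀ {i j l} → i ≢ j → i ≢ l → j ≢ l → Cross₃ (𝓕 i) (𝓕 j) (𝓕 l)
    with-members {i} {j} {l} i≢j i≢l j≢l {A} {B} {D} A∈ B∈ D∈ =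
      interAll r h G , Uniqueₚ.filter⁺ (λ B → allF? (λ i → B ∈? G i)) (partition-unique (All.lookup (proj₁ (fam last)) (G∈ last))) , cross G G∈ ,
      at i (λ P → interAll r h G ⊑ P) at-i (sub i) , at j (λ P → interAll r h G ⊑ P) at-j (sub j) , at l (λ P → interAll r h G ⊑ P) at-l (sub l)
      where
      choose : ∀ m → Dec (m ≡ i) → Dec (m ≡ j) → Dec (m ≡ l) → List (Subset N)
      choose m (yes _) _ _ = A
      choose m (no _) (yes _) _ = B
      choose m (no _) (no _) (yes _) = D
      choose m (no _) (no _) (no _) = proj₁ (member m)
      choose∈ : ∀ m di dj dl → choose m di dj dl ∈L 𝓕 m
      choose∈ m (yes refl) _ _ = A∈
      choose∈ m (no _) (yes refl) _ = B∈
      choose∈ m (no _) (no _) (yes refl) = D∈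
      choose∈ m (no _) (no _) (no _) = proj₂ (member m)
      G : Fin r → List (Subset N)
      G m = choose m (m ≟ᶠ i) (m ≟ᶠ j) (m ≟ᶠ l)
      G∈ : ∀ m → G m ∈L 𝓕 m
      G∈ m = choose∈ m (m ≟ᶠ i) (m ≟ᶠ j) (m ≟ᶠ l)
      sub : ∀ m → interAll r h G ⊑ G m
      sub m = All.tabulate λ B∈ → proj₂ (∈-filter⁻ (λ B → allF? (λ i → B ∈? G i)) {xs = G last} B∈) m
      at : ∀ m (Q : List (Subset N) → Set) {P} → G m ≡ P → Q (G m) → Q P
      at m Q = subst Q
      at-i : G i ≡ A
      at-i with i ≟ᶠ i
      ... | yes _ = refl
      ... | no ne = contradiction refl ne
      at-j : G j ≡ B
      at-j with j ≟ᶠ i | j ≟ᶠ j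
      ... | yes e | _ = contradiction (sym e) i≢j
      ... | no _ | yes _ = refl
      ... | no _ | no ne = contradiction refl ne
      at-l : G l ≡ D
      at-l with l ≟ᶠ i | l ≟ᶠ j | l ≟ᶠ l
      ... | yes e | _ | _ = contradiction (sym e) i≢l
      ... | no _ | yes e | _ = contradiction (sym e) j≢l
      ... | no _ | no _ | yes _ = refl
      ... | no _ | no _ | no ne = contradiction refl ne

    third : ∀ i j → ∃ λ m → i ≢ m × j ≢ m
    third i j with fresh (i ∷ j ∷ []) h
    ... | m , m∉ = m , (λ e → m∉ (here (sym e))) , (λ e → m∉ (there (here (sym e))))

    pair-meet : ∀ {i j A B} → i ≢ j → A ∈L 𝓕 i → B ∈L 𝓕 j → ∃ λ Q → Unique Q × t ≤ length Q × Q ⊑ A × Q ⊑ B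
    pair-meet {i} {j} i≢j A∈ B∈ with third i j
    ... | m , i≢m , j≢m = let (Q , u , l , a , b , _) = with-members i≢j i≢m j≢m A∈ B∈ (proj₂ (member m)) in Q , u , l , a , b

    not-common : ∀ X → Unique X → t ≤ length X → ¬ (∀ m → All (X ⊑_) (𝓕 m))
    not-common X uX le all = contradiction (≤-trans le (unique-length-≤ uX (All.tabulate λ {B} B∈ →
        ∈-filter⁺ (λ B → allF? (λ i → allL? (B ∈?_) (𝓕 i))) (∈-allSubsets B) (λ i → All.map (λ X⊑P → All.lookup X⊑P B∈) (all i)))))
      (<⇒≱ nontrivial)

    module _ {i j} (i≢j : i ≢ j) {A B : List (Subset N)} (A∈ : A ∈L 𝓕 i) (B∈ : B ∈L 𝓕 j) {X : List (Subset N)} (X≤t : length X ≤ t)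
             (greatest : ∀ {Q} → Q ⊑ A → Q ⊑ B → Q ⊑ X) where

      core-length : t ≤ length X
      core-length = let (Q , u , l , a , b) = pair-meet i≢j A∈ B∈ in ≤-trans l (⊑-length u (greatest a b))

      -- With a member of a third family A and B share at least t blocks, all inside X; since |X| ≤
      -- t, they are all of X.
      core-others : ∀ m → i ≢ m → j ≢ m → All (X ⊑_) (𝓕 m)
      core-others m i≢m j≢m = All.tabulate λ M∈ → let (Q , u , l , a , b , d) = with-members i≢j i≢m j≢m A∈ B∈ M∈ in
        ⊑-trans (⊑-flip u (greatest a b) (≤-trans X≤t l)) d

    good-or-bad : ∀ {i j} → i ≢ j → Cross (suc t) (𝓕 i) (𝓕 j) ⊎ Bad (𝓕 i) (𝓕 j)
    good-or-bad {i} {j} i≢j with allL? (λ A → allL? (λ B → suc t ≤? meet A B) (𝓕 j)) (𝓕 i)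
    ... | yes good = inj₁ (λ A∈ B∈ → All.lookup (All.lookup good A∈) B∈)
    ... | no ¬good with find (¬All⇒Any¬ (λ A → allL? (λ B → suc t ≤? meet A B) (𝓕 j)) (𝓕 i) ¬good)
    ...   | A , A∈ , ¬goodA with find (¬All⇒Any¬ (λ B → suc t ≤? meet A B) (𝓕 j) ¬goodA)
    ...     | B , B∈ , ¬le = inj₂ (record
      { B∈ = A∈ ; D∈ = B∈ ; core = X₀ ; core-unique = uX ; core-small = X≤t
      ; core⊑B = common-⊑ˡ A B ; core⊑D = common-⊑ʳ A B ; core-greatest = ⊑-common A B
      ; nontrivial = λ (p , q) → not-common X₀ uX (core-length i≢j A∈ B∈ X≤t (⊑-common A B)) λ m → case i ≟ᶠ m of λ where
          (yes refl) → p
          (no i≢m) → case j ≟ᶠ m of λ where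
            (yes refl) → q
            (no j≢m) → core-others i≢j A∈ B∈ X≤t (⊑-common A B) m i≢m j≢m })
      where
      X₀ = common A B
      uX : Unique X₀
      uX = common-unique A B (partition-unique (All.lookup (proj₁ (fam i)) A∈))
      X≤t : length X₀ ≤ t
      X≤t = s≤s⁻¹ (≰⇒> ¬le)

    -- Two disjoint bad pairs would make their cores a common t-set of all the families.
    no-two-bad : ∀ {i j l m} → i ≢ j → l ≢ m → i ≢ l → i ≢ m → j ≢ l → j ≢ m → Bad (𝓕 i) (𝓕 j) → ¬ Bad (𝓕 l) (𝓕 m)
    no-two-bad {i} {j} {l} {m} i≢j l≢m i≢l i≢m j≢l j≢m b₁ b₂ = b₁.nontrivial (on i (i≢l ∘ sym) (i≢m ∘ sym) , on j (j≢l ∘ sym) (j≢m ∘ sym))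
      where
      module b₁ = Bad b₁
      module b₂ = Bad b₂
      others₁ = core-others i≢j b₁.B∈ b₁.D∈ b₁.core-small b₁.core-greatest
      others₂ = core-others l≢m b₂.B∈ b₂.D∈ b₂.core-small b₂.core-greatest
      core₁⊑core₂ : b₁.core ⊑ b₂.core
      core₁⊑core₂ = b₂.core-greatest (All.lookup (others₁ l i≢l j≢l) b₂.B∈) (All.lookup (others₁ m i≢m j≢m) b₂.D∈)
      on : ∀ x → l ≢ x → m ≢ x → All (b₁.core ⊑_) (𝓕 x)
      on x l≢x m≢x = All.map (⊑-trans core₁⊑core₂) (others₂ x l≢x m≢x)

    Large : Fin r → Set
    Large i = B′ i < f i

    -- A good pair is cross (t+1)-intersecting, and `pair-bound` with s = t + 1 keeps its product
    -- within `B′ i * B′ j`.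
    large-bad : ∀ {i j} → i ≢ j → Large i → Large j → Bad (𝓕 i) (𝓕 j)
    large-bad {i} {j} i≢j Li Lj with good-or-bad i≢j
    ... | inj₂ b = b
    ... | inj₁ good = contradiction
        (pair-bound (fam i) (fam j) good (proj₂ (admissible i)) (proj₂ (admissible j)) (s≤s z≤n) (proj₁ (admissible i)) (proj₁ (admissible j)))
        (<⇒≱ (*-mono-< Li Lj))

    at-most-3-large : ∀ xs → Unique xs → All Large xs → length xs ≤ 3
    at-most-3-large [] _ _ = z≤n
    at-most-3-large (_ ∷ []) _ _ = s≤s z≤n
    at-most-3-large (_ ∷ _ ∷ []) _ _ = s≤s (s≤s z≤n)
    at-most-3-large (_ ∷ _ ∷ _ ∷ []) _ _ = ≤-refl
    at-most-3-large (i ∷ j ∷ l ∷ m ∷ _) ((i≢j ∷ i≢l ∷ i≢m ∷ _) ∷ (j≢l ∷ j≢m ∷ _) ∷ (l≢m ∷ _) ∷ _) (Li ∷ Lj ∷ Ll ∷ Lm ∷ _) =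
      ⊥-elim (no-two-bad i≢j l≢m i≢l i≢m j≢l j≢m (large-bad i≢j Li Lj) (large-bad l≢m Ll Lm))

    Outcome : Set
    Outcome = ∃ λ a → ∃ λ rest → allFin r ↭ a ∷ rest ×
      ((Star (k a) (𝓕 a) × product (map f rest) ≤ product (map B′ rest)) ⊎ f a * product (map f rest) < W′ a * product (map B′ rest))

    arrange : ∀ {a b d rest} → allFin r ↭ a ∷ b ∷ d ∷ rest → All (λ i → f i ≤ B′ i) rest →
      (Star (k a) (𝓕 a) × f b * f d ≤ B′ b * B′ d) ⊎ f a * (f b * f d) < W′ a * (B′ b * B′ d) → Outcome
    arrange {a} {b} {d} {rest} p small (inj₁ (s , le)) = a , b ∷ d ∷ rest , p , inj₁ (s , (begin
      f b * (f d * product (map f rest)) ≡⟨ sym (*-assoc (f b) (f d) _) ⟩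
      f b * f d * product (map f rest) ≤⟨ *-mono-≤ le (product-mono rest small) ⟩
      B′ b * B′ d * product (map B′ rest) ≡⟨ *-assoc (B′ b) (B′ d) _ ⟩
      B′ b * (B′ d * product (map B′ rest)) ∎))
      where open ≤-Reasoning
    arrange {a} {b} {d} {rest} p small (inj₂ lt) = a , b ∷ d ∷ rest , p , inj₂ (begin-strict
      f a * (f b * (f d * product (map f rest))) ≡⟨ lem (f a) (f b) (f d) _ ⟩
      f a * (f b * f d) * product (map f rest) <⟨ *-<-≤ lt (product-mono rest small) (product-pos rest (All.tabulate λ {i} _ → B′-pos i)) ⟩
      W′ a * (B′ b * B′ d) * product (map B′ rest) ≡⟨ sym (lem (W′ a) (B′ b) (B′ d) _) ⟩
      W′ a * (B′ b * (B′ d * product (map B′ rest))) ∎)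
      where
      open ≤-Reasoning
      lem : ∀ a b d x → a * (b * (d * x)) ≡ a * (b * d) * x
      lem = solve-∀

    good-outcome : ∀ {a b d rest} → a ≢ b → a ≢ d → b ≢ d → Cross (suc t) (𝓕 b) (𝓕 d) → allFin r ↭ a ∷ b ∷ d ∷ rest →
      All (λ i → f i ≤ B′ i) rest → Outcome
    good-outcome {a} {b} {d} a≢b a≢d b≢d good p small = arrange p small
      (good-pair (fam a) (fam b) (fam d) (admissible a) (admissible b) (admissible d) (with-members a≢b a≢d b≢d) good (proj₂ (member b)) (proj₂ (member d)))

    triple-outcome : ∀ {i j l rest} → i ≢ j → i ≢ l → j ≢ l → allFin r ↭ i ∷ j ∷ l ∷ rest → All (λ i → f i ≤ B′ i) rest → Outcome
    triple-outcome {i} {j} {l} i≢j i≢l j≢l p small with good-or-bad j≢l | good-or-bad i≢l | good-or-bad i≢j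
    ... | inj₁ good | _ | _ = good-outcome i≢j i≢l j≢l good p small
    ... | inj₂ _ | inj₁ good | _ = good-outcome (i≢j ∘ sym) j≢l i≢l good (↭-trans p (_↭_.swap i j ↭-refl)) small
    ... | inj₂ _ | inj₂ _ | inj₁ good = good-outcome (i≢l ∘ sym) (j≢l ∘ sym) i≢j good (↭-trans p (shift l (i ∷ j ∷ []) _)) small
    ... | inj₂ jl | inj₂ il | inj₂ ij = arrange p small (inj₂ (triple-bound (record
      { famA = fam i ; famB = fam j ; famD = fam l ; adA = admissible i ; adB = admissible j ; adD = admissible l
      ; cross = with-members i≢j i≢l j≢l ; badBD = jl ; badAD = il ; badAB = ij })))

    outcome : Outcome
    outcome with extend-to-3 h (3 ∸ length large) large uL (m∸n+n≡m (at-most-3-large large uL (Allₚ.all-filter large? (allFin r))))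
      where
      large? : ∀ i → Dec (Large i)
      large? i = B′ i <? f i
      large = filter large? (allFin r)
      uL : Unique large
      uL = Uniqueₚ.filter⁺ large? (allFin⁺ r)
    ... | i ∷ j ∷ l ∷ [] , u@((i≢j ∷ i≢l ∷ []) ∷ (j≢l ∷ []) ∷ _) , _ , large⊑ with ⊆⇒↭ u (All.tabulate (λ {m} _ → ∈-allFin m))
    ...   | rest , p = triple-outcome i≢j i≢l j≢l p (All.tabulate small)
      where
      small : ∀ {m} → m ∈L rest → f m ≤ B′ m
      small {m} m∈ = ≮⇒≥ λ Lm → distinct (All.lookup large⊑ (∈-filter⁺ (λ i → B′ i <? f i) (∈-allFin m) Lm)) (Unique-↭ p (allFin⁺ r))
        where
        distinct : m ∈L (i ∷ j ∷ l ∷ []) → ¬ Unique (i ∷ j ∷ l ∷ rest)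
        distinct (here refl) ((_ ∷ _ ∷ h) ∷ _) = All.lookup h m∈ refl
        distinct (there (here refl)) (_ ∷ (_ ∷ h) ∷ _) = All.lookup h m∈ refl
        distinct (there (there (here refl))) (_ ∷ _ ∷ h ∷ _) = All.lookup h m∈ refl

    ∏f≡ : ∀ {a rest} → allFin r ↭ a ∷ rest → ∏ f ≡ f a * product (map f rest)
    ∏f≡ p = product-↭ (map⁺ f p)

    add-partition : ∀ {i P} → IsKPartition N (k i) P → ¬ Any (SameBlocks P) (𝓕 i) → IsKFamily N (k i) (P ∷ 𝓕 i)
    add-partition {i} part ∉ = part ∷ proj₁ (fam i) , ¬Any⇒All¬ (𝓕 i) ∉ ∷ proj₂ (fam i)

    -- If y ∈ T is not in F then F meets every A ⊇ T - z (z ≠ y) outside T - z, so there are too few such A.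
    others-contain : ∀ {a i T} → Unique T → length T ≡ suc t → All (λ F → t ≤ meet T F) (𝓕 a) → W′ a ≤ f a → i ≢ a → All (T ⊑_) (𝓕 i)
    others-contain {a} {i} {T} uT lenT meets W≤f i≢a = All.tabulate λ {F} F∈ → All.tabulate λ {y} y∈ → decidable-stable (y ∈? F) λ y∉F → absurd F∈ y∈ y∉F
      where
      open ≤-Reasoning
      ad = admissible a
      absurd : ∀ {F y} → F ∈L 𝓕 i → y ∈L T → y ∉L F → ⊥₀
      absurd {F} {y} F∈ y∈ y∉F with remove y T | length-remove uT y∈ | remove-⊑ y T | remove-∌ y T
      ... | [] | e | _ | _ = contradiction (≤-trans 1≤t (≤-reflexive (suc-injective (trans (sym lenT) (sym e))))) λ ()
      ... | z ∷ _ | _ | z∈ ∷ _ | ∌y = contradiction W≤f (<⇒≱ (begin-strict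
        f a ≤⟨ split-bound (fam a) (proj₁ ad) (proj₂ ad) uT lenT meets z∈ (λ X uX eq _ → deg≤A (fam a) (proj₁ ad) X uX eq) ⟩
        deg (𝓕 a) X₀ + t * A′ a ≤⟨ +-monoˡ-≤ (t * A′ a) (deg-extend (𝓕 a) extends (λ B B∉ → deg≤B (fam a) (proj₁ ad) (B ∷ X₀) (¬Any⇒All¬ X₀ B∉ ∷ uX) (cong suc lenX))) ⟩
        K * B′ a + t * A′ a <⟨ few ⟩
        W′ a ∎))
        where
        X₀ = remove z T
        uX = remove-unique z uT
        lenX : length X₀ ≡ t
        lenX = suc-injective (trans (length-remove uT z∈) lenT)
        y∈X : y ∈L X₀
        y∈X = ∈-filter⁺ (λ D → ¬? (D ≟ₛ z)) y∈ (λ e → ∌y (here e))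
        extends : Extends K (𝓕 a) X₀
        extends = extends-by (≤-trans (≤-reflexive (proj₂ (All.lookup (proj₁ (fam i)) F∈))) (proj₂ (admissible i)))
          (≰⇒> λ le → y∉F (All.lookup (meet-full X₀ F uX (≤-trans (≤-reflexive lenX) le)) y∈X))
          (λ A∈ → let (Q , u , l , p , q) = pair-meet (i≢a ∘ sym) A∈ F∈ in Q , u , l , p , q)
        K+t<K² : K + t < K * K
        K+t<K² = ≤-trans (+-monoʳ-< K (≤-trans (<⇒≤ (proj₁ ad)) (proj₂ ad))) (≤-trans (≤-reflexive (cong (K +_) (sym (+-identityʳ K)))) (*-monoˡ-≤ K (≤-trans (n≤1+n 2) 3≤K)))
        -- As W = (t+1)A - tB, the claim is (K + t)B < A, which follows from A ≥ K²B.
        few : K * B′ a + t * A′ a < W′ a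
        few = +-cancelʳ-< (t * B′ a) _ _ (begin-strict
          K * B′ a + t * A′ a + t * B′ a ≡⟨ lem K t (B′ a) (A′ a) ⟩
          (K + t) * B′ a + t * A′ a <⟨ +-monoˡ-< (t * A′ a) (*-monoˡ-< (B′ a) {{>-nonZero (B′-pos a)}} K+t<K²) ⟩
          K * K * B′ a + t * A′ a ≤⟨ +-monoˡ-≤ (t * A′ a) (K²B≤A ad) ⟩
          suc t * A′ a ≡⟨ sym (W+tB≡ ad) ⟩
          W′ a + t * B′ a ∎)
          where
          lem : ∀ K t b a → K * b + t * a + t * b ≡ (K + t) * b + t * a
          lem = solve-∀

    conclude : Outcome → ∏ f < RHS ⊎ (∏ f ≤ RHS × (∏ f ≡ RHS → EqualityCase))
    conclude (a , rest , p , inj₂ lt) = inj₁ (≤-<-trans (≤-reflexive (∏f≡ p)) (<-≤-trans lt (case W-last-max p of λ where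
      (inj₁ (_ , e)) → ≤-reflexive e
      (inj₂ l) → <⇒≤ l)))
    conclude (a , rest , p , inj₁ ((T , uT , lenT , ss , meets , fa≤) , rest≤)) with W-last-max p
    ... | inj₂ lt = inj₁ (≤-<-trans (≤-trans (≤-reflexive (∏f≡ p)) (*-mono-≤ fa≤ rest≤)) lt)
    ... | inj₁ (ka≡ , W≡RHS) = inj₂ (≤-trans (≤-trans (≤-reflexive (∏f≡ p)) (*-mono-≤ fa≤ rest≤)) (≤-reflexive W≡RHS) , λ eq → equality (trans (sym (∏f≡ p)) (trans eq (sym W≡RHS))))
      where
      ad = admissible a
      rest-pos : All (λ i → 0 < B′ i) rest
      rest-pos = All.tabulate λ {i} _ → B′-pos i
      ΠB = product (map B′ rest)
      Πf = product (map f rest)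
      equality : f a * Πf ≡ W′ a * ΠB → EqualityCase
      equality eq = a , ka≡ , T , (trans lenT (+-comm 1 t) , uT , ss) , (λ P P∈ → All.lookup meets P∈) , complete-a , others
        where
        W≤fa : W′ a ≤ f a
        W≤fa = *-cancelʳ-≤ (W′ a) (f a) ΠB {{>-nonZero (product-pos rest rest-pos)}} (≤-trans (≤-reflexive (sym eq)) (*-monoʳ-≤ (f a) rest≤))
        W-pos : 0 < W′ a
        W-pos = ≤-trans (s≤s z≤n) (A<W (proj₁ ad) (proj₂ ad))
        ΠB≤Πf : ΠB ≤ Πf
        ΠB≤Πf = *-cancelˡ-≤ (W′ a) {{>-nonZero W-pos}} (≤-trans (≤-reflexive (sym eq)) (*-monoˡ-≤ Πf fa≤))
        contain : ∀ i → i ≢ a → All (T ⊑_) (𝓕 i)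
        contain i i≢a = others-contain uT lenT meets W≤fa i≢a
        rest-≢a : All (λ i → i ≢ a) rest
        rest-≢a with Unique-↭ p (allFin⁺ r)
        ... | ne ∷ _ = All.map (λ x → x ∘ sym) ne
        -- `rest≤` bounds only a product. The single bounds come from T lying in all members of the
        -- other families, and then equality of the products passes to each factor.
        tight : All (λ i → B′ i ≤ f i) rest
        tight = product-tight rest (All.map (λ {i} i≢a → length≤B (fam i) (proj₁ (admissible i)) T uT lenT (contain i i≢a)) rest-≢a) rest-pos ΠB≤Πf
        complete-a : ∀ P → IsKPartition N (k a) P → t ≤ length (common T P) → Any (SameBlocks P) (𝓕 a)
        complete-a P part le = decidable-stable (anyL? (SameBlocks? P) (𝓕 a)) λ ∉ →
          contradiction (singletons-bound (add-partition part ∉) (proj₁ ad) (proj₂ ad) uT lenT (le ∷ meets) ss) (<⇒≱ (s≤s W≤fa))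
        others : ∀ i → i ≢ a → (∀ P → P ∈L 𝓕 i → All (_∈L P) T) × (∀ P → IsKPartition N (k i) P → All (_∈L P) T → Any (SameBlocks P) (𝓕 i))
        others i i≢a = (λ P P∈ → All.lookup (contain i i≢a) P∈) , λ P part T⊑P → decidable-stable (anyL? (SameBlocks? P) (𝓕 i)) λ ∉ →
          contradiction (length≤B (add-partition part ∉) (proj₁ (admissible i)) T uT lenT (T⊑P ∷ contain i i≢a)) (<⇒≱ (s≤s (All.lookup tight i∈rest)))
          where
          i∈rest : i ∈L rest
          i∈rest with ∈-resp-↭ p (∈-allFin i)
          ... | here e = contradiction e i≢a
          ... | there i∈ = i∈

  Conclusion : Set
  Conclusion = ∏ f ≤ RHS × (∏ f ≡ RHS → EqualityCase)

  strict : ∏ f < RHS → Conclusion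
  strict lt = <⇒≤ lt , λ e → contradiction e (<⇒≢ lt)

  conclusion : Conclusion
  conclusion with allL? (λ i → 1 ≤? f i) (allFin r)
  ... | yes ne = [ strict , id ]′ (conclude outcome)
    where
    first : ∀ {i} → 1 ≤ length (𝓕 i) → ∃ λ P → P ∈L 𝓕 i
    first {i} le with 𝓕 i
    ... | P ∷ _ = P , here refl
    member : ∀ i → ∃ λ P → P ∈L 𝓕 i
    member i = first (All.lookup ne (∈-allFin i))
    open NonEmpty member
  ... | no ¬ne = strict (≤-<-trans (≤-reflexive zero-product) RHS-pos)
    where
    zero-product : ∏ f ≡ 0
    zero-product with find (¬All⇒Any¬ (λ i → 1 ≤? f i) (allFin r) ¬ne)
    ... | i , i∈ , ¬le with ∈⇒↭ i∈
    ...   | rest , p = trans (product-↭ (map⁺ f p)) (cong (_* product (map f rest)) (n<1⇒n≡0 (≰⇒> ¬le)))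

-- From the hypotheses of the theorem to the parameters K and c

-- From 2^(2K) ≤ K^(2K) the exponent is at least 2K, hence positive. So the truncated subtraction is
-- a true one, and c = n - K - 5 is a natural number.
big-exponent : ∀ {K n} → 3 ≤ K → K ^ (2 * K) ≤ 2 ^ (n + K ∸ 5) → ∃ λ c → K + 5 + c ≡ n × K ^ (2 * K) ≤ 2 ^ (2 * K + c)
big-exponent {K} {n} 3≤K h with n + K ∸ 5 in eq
... | e = c , K+5+c≡n , subst (λ z → K ^ (2 * K) ≤ 2 ^ z) (sym (m+[n∸m]≡n 2K≤e)) h
  where
  open ≤-Reasoning
  c = e ∸ 2 * K
  2K≤e : 2 * K ≤ e
  2K≤e = ≮⇒≥ λ e<2K → contradiction (≤-trans (^-monoˡ-≤ (2 * K) (≤-trans (n≤1+n 2) 3≤K)) h) (<⇒≱ (^-monoʳ-< 2 ≤-refl e<2K))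
  0<e : 0 < e
  0<e = ≤-trans (≤-trans (s≤s z≤n) 3≤K) (≤-trans (m≤m+n K (K + 0)) 2K≤e)
  5≤n+K : 5 ≤ n + K
  5≤n+K = <⇒≤ (m∸n≢0⇒n<m {n + K} {5} λ z → contradiction 0<e (<⇒≱ (s≤s (≤-reflexive (trans (sym eq) z)))))
  K+5+c≡n : K + 5 + c ≡ n
  K+5+c≡n = +-cancelʳ-≡ K _ _ (trans (lem K c) (trans (cong (5 +_) (m+[n∸m]≡n 2K≤e)) (trans (cong (5 +_) (sym eq)) (m+[n∸m]≡n 5≤n+K))))
    where
    lem : ∀ K c → K + 5 + c + K ≡ 5 + (2 * K + c)
    lem = solve-∀

first≤ : ∀ r (h : 3 ≤ r) (i : Fin r) → firstIdx r h ≤ᶠ i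
first≤ (suc r) h i = z≤n

≤last : ∀ r (h : 3 ≤ r) (i : Fin r) → i ≤ᶠ lastIdx r h
≤last (suc r) h i = ≤fromℕ i

theorem1p6 : (r t n : ℕ) (h : 3 ≤ r) → 1 ≤ t
  → (k : Fin r → ℕ)
  → (∀ (i j : Fin r) → i ≤ᶠ j → k j ≤ k i)
  → t + 2 ≤ k (lastIdx r h)
  → k (firstIdx r h) ^ (2 * k (firstIdx r h)) ≤ 2 ^ (n + k (firstIdx r h) ∸ 5)
  → (𝓕 : Fin r → List (List (Subset n)))
  → (∀ i → IsKFamily n (k i) (𝓕 i))
  → CrossIntersecting r h t 𝓕
  → NonTrivial r t 𝓕
  → let kr = k (lastIdx r h)
        RHS = ((t + 1) * S (n ∸ t) (kr ∸ t) ∸ t * S (n ∸ t ∸ 1) (kr ∸ t ∸ 1))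
              * ∏init (λ i → S (n ∸ t ∸ 1) (k i ∸ t ∸ 1))
    in ∏ (λ i → length (𝓕 i)) ≤ RHS
       × (∏ (λ i → length (𝓕 i)) ≡ RHS
          → ∃[ a ] (k a ≡ kr
             × ∃[ T ] (SingletonPartition (t + 1) T
                × (∀ P → P ∈L 𝓕 a → t ≤ length (common T P))
                × (∀ P → IsKPartition n (k a) P → t ≤ length (common T P)
                     → Any (SameBlocks P) (𝓕 a))
                × (∀ i → i ≢ a
                     → (∀ P → P ∈L 𝓕 i → All (_∈L P) T)
                        × (∀ P → IsKPartition n (k i) P → All (_∈L P) T
                             → Any (SameBlocks P) (𝓕 i))))))
theorem1p6 r t n h 1≤t k mono t+2≤k big 𝓕 fam cross nontrivial
  with big-exponent {k (firstIdx r h)} {n} (≤-trans (+-monoˡ-≤ 2 1≤t) (≤-trans t+2≤k (mono (firstIdx r h) (lastIdx r h) (first≤ r h (lastIdx r h))))) big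
... | c , refl , big′ = subst (λ b → ∏ f ≤ b × (∏ f ≡ b → EqualityCase)) RHS≡ conclusion
  where
  K = k (firstIdx r h)
  2+t≤k : 2 + t ≤ k (lastIdx r h)
  2+t≤k = ≤-trans (≤-reflexive (+-comm 2 t)) t+2≤k
  k-last≤ : ∀ i → k (lastIdx r h) ≤ k i
  k-last≤ i = mono i (lastIdx r h) (≤last r h i)
  3≤K : 3 ≤ K
  3≤K = ≤-trans (+-monoʳ-≤ 2 1≤t) (≤-trans 2+t≤k (k-last≤ (firstIdx r h)))
  open Bounds K c 3≤K big′ using (N)
  open Intersecting K c 3≤K big′ t 1≤t using (A₊; B₊; W₊)
  admissible : ∀ i → 2 + t ≤ k i × k i ≤ K
  admissible i = ≤-trans 2+t≤k (k-last≤ i) , mono (firstIdx r h) i (first≤ r h i)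
  open Assembly K c 3≤K big′ t 1≤t r h k admissible k-last≤ 𝓕 fam cross nontrivial
  S≡ : ∀ j → S (N ∸ t ∸ 1) (j ∸ t ∸ 1) ≡ B₊ j
  S≡ j = cong₂ S (trans (∸-+-assoc N t 1) (cong (N ∸_) (+-comm t 1))) (trans (∸-+-assoc j t 1) (cong (j ∸_) (+-comm t 1)))
  W≡′ : (t + 1) * A₊ (k last) ∸ t * S (N ∸ t ∸ 1) (k last ∸ t ∸ 1) ≡ W₊ (k last)
  W≡′ = trans (cong₂ (λ x y → x * A₊ (k last) ∸ t * y) (+-comm t 1) (S≡ (k last)))
    (trans (cong (_∸ t * B₊ (k last)) (sym (W+tB≡ (admissible last)))) (m+n∸n≡m (W₊ (k last)) (t * B₊ (k last))))
  RHS≡ : RHS ≡ ((t + 1) * S (N ∸ t) (k last ∸ t) ∸ t * S (N ∸ t ∸ 1) (k last ∸ t ∸ 1)) * ∏init (λ i → S (N ∸ t ∸ 1) (k i ∸ t ∸ 1))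
  RHS≡ = sym (cong₂ _*_ W≡′ (cong product (map-cong (λ i → S≡ (k i)) (filter (λ i → suc (toℕ i) <? r) (allFin r)))))
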